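{- Let $\mathcal{T}$ be the class of all Pólya trees, and let $\operatorname{MSET}^{(\ge 2)}(\mathcal{T})$ be the class of all multisets (forests) of Pólya trees in which each tree appears at least twice if it appears at all. Let $D(z)=\sum_{n\ge 0}d_nz^n=\exp\left(\sum_{i\ge 2}\frac{T(z^i)}{i}\right)$, where $T(z)$ is the ordinary generating function of Pólya trees. Then for all $n\ge 0$ $$d_n=\sum_{\substack{F\in \operatorname{MSET}^{(\ge 2)}(\mathcal{T})\\ |F|=n}}\frac{|\{\sigma\in\operatorname{Aut}(F) : \sigma_1=0\}|}{|\operatorname{Aut}(F)|},$$ where $\operatorname{Aut}(F)$ is the automorphism group of $F$. Furthermore, the polynomial $t_{c,n}(u)$ associated to $C$-trees in Pólya trees of size $n$ is given by $$t_{c,n}(u)=\sum_{T\in\mathcal{T},\ |T|=n}t_T(u),\qquad\text{where}\qquad t_T(u)=\frac{1}{|\operatorname{Aut}(T)|}\sum_{\sigma\in\operatorname{Aut}(T)}u^{\sigma_1}.$$ In particular, for all $T\in\mathcal{T}$ we have $t_T'(1)=|\mathcal{P}(T)|$, where $\mathcal{P}(T)$ is the set of all trees which are obtained by pointing (or coloring) one single node in $T$.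
   Context: A Pólya tree is a rooted unlabelled non-plane tree (an isomorphism class of finite rooted trees with at least one node); its size $|T|$ is its number of nodes. The size $|F|$ of a forest (multiset of Pólya trees) is its total number of nodes; the empty forest, of size $0$, belongs to $\operatorname{MSET}^{(\ge 2)}(\mathcal{T})$. Let $t_n$ be the number of Pólya trees of size $n$ and $T(z)=\sum_{n\ge1}t_nz^n$; it satisfies $T(z)=z\exp\left(\sum_{i\ge1}T(z^i)/i\right)$. Automorphisms are those of rooted trees, respectively forests of rooted trees, regarded as permutations of the nodes (roots are mapped to roots, and components of a forest may be permuted). For a permutation $\sigma$, $\sigma_1$ is the number of fixed points (cycles of length 1), i.e. the number of nodes fixed by $\sigma$. The polynomials $t_{c,n}(u)$ are defined as $t_{c,n}(u)=[z^n]T_c(z,u)$, where $T_c(z,u)$ is the unique formal power series in $z$ (with coefficients polynomials in $u$ and zero constant term) satisfying $T_c(z,u)=zu\exp(T_c(z,u))D(z)$. (The coefficient of $u^k$ in $t_{c,n}(u)$ is the cumulative weight of all $C$-trees of size $k$ contained in Pólya trees of size $n$.) Elements of $\mathcal{P}(T)$ are rooted unlabelled non-plane trees with one distinguished node, considered up to isomorphism. -}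

module Defs where

open import Level using (0ℓ)
open import Function.Base using (_∘_)
open import Data.Nat.Base as ℕ using (ℕ; zero; suc; _∸_; _!; NonZero)
import Data.Nat.DivMod as ℕ
open import Data.Nat.Divisibility using (_∣?_)
import Data.Nat.Properties as ℕ
open import Data.Integer.Base using (+_)
open import Data.Rational.Base as ℚ using (ℚ; 0ℚ; 1ℚ; _/_)
open import Data.Fin.Base using (Fin; zero; suc; toℕ; splitAt; _↑ˡ_; _↑ʳ_; punchIn)
import Data.Fin.Properties as Fin
open import Data.Fin.Permutation as Perm
  using (Permutation; Permutation′; _⟨$⟩ʳ_; insert; remove; insert-remove; insert-punchIn)
  renaming (_≈_ to _≗ᴾ_)
open import Data.Maybe.Base as Maybe using (Maybe; just; nothing; maybe)
import Data.Maybe.Properties as Maybe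
open import Data.List.Base as List
  using (List; []; _∷_; _++_; length; filter; concatMap; allFin; deduplicate; lookup)
open import Data.List.Membership.Propositional using (_∈_; find; lose)
open import Data.List.Membership.Propositional.Properties
  using (∈-filter⁺; ∈-concatMap⁺; ∈-concatMap⁻; ∈-map⁺; ∈-map⁻; ∈-allFin; ∈-length)
open import Data.List.Relation.Unary.All as All using (All)
open import Data.List.Relation.Unary.Any as Any using (Any; here; there)
open import Data.Product.Base using (Σ; ∃; _×_; _,_)
open import Data.Sum.Base using ([_,_]′)
open import Relation.Nullary using (Dec; does)
open import Relation.Nullary.Decidable as Dec using (_×-dec_)
open import Relation.Binary.PropositionalEquality
  using (_≡_; refl; sym; trans; cong)
open import Data.Bool.Base using (if_then_else_)
open import Algebra.Bundles.Raw using (RawSemiring)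
import Algebra.Definitions.RawSemiring as RawSemiringOps

-- A rooted forest on the nodes Fin n is given by its parent map; the roots
-- are the nodes without a parent.
Parents : ℕ → Set
Parents n = Fin n → Maybe (Fin n)

IsIso : ∀ {m n} → Parents m → Parents n → Permutation m n → Set
IsIso p q π = ∀ i → Maybe.map (π ⟨$⟩ʳ_) (p i) ≡ q (π ⟨$⟩ʳ i)

isIso? : ∀ {m n} (p : Parents m) (q : Parents n) π → Dec (IsIso p q π)
isIso? p q π = Fin.all? λ i →
  Maybe.≡-dec Fin._≟_ (Maybe.map (π ⟨$⟩ʳ_) (p i)) (q (π ⟨$⟩ʳ i))

infix 4 _≅_ _≅?_

_≅_ : ∀ {m n} → Parents m → Parents n → Set
_≅_ {m} {n} p q = ∃ λ (π : Permutation m n) → IsIso p q π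

-- Every permutation, exactly once up to pointwise equality _≗ᴾ_.
permutations : ∀ m n → List (Permutation m n)
permutations zero    zero    = Perm.id ∷ []
permutations zero    (suc n) = []
permutations (suc m) zero    = []
permutations (suc m) (suc n) =
  concatMap (λ j → List.map (insert zero j) (permutations m n)) (allFin (suc n))

insert-cong : ∀ {m n} j {π ρ : Permutation m n} →
              π ≗ᴾ ρ → insert zero j π ≗ᴾ insert zero j ρ
insert-cong j         π≈ρ zero    = refl
insert-cong j {π} {ρ} π≈ρ (suc k) =
  trans (insert-punchIn zero j π k)
        (trans (cong (punchIn j) (π≈ρ k)) (sym (insert-punchIn zero j ρ k)))

permutations-complete : ∀ {m n} (π : Permutation m n) → ∃ λ ρ → ρ ∈ permutations m n × ρ ≗ᴾ π
permutations-complete {zero}  {zero}  π = Perm.id , here refl , λ ()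
permutations-complete {zero}  {suc n} π with Perm.refute (λ ()) π
... | ()
permutations-complete {suc m} {zero}  π with π ⟨$⟩ʳ zero
... | ()
permutations-complete {suc m} {suc n} π with permutations-complete (remove zero π)
... | ρ , ρ∈ , ρ≈ =
  insert zero j ρ ,
  ∈-concatMap⁺ (λ i → List.map (insert zero i) (permutations m n))
    (lose (∈-allFin j) (∈-map⁺ (insert zero j) ρ∈)) ,
  λ k → trans (insert-cong j ρ≈ k) (insert-remove zero π k)
  where j = π ⟨$⟩ʳ zero

IsIso-resp-≈ : ∀ {m n} {p : Parents m} {q : Parents n} {π ρ} →
               ρ ≗ᴾ π → IsIso p q π → IsIso p q ρ
IsIso-resp-≈ {p = p} {q} ρ≈π iso i =
  trans (Maybe.map-cong ρ≈π (p i)) (trans (iso i) (cong q (sym (ρ≈π i))))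

_≅?_ : ∀ {m n} (p : Parents m) (q : Parents n) → Dec (p ≅ q)
_≅?_ {m} {n} p q = Dec.map′
  (λ any → let π , _ , iso = find any in π , iso)
  (λ (π , iso) → let ρ , ρ∈ , ρ≈π = permutations-complete π in
                 lose ρ∈ (IsIso-resp-≈ {p = p} {q} {π} {ρ} ρ≈π iso))
  (Any.any? (isIso? p q) (permutations m n))

automorphisms : ∀ {n} → Parents n → List (Permutation′ n)
automorphisms {n} p = filter (isIso? p p) (permutations n n)

∣Aut_∣ : ∀ {n} → Parents n → ℕ
∣Aut p ∣ = length (automorphisms p)

∣Aut∣≢0 : ∀ {n} (p : Parents n) → NonZero ∣Aut p ∣
∣Aut∣≢0 p =
  let ρ , ρ∈ , ρ≈id = permutations-complete Perm.id in
  ℕ.>-nonZero (∈-length (∈-filter⁺ (isIso? p p) ρ∈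
    (IsIso-resp-≈ {p = p} {p} {Perm.id} {ρ} ρ≈id λ i → Maybe.map-id (p i))))

fixedPoints : ∀ {n} → Permutation′ n → ℕ
fixedPoints {n} σ = length (filter (λ i → σ ⟨$⟩ʳ i Fin.≟ i) (allFin n))

derangementProportion : ∀ {n} → Parents n → ℚ
derangementProportion p =
  + length (filter (λ σ → fixedPoints σ ℕ.≟ 0) (automorphisms p)) / ∣Aut p ∣
  where instance _ = ∣Aut∣≢0 p

-- Unlabelled objects are represented by plane ones, and always taken up to
-- the isomorphisms _≅_ of the underlying non-plane objects.
data Tree : Set where
  node : List Tree → Tree

Forest : Set
Forest = List Tree

∣_∣ᵗ : Tree → ℕ
∣_∣ᶠ : Forest → ℕ
∣ node F ∣ᵗ = suc ∣ F ∣ᶠ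
∣ [] ∣ᶠ     = 0
∣ T ∷ F ∣ᶠ  = ∣ T ∣ᵗ ℕ.+ ∣ F ∣ᶠ

-- Nodes are numbered in preorder.
parentᵗ : (T : Tree) → Parents ∣ T ∣ᵗ
parentᶠ : (F : Forest) → Parents ∣ F ∣ᶠ
parentᵗ (node F) zero    = nothing
parentᵗ (node F) (suc i) = just (maybe suc zero (parentᶠ F i))
parentᶠ (T ∷ F) i =
  [ Maybe.map (_↑ˡ ∣ F ∣ᶠ) ∘ parentᵗ T
  , Maybe.map (∣ T ∣ᵗ ↑ʳ_) ∘ parentᶠ F
  ]′ (splitAt ∣ T ∣ᵗ i)

-- The forests obtained by adding a leaf on the left: as a new first tree, or
-- as a new first child of a node on the leftmost branch.  Each nonempty plane
-- forest arises in this way from exactly one smaller one.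
grow : Forest → List Forest
grow []           = (node [] ∷ []) ∷ []
grow (node F ∷ G) = (node [] ∷ node F ∷ G) ∷ List.map (λ F′ → node F′ ∷ G) (grow F)

planeForests : ℕ → List Forest
planeForests zero    = [] ∷ []
planeForests (suc n) = concatMap grow (planeForests n)

grow-surjective : ∀ T F → ∃ λ G → T ∷ F ∈ grow G × suc ∣ G ∣ᶠ ≡ ∣ T ∷ F ∣ᶠ
grow-surjective (node [])        []           = [] , here refl , refl
grow-surjective (node [])        (node G ∷ F) = node G ∷ F , here refl , refl
grow-surjective (node (T ∷ G))   F with grow-surjective T G
... | H , T∷G∈ , eq =
  node H ∷ F , there (∈-map⁺ (λ F′ → node F′ ∷ F) T∷G∈) , cong (λ k → suc (k ℕ.+ ∣ F ∣ᶠ)) eq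

planeForests-complete : ∀ n F → ∣ F ∣ᶠ ≡ n → F ∈ planeForests n
planeForests-complete zero    []           eq = here refl
planeForests-complete zero    (node _ ∷ _) ()
planeForests-complete (suc n) (T ∷ F)      eq with grow-surjective T F
... | G , T∷F∈ , eq′ =
  ∈-concatMap⁺ grow
    (lose (planeForests-complete n G (ℕ.suc-injective (trans eq′ eq))) T∷F∈)

grow-size : ∀ G {F} → F ∈ grow G → ∣ F ∣ᶠ ≡ suc ∣ G ∣ᶠ
grow-size []           (here refl) = refl
grow-size (node _ ∷ _) (here refl) = refl
grow-size (node F ∷ G) (there F′∈) with ∈-map⁻ (λ F′ → node F′ ∷ G) F′∈
... | _ , H∈ , refl = cong (λ k → suc (k ℕ.+ ∣ G ∣ᶠ)) (grow-size F H∈)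

planeForests-sound : ∀ n F → F ∈ planeForests n → ∣ F ∣ᶠ ≡ n
planeForests-sound zero    _ (here refl) = refl
planeForests-sound (suc n) F F∈ with find (∈-concatMap⁻ grow F∈)
... | G , G∈ , F∈G = trans (grow-size G F∈G) (cong suc (planeForests-sound n G G∈))

planeTrees : ℕ → List Tree
planeTrees zero    = []
planeTrees (suc n) = List.map node (planeForests n)

infix 4 _≅ᵗ_ _≅ᵗ?_ _∼_ _∼?_ _≅•_ _≅•?_

_≅ᵗ_ : Tree → Tree → Set
T ≅ᵗ U = parentᵗ T ≅ parentᵗ U

_≅ᵗ?_ : ∀ T U → Dec (T ≅ᵗ U)
T ≅ᵗ? U = parentᵗ T ≅? parentᵗ U

polyaTrees : ℕ → List Tree
polyaTrees n = deduplicate _≅ᵗ?_ (planeTrees n)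

multiplicity : Tree → Forest → ℕ
multiplicity T F = length (filter (T ≅ᵗ?_) F)

-- Equality of multisets of Pólya trees.  A tree occurring in neither F nor G
-- has multiplicity 0 in both.
_∼_ : Forest → Forest → Set
F ∼ G = All (λ T → multiplicity T F ≡ multiplicity T G) (F ++ G)

_∼?_ : ∀ F G → Dec (F ∼ G)
F ∼? G = All.all? (λ T → multiplicity T F ℕ.≟ multiplicity T G) (F ++ G)

Repeated : Forest → Set
Repeated F = All (λ T → 2 ℕ.≤ multiplicity T F) F

repeated? : ∀ F → Dec (Repeated F)
repeated? F = All.all? (λ T → 2 ℕ.≤? multiplicity T F) F

MSET≥2 : ℕ → List Forest
MSET≥2 n = deduplicate _∼?_ (filter repeated? (planeForests n))

PointedTree : Set
PointedTree = Σ Tree λ T → Fin ∣ T ∣ᵗ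

_≅•_ : PointedTree → PointedTree → Set
(T , v) ≅• (U , w) =
  ∃ λ π → IsIso (parentᵗ T) (parentᵗ U) π × π ⟨$⟩ʳ v ≡ w

_≅•?_ : ∀ P Q → Dec (P ≅• Q)
(T , v) ≅•? (U , w) = Dec.map′
  (λ any → let π , _ , iso = find any in π , iso)
  (λ (π , iso , eq) → let ρ , ρ∈ , ρ≈π = permutations-complete π in
    lose ρ∈ (IsIso-resp-≈ {p = parentᵗ T} {parentᵗ U} {π} {ρ} ρ≈π iso , trans (ρ≈π v) eq))
  (Any.any? (λ π → isIso? (parentᵗ T) (parentᵗ U) π ×-dec (π ⟨$⟩ʳ v Fin.≟ w))
            (permutations ∣ T ∣ᵗ ∣ U ∣ᵗ))

pointings : Tree → List PointedTree
pointings T = deduplicate _≅•?_ (List.map (T ,_) (allFin ∣ T ∣ᵗ))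

-- Formal power series over a ℚ-algebra R with structure map ι.
module PowerSeries (R : RawSemiring 0ℓ 0ℓ) (ι : ℚ → RawSemiring.Carrier R) where

  open RawSemiring R
  open RawSemiringOps R using (sum) public

  ∑ : {A : Set} → List A → (A → Carrier) → Carrier
  ∑ xs f = sum (f ∘ lookup xs)

  Series : Set
  Series = ℕ → Carrier

  monomial : Carrier → ℕ → Series
  monomial a k n = if does (n ℕ.≟ k) then a else 0#

  series : RawSemiring 0ℓ 0ℓ
  series = record
    { Carrier = Series
    ; _≈_     = λ A B → ∀ n → A n ≈′ B n
    ; _+_     = λ A B n → A n + B n
    ; _*_     = λ A B n → sum {suc n} λ k → A (toℕ k) * B (n ∸ toℕ k)
    ; 0#      = λ _ → 0#
    ; 1#      = monomial 1# 0
    }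
    where open RawSemiring R renaming (_≈_ to _≈′_) using ()

  open RawSemiring series public using () renaming (_≈_ to _≈ˢ_; _*_ to _*ˢ_)
  open RawSemiringOps series using (_^_)

  infixr 7 _·_

  _·_ : ℚ → Series → Series
  (q · A) n = ι q * A n

  -- The sum of the series A 0, A 1, …, provided that A k has no term of
  -- degree below k.
  ∑∞ : (ℕ → Series) → Series
  ∑∞ A n = sum {suc n} λ k → A (toℕ k) n

  -- Only meaningful for series with zero constant term.
  exp : Series → Series
  exp A = ∑∞ λ k → ((+ 1 / k !) {{k ℕ.!≢0}}) · (A ^ k)

  infix 8 _⟨z^_⟩

  _⟨z^_⟩ : Series → (i : ℕ) .{{_ : NonZero i}} → Series
  (A ⟨z^ i ⟩) n = if does (i ∣? n) then A (n ℕ./ i) else 0#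

-- Polynomials in u as lists of coefficients, constant term first, up to trailing zeros.
Poly : Set
Poly = List ℚ

coeff : Poly → ℕ → ℚ
coeff []      k       = 0ℚ
coeff (a ∷ p) zero    = a
coeff (a ∷ p) (suc k) = coeff p k

infixl 6 _+ᵖ_
infixl 7 _*ᵖ_

_+ᵖ_ : Poly → Poly → Poly
[]      +ᵖ q       = q
(a ∷ p) +ᵖ []      = a ∷ p
(a ∷ p) +ᵖ (b ∷ q) = (a ℚ.+ b) ∷ (p +ᵖ q)

_*ᵖ_ : Poly → Poly → Poly
[]      *ᵖ q = []
(a ∷ p) *ᵖ q = List.map (a ℚ.*_) q +ᵖ (0ℚ ∷ p *ᵖ q)

constᵖ : ℚ → Poly
constᵖ a = a ∷ []

u : Poly
u = 0ℚ ∷ 1ℚ ∷ []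

polynomials : RawSemiring 0ℓ 0ℓ
polynomials = record
  { Carrier = Poly
  ; _≈_     = λ p q → ∀ k → coeff p k ≡ coeff q k
  ; _+_     = _+ᵖ_
  ; _*_     = _*ᵖ_
  ; 0#      = []
  ; 1#      = constᵖ 1ℚ
  }

open RawSemiring polynomials public using () renaming (_≈_ to _≈ᵖ_)
open RawSemiringOps polynomials public using () renaming (_^_ to _^ᵖ_)

-- (a + u p)′ = p + u p′
_′ : Poly → Poly
[] ′      = []
(a ∷ p) ′ = p +ᵖ (0ℚ ∷ p ′)

eval : Poly → ℚ → ℚ
eval []      x = 0ℚ
eval (a ∷ p) x = a ℚ.+ x ℚ.* eval p x

module ℚ⟦z⟧    = PowerSeries ℚ.+-*-rawSemiring (λ q → q)
module ℚ[u]⟦z⟧ = PowerSeries polynomials constᵖ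

T[z] : ℚ⟦z⟧.Series
T[z] n = + length (polyaTrees n) / 1

D[z] : ℚ⟦z⟧.Series
D[z] = exp (∑∞ λ j → (+ 1 / suc (suc j)) · (T[z] ⟨z^ suc (suc j) ⟩))
  where open ℚ⟦z⟧

IsCTreeSeries : ℚ[u]⟦z⟧.Series → Set
IsCTreeSeries Tc =
  Tc 0 ≈ᵖ [] ×
  Tc ≈ˢ monomial u 1 *ˢ exp Tc *ˢ (constᵖ ∘ D[z])
  where open ℚ[u]⟦z⟧

treePolynomial : Tree → Poly
treePolynomial T =
  constᵖ (+ 1 / ∣Aut p ∣) *ᵖ ∑ (automorphisms p) λ σ → u ^ᵖ fixedPoints σ
  where
  open ℚ[u]⟦z⟧
  p = parentᵗ T
  instance _ = ∣Aut∣≢0 p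

{-# OPTIONS --safe #-}
module Submission where

-- Let H(z,u) sum, over the isomorphism classes of forests, the mean of u^(fixed nodes) over the
-- automorphism group, and let G be the same sum over trees.  Roots are fixed, so G = z u H, and
-- everything follows from H = exp(G) D: for u = 0 it reads H(z,0) = D, where only forests with all
-- trees repeated contribute, and in general it is the defining equation of the C-tree series.
--
-- H = exp(G) D is proved by comparing logarithmic derivatives: both sides satisfy
-- z F′ = (z G′ + Σ_{i≥2} z^i T′(z^i)) F, and F 0 = 1.  For H this says that for a forest with m copies
-- of T the mean P_m satisfies m P_m = P_T P_{m-1} + P_{m-2} + ⋯ + P_0.  That recursion comes
-- from inclusion–exclusion over the components mapped to themselves: replacing the weight of one copy
-- of T by 1 changes the total weight by (Z_T − |Aut T|) times the total weight without this copy, and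
-- the unweighted totals are given by |Aut(T ∷ F)| = (1 + multiplicity of T in F) |Aut T| |Aut F|.
--
-- The statement on pointings is Burnside's lemma for the action of Aut T on the nodes.

-- The textbook route writes Aut(F) as a product of wreath products and sums over cycle types. No
-- wreath product is formed here. Colours on the nodes let one component at a time gain or lose its
-- weight, and three facts about automorphisms suffice: those fixing the root of the first tree are
-- pairs, the others fix no node of this tree, and the images of the root are the roots of the
-- copies of this tree. For m copies of T next to a forest R without copies, this leads to Σ P_m z^m
-- = P_R exp(x z)/(1 - z) with x = P_T - 1, which is P_R exp(P_T z + z²/2 + z³/3 + ⋯). The terms
-- z^i/i are the origin of D, the term P_T z that of exp(G). Morally H is the product of such
-- factors over all T, with z^|T| for z. The logarithmic derivative replaces this infinite product
-- by a sum that is finite in each degree: n = |F| is distributed over the copies of each T in F,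
-- and the recursion for P_m is summed over all F of size n. The coefficient ring and its element u
-- stay arbitrary, because the result is used twice: in ℚ with u = 0, and in ℚ[u] with the variable
-- u.

open import Defs
open import Level using (0ℓ)
open import Algebra.Bundles using (CommutativeRing; Monoid; Semiring)
open import Function.Base using (_∘_; id; flip; const; case_of_)
open import Data.Bool.Base using (Bool; true; false; if_then_else_; _∧_)
open import Data.Empty using (⊥-elim)
open import Data.Fin.Base using (Fin; zero; suc; toℕ; fromℕ<; splitAt; join; _↑ˡ_; _↑ʳ_)
import Data.Fin.Properties as Fin
open import Data.Fin.Permutation as Perm
  using (Permutation; Permutation′; _⟨$⟩ʳ_; _⟨$⟩ˡ_; permutation; _∘ₚ_)
  renaming (_≈_ to _≗ᴾ_)
open import Data.Integer.Base as ℤ using (+_)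
import Data.Integer.Properties as ℤ
open import Data.List.Base as List
  using (List; []; _∷_; _++_; length; filter; lookup; allFin; tabulate; replicate; deduplicate; cartesianProduct)
import Data.List.Properties as List
open import Data.List.Membership.Propositional using (_∈_; find; lose)
open import Data.List.Membership.Propositional.Properties
  using (∈-filter⁺; ∈-filter⁻; ∈-++⁺ˡ; ∈-++⁺ʳ; ∈-∃++; ∈-map⁺; ∈-map⁻; ∈-allFin; ∈-lookup; ∈-cartesianProduct⁺; ∈-cartesianProduct⁻)
open import Data.List.Relation.Binary.Permutation.Propositional as ↭ using (_↭_; prep; ↭-sym)
open import Data.List.Relation.Binary.Permutation.Propositional.Properties using (shift; ↭-length; filter-↭)
open import Data.List.Relation.Unary.All as All using (All; []; _∷_)
import Data.List.Relation.Unary.All.Properties as All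
open import Data.List.Relation.Unary.AllPairs as AllPairs using (AllPairs; []; _∷_)
import Data.List.Relation.Unary.AllPairs.Properties as AllPairs
open import Data.List.Relation.Unary.Any as Any using (Any; here; there)
import Data.List.Relation.Unary.Any.Properties as Any
import Data.List.Relation.Unary.Unique.Propositional.Properties as Unique
open import Data.Maybe.Base as Maybe using (Maybe; just; nothing; maybe)
import Data.Maybe.Properties as Maybe
open import Data.Nat.Base as ℕ using (ℕ; zero; suc; z≤n; s≤s; _!)
import Data.Nat.Properties as ℕ
import Data.Nat.DivMod as ℕ
open import Data.Nat.Divisibility using (_∣?_; divides)
open import Data.Product using (Σ; ∃; ∃!; _×_; _,_; proj₁; proj₂)
open import Data.Rational.Base as ℚ using (ℚ; 0ℚ; 1ℚ; _/_; toℚᵘ)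
import Data.Rational.Properties as ℚ
open import Data.Rational.Unnormalised.Base as ℚᵘ using (mkℚᵘ; *≡*)
import Data.Rational.Unnormalised.Properties as ℚᵘ
open import Data.Sum.Base using (inj₁; inj₂)
open import Data.Vec.Functional using () renaming (_++_ to _⊹_)
open import Data.Vec.Functional.Properties using (lookup-++ˡ; lookup-++ʳ)
open import Relation.Nullary using (¬_; Dec; yes; no; does; ¬?)
open import Relation.Nullary.Decidable using (dec-true; dec-false; _×-dec_)
open import Relation.Binary.PropositionalEquality as ≡ using (_≡_; _≢_; refl; cong; cong₂; subst)
import Algebra.Properties.CommutativeMonoid.Sum ℕ.+-0-commutativeMonoid as ℕΣ

-- Lists of representatives of equivalence classes, and sums over them

record Enumeration {A : Set} (_≈_ : A → A → Set) (P : A → Set) (xs : List A) : Set where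
  field
    sound    : ∀ {x} → x ∈ xs → P x
    complete : ∀ {x} → P x → ∃ λ y → y ∈ xs × x ≈ y
    unique   : AllPairs (λ x y → ¬ x ≈ y) xs

AllPairs-lookup-injective : ∀ {A : Set} {_≈_ : A → A → Set} → (∀ {x y} → x ≈ y → y ≈ x) →
  ∀ {xs} → AllPairs (λ x y → ¬ x ≈ y) xs → ∀ i j → lookup xs i ≈ lookup xs j → i ≡ j
AllPairs-lookup-injective s (_ ∷ _) zero zero eq = refl
AllPairs-lookup-injective s (x≉ ∷ _) zero (suc j) eq = ⊥-elim (All.lookup x≉ (∈-lookup j) eq)
AllPairs-lookup-injective s (x≉ ∷ _) (suc i) zero eq = ⊥-elim (All.lookup x≉ (∈-lookup i) (s eq))
AllPairs-lookup-injective s (_ ∷ u) (suc i) (suc j) eq = cong suc (AllPairs-lookup-injective s u i j eq)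

Any-index : ∀ {A : Set} {P : A → Set} {xs : List A} → Any P xs → ∃ λ i → P (lookup xs i)
Any-index a = Any.index a , Any.lookup-index a

enum-filter : ∀ {A : Set} {_≈_ : A → A → Set} {P : A → Set} {xs} {Q : A → Set} (Q? : ∀ x → Dec (Q x)) →
  (∀ {x y} → x ≈ y → Q x → Q y) → Enumeration _≈_ P xs → Enumeration _≈_ (λ x → P x × Q x) (filter Q? xs)
enum-filter {xs = xs} Q? resp e = record
  { sound = λ x∈ → let x∈xs , q = ∈-filter⁻ Q? {xs = xs} x∈ in sound x∈xs , q
  ; complete = λ (p , q) → let y , y∈ , x≈y = complete p in y , ∈-filter⁺ Q? y∈ (resp x≈y q) , x≈y
  ; unique = AllPairs.filter⁺ Q? unique
  }
  where open Enumeration e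

AllPairs-cartesianProduct : ∀ {A B : Set} {_≈_ : A → A → Set} {_∼_ : B → B → Set} {xs ys} →
  AllPairs (λ x y → ¬ x ≈ y) xs → AllPairs (λ x y → ¬ x ∼ y) ys →
  AllPairs (λ p q → ¬ (proj₁ p ≈ proj₁ q × proj₂ p ∼ proj₂ q)) (cartesianProduct xs ys)
AllPairs-cartesianProduct [] v = []
AllPairs-cartesianProduct {xs = x ∷ xs} {ys} (x≉ ∷ u) v = AllPairs.++⁺
  (AllPairs.map⁺ (AllPairs.map (λ n e → n (proj₂ e)) v))
  (AllPairs-cartesianProduct u v)
  (All.map⁺ (All.tabulate λ _ → All.tabulate λ q∈ e →
    All.lookup x≉ (proj₁ (∈-cartesianProduct⁻ xs ys q∈)) (proj₁ e)))

enum-product : ∀ {A B : Set} {_≈_ : A → A → Set} {_∼_ : B → B → Set} {P : A → Set} {Q : B → Set} {xs ys} →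
  Enumeration _≈_ P xs → Enumeration _∼_ Q ys →
  Enumeration (λ p q → proj₁ p ≈ proj₁ q × proj₂ p ∼ proj₂ q) (λ p → P (proj₁ p) × Q (proj₂ p)) (cartesianProduct xs ys)
enum-product {xs = xs} {ys} e₁ e₂ = record
  { sound = λ p∈ → let x∈ , y∈ = ∈-cartesianProduct⁻ xs ys p∈ in E₁.sound x∈ , E₂.sound y∈
  ; complete = λ (p , q) → let x , x∈ , ≈x = E₁.complete p ; y , y∈ , ≈y = E₂.complete q in
      (x , y) , ∈-cartesianProduct⁺ x∈ y∈ , ≈x , ≈y
  ; unique = AllPairs-cartesianProduct E₁.unique E₂.unique
  }
  where
  module E₁ = Enumeration e₁
  module E₂ = Enumeration e₂

module _ (M : Monoid 0ℓ 0ℓ) where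
  open Monoid M using (Carrier; _≈_; ∙-congˡ; identityˡ; assoc; trans; sym; _∙_)
  open import Algebra.Properties.Monoid.Sum M using (sum)

  sum-split : ∀ m {n} (f : Fin (m ℕ.+ n) → Carrier) → sum f ≈ (sum (f ∘ (_↑ˡ n)) ∙ sum (f ∘ (m ↑ʳ_)))
  sum-split zero    f = sym (identityˡ _)
  sum-split (suc m) f = trans (∙-congˡ (sum-split m (f ∘ suc))) (sym (assoc _ _ _))

module Sums (K : CommutativeRing 0ℓ 0ℓ) where

  open CommutativeRing K hiding (zero; refl)
  open import Algebra.Properties.Semiring.Sum semiring public
    using (sum; sum-cong-≋; sum-permute; ∑-distrib-+; ∑-comm; sum-replicate-zero; *-distribˡ-sum; *-distribʳ-sum)
  open import Algebra.Properties.Semiring.Mult semiring public using (×-homo-+; ×1-homo-*; ×-assoc-*) renaming (_×_ to _·ₙ_; ×-congʳ to ·ₙ-congʳ)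
  open import Relation.Binary.Reasoning.Setoid setoid

  ι : ℕ → Carrier
  ι n = n ·ₙ 1#

  ·ₙ≈ι* : ∀ n x → n ·ₙ x ≈ ι n * x
  ·ₙ≈ι* n x = sym (trans (×-assoc-* n 1# x) (·ₙ-congʳ n (*-identityˡ x)))

  sum-zero : ∀ {n} {f : Fin n → Carrier} → (∀ i → f i ≈ 0#) → sum f ≈ 0#
  sum-zero {n} h = trans (sum-cong-≋ h) (sum-replicate-zero n)

  Σ< : ℕ → (ℕ → Carrier) → Carrier
  Σ< n f = sum {n} (f ∘ toℕ)

  Σ<-last : ∀ n f → Σ< (suc n) f ≈ Σ< n f + f n
  Σ<-last zero    f = +-comm _ _
  Σ<-last (suc n) f = trans (+-congˡ (Σ<-last n (f ∘ suc))) (sym (+-assoc _ _ _))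

  Σ<-cong : ∀ n f g → (∀ k → k ℕ.< n → f k ≈ g k) → Σ< n f ≈ Σ< n g
  Σ<-cong n f g h = sum-cong-≋ λ i → h (toℕ i) (Fin.toℕ<n i)

  Σ<-zero : ∀ n f → (∀ k → k ℕ.< n → f k ≈ 0#) → Σ< n f ≈ 0#
  Σ<-zero n f h = sum-zero λ i → h (toℕ i) (Fin.toℕ<n i)

  Σ<-+ : ∀ n f g → Σ< n (λ k → f k + g k) ≈ Σ< n f + Σ< n g
  Σ<-+ n f g = ∑-distrib-+ {n} (f ∘ toℕ) (g ∘ toℕ)

  Σ<-*ˡ : ∀ n c f → c * Σ< n f ≈ Σ< n (λ k → c * f k)
  Σ<-*ˡ n c f = *-distribˡ-sum {n} c (f ∘ toℕ)

  Σ<-*ʳ : ∀ n c f → Σ< n f * c ≈ Σ< n (λ k → f k * c)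
  Σ<-*ʳ n c f = *-distribʳ-sum {n} c (f ∘ toℕ)

  Σ<-swap : ∀ m n (f : ℕ → ℕ → Carrier) → Σ< m (λ i → Σ< n (f i)) ≈ Σ< n (λ j → Σ< m (λ i → f i j))
  Σ<-swap m n f = ∑-comm (λ (i : Fin m) (j : Fin n) → f (toℕ i) (toℕ j))

  opaque
    ∑ : {A : Set} → List A → (A → Carrier) → Carrier
    ∑ xs f = sum (f ∘ lookup xs)

    ∑-lookup : ∀ {A : Set} (xs : List A) (f : A → Carrier) → ∑ xs f ≡ sum (f ∘ lookup xs)
    ∑-lookup xs f = refl

    ∑-[] : ∀ {A : Set} {f : A → Carrier} → ∑ [] f ≈ 0#
    ∑-[] = CommutativeRing.refl K

    ∑-∷ : ∀ {A : Set} x (xs : List A) {f : A → Carrier} → ∑ (x ∷ xs) f ≈ f x + ∑ xs f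
    ∑-∷ x xs = CommutativeRing.refl K

    ∑-+ : ∀ {A : Set} (xs : List A) (f g : A → Carrier) → ∑ xs (λ x → f x + g x) ≈ ∑ xs f + ∑ xs g
    ∑-+ xs f g = ∑-distrib-+ (f ∘ lookup xs) (g ∘ lookup xs)

    ∑-*ˡ : ∀ {A : Set} (xs : List A) c (f : A → Carrier) → c * ∑ xs f ≈ ∑ xs (λ x → c * f x)
    ∑-*ˡ xs c f = *-distribˡ-sum c (f ∘ lookup xs)

    ∑-*ʳ : ∀ {A : Set} (xs : List A) c (f : A → Carrier) → ∑ xs f * c ≈ ∑ xs (λ x → f x * c)
    ∑-*ʳ xs c f = *-distribʳ-sum c (f ∘ lookup xs)

    ∑-swap : ∀ {A B : Set} (xs : List A) (ys : List B) (f : A → B → Carrier) →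
             ∑ xs (λ x → ∑ ys (f x)) ≈ ∑ ys (λ y → ∑ xs (λ x → f x y))
    ∑-swap xs ys f = ∑-comm (λ i j → f (lookup xs i) (lookup ys j))

    ∑-sum : ∀ {A : Set} {n} (xs : List A) (f : A → Fin n → Carrier) →
            ∑ xs (λ x → sum (f x)) ≈ sum (λ i → ∑ xs (λ x → f x i))
    ∑-sum xs f = ∑-comm (f ∘ lookup xs)

  [_]· : ∀ {P : Set} → Dec P → Carrier → Carrier
  [ d ]· x = if does d then x else 0#

  ∑-cong : ∀ {A : Set} (xs : List A) {f g : A → Carrier} → (∀ {x} → x ∈ xs → f x ≈ g x) → ∑ xs f ≈ ∑ xs g
  ∑-cong []       h = trans ∑-[] (sym ∑-[])
  ∑-cong (x ∷ xs) h = trans (∑-∷ x xs) (trans (+-cong (h (here refl)) (∑-cong xs (h ∘ there))) (sym (∑-∷ x xs)))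

  ∑-zero : ∀ {A : Set} (xs : List A) {f : A → Carrier} → (∀ {x} → x ∈ xs → f x ≈ 0#) → ∑ xs f ≈ 0#
  ∑-zero xs {f} h = trans (reflexive (∑-lookup xs f)) (sum-zero λ i → h (∈-lookup {xs = xs} i))

  ∑-++ : ∀ {A : Set} (xs ys : List A) (f : A → Carrier) → ∑ (xs ++ ys) f ≈ ∑ xs f + ∑ ys f
  ∑-++ []       ys f = trans (sym (+-identityˡ _)) (+-congʳ (sym ∑-[]))
  ∑-++ (x ∷ xs) ys f = begin
    ∑ (x ∷ xs ++ ys) f          ≈⟨ ∑-∷ x _ ⟩
    f x + ∑ (xs ++ ys) f        ≈⟨ +-congˡ (∑-++ xs ys f) ⟩
    f x + (∑ xs f + ∑ ys f)     ≈⟨ +-assoc _ _ _ ⟨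
    f x + ∑ xs f + ∑ ys f       ≈⟨ +-congʳ (∑-∷ x xs) ⟨
    ∑ (x ∷ xs) f + ∑ ys f       ∎

  ∑-map : ∀ {A B : Set} (xs : List A) (h : A → B) (f : B → Carrier) → ∑ (List.map h xs) f ≈ ∑ xs (f ∘ h)
  ∑-map []       h f = trans ∑-[] (sym ∑-[])
  ∑-map (x ∷ xs) h f = trans (∑-∷ (h x) _) (trans (+-congˡ (∑-map xs h f)) (sym (∑-∷ x xs)))

  ∑-cartesianProduct : ∀ {A B : Set} (xs : List A) (ys : List B) (f : A → B → Carrier) →
    ∑ (cartesianProduct xs ys) (λ p → f (proj₁ p) (proj₂ p)) ≈ ∑ xs (λ x → ∑ ys (f x))
  ∑-cartesianProduct []       ys f = trans ∑-[] (sym ∑-[])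
  ∑-cartesianProduct (x ∷ xs) ys f =
    trans (∑-++ (List.map (x ,_) ys) (cartesianProduct xs ys) _)
          (trans (+-cong (∑-map ys (x ,_) _) (∑-cartesianProduct xs ys f)) (sym (∑-∷ x xs)))

  ∑-filter : ∀ {A : Set} {P : A → Set} (P? : ∀ x → Dec (P x)) xs (f : A → Carrier) →
             ∑ (filter P? xs) f ≈ ∑ xs (λ x → [ P? x ]· (f x))
  ∑-filter P? []       f = trans ∑-[] (sym ∑-[])
  ∑-filter P? (x ∷ xs) f = trans step (sym (∑-∷ x xs))
    where
    step : ∑ (filter P? (x ∷ xs)) f ≈ [ P? x ]· (f x) + ∑ xs (λ x → [ P? x ]· (f x))
    step with P? x
    ... | yes _ = trans (∑-∷ x _) (+-congˡ (∑-filter P? xs f))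
    ... | no  _ = trans (∑-filter P? xs f) (sym (+-identityˡ _))

  ∑-partition : ∀ {A : Set} {P : A → Set} (P? : ∀ x → Dec (P x)) xs (f : A → Carrier) →
                ∑ xs f ≈ ∑ (filter P? xs) f + ∑ (filter (¬? ∘ P?) xs) f
  ∑-partition P? xs f = sym (begin
    ∑ (filter P? xs) f + ∑ (filter (¬? ∘ P?) xs) f
      ≈⟨ +-cong (∑-filter P? xs f) (∑-filter (¬? ∘ P?) xs f) ⟩
    ∑ xs (λ x → [ P? x ]· (f x)) + ∑ xs (λ x → [ ¬? (P? x) ]· (f x)) ≈⟨ ∑-+ xs _ _ ⟨
    ∑ xs (λ x → [ P? x ]· (f x) + [ ¬? (P? x) ]· (f x)) ≈⟨ ∑-cong xs (λ {x} _ → each x) ⟩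
    ∑ xs f ∎)
    where
    each : ∀ x → [ P? x ]· (f x) + [ ¬? (P? x) ]· (f x) ≈ f x
    each x with P? x
    ... | yes _ = +-identityʳ _
    ... | no  _ = +-identityˡ _

  ∑-const : ∀ {A : Set} (xs : List A) c → ∑ xs (const c) ≈ length xs ·ₙ c
  ∑-const []       c = ∑-[]
  ∑-const (x ∷ xs) c = trans (∑-∷ x xs) (+-congˡ (∑-const xs c))

  -- Permutations, trees and forests are listed only up to an equivalence, so a correspondence is
  -- given as a relation `R` between the objects, invariant under both equivalences. It becomes a
  -- permutation of indices because the entries of each list are pairwise inequivalent.
  ∑-bijection : ∀ {A B : Set} {_≈₁_ : A → A → Set} {_≈₂_ : B → B → Set} {P Q xs ys} →
    Enumeration _≈₁_ P xs → Enumeration _≈₂_ Q ys →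
    (∀ {x x′} → x ≈₁ x′ → x′ ≈₁ x) → (∀ {y y′} → y ≈₂ y′ → y′ ≈₂ y) →
    (R : A → B → Set) →
    (∀ {x x′ y} → x ≈₁ x′ → R x y → R x′ y) → (∀ {x y y′} → y ≈₂ y′ → R x y → R x y′) →
    (∀ {x} → P x → ∃ λ y → Q y × R x y) → (∀ {y} → Q y → ∃ λ x → P x × R x y) →
    (∀ {x y y′} → P x → R x y → R x y′ → y ≈₂ y′) → (∀ {x x′ y} → Q y → R x y → R x′ y → x ≈₁ x′) →
    (f : A → Carrier) (g : B → Carrier) → (∀ {x y} → P x → Q y → R x y → f x ≈ g y) →
    ∑ xs f ≈ ∑ ys g
  ∑-bijection {A} {B} {_≈₁_} {_≈₂_} {P} {Q} {xs} {ys} e₁ e₂ sym₁ sym₂ R respˡ respʳ to from func inj f g f≈g =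
    sym (begin
      ∑ ys g                             ≡⟨ ∑-lookup ys g ⟩
      sum (g ∘ lookup ys)                ≈⟨ sum-permute (g ∘ lookup ys) π ⟩
      sum (g ∘ lookup ys ∘ φ)            ≈⟨ sum-cong-≋ (λ i → sym (f≈g (P-at i) (Q-at (φ i)) (R-φ i))) ⟩
      sum (f ∘ lookup xs)                ≡⟨ ∑-lookup xs f ⟨
      ∑ xs f                             ∎)
    where
    module E₁ = Enumeration e₁
    module E₂ = Enumeration e₂
    P-at : ∀ i → P (lookup xs i)
    P-at i = E₁.sound (∈-lookup i)
    Q-at : ∀ j → Q (lookup ys j)
    Q-at j = E₂.sound (∈-lookup j)
    R-ys : ∀ i → Any (R (lookup xs i)) ys
    R-ys i = let y , q , r = to (P-at i) ; y′ , y′∈ , y≈ = E₂.complete q in lose y′∈ (respʳ y≈ r)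
    R-xs : ∀ j → Any (λ x → R x (lookup ys j)) xs
    R-xs j = let x , p , r = from (Q-at j) ; x′ , x′∈ , x≈ = E₁.complete p in lose x′∈ (respˡ x≈ r)
    φ : Fin (length xs) → Fin (length ys)
    φ i = proj₁ (Any-index (R-ys i))
    R-φ : ∀ i → R (lookup xs i) (lookup ys (φ i))
    R-φ i = proj₂ (Any-index (R-ys i))
    ψ : Fin (length ys) → Fin (length xs)
    ψ j = proj₁ (Any-index (R-xs j))
    R-ψ : ∀ j → R (lookup xs (ψ j)) (lookup ys j)
    R-ψ j = proj₂ (Any-index (R-xs j))
    π : Permutation (length xs) (length ys)
    π = permutation φ ψ
      (λ j → AllPairs-lookup-injective sym₂ E₂.unique _ _ (func (P-at (ψ j)) (R-φ (ψ j)) (R-ψ j)))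
      (λ i → AllPairs-lookup-injective sym₁ E₁.unique _ _ (inj (Q-at (φ i)) (R-ψ (φ i)) (R-φ i)))

  ∑-enumeration : ∀ {A : Set} {_≈₁_ : A → A → Set} {P Q xs ys} →
    (∀ {x x′} → x ≈₁ x′ → x′ ≈₁ x) → (∀ {x y z} → x ≈₁ y → y ≈₁ z → x ≈₁ z) → (∀ {x} → x ≈₁ x) →
    Enumeration _≈₁_ P xs → Enumeration _≈₁_ Q ys → (∀ {x} → P x → Q x) → (∀ {x} → Q x → P x) →
    (f : A → Carrier) → (∀ {x y} → P x → P y → x ≈₁ y → f x ≈ f y) → ∑ xs f ≈ ∑ ys f
  ∑-enumeration {_≈₁_ = _≈₁_} sym₁ trans₁ refl₁ e₁ e₂ P⇒Q Q⇒P f resp =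
    ∑-bijection e₁ e₂ sym₁ sym₁ _≈₁_ (λ e r → trans₁ (sym₁ e) r) (λ e r → trans₁ r e)
      (λ p → _ , P⇒Q p , refl₁) (λ q → _ , Q⇒P q , refl₁)
      (λ _ r r′ → trans₁ (sym₁ r) r′) (λ _ r r′ → trans₁ r (sym₁ r′)) f f
      (λ p q r → resp p (Q⇒P q) r)

  -- The indicators of the fibres through `x` total 1 by hypothesis; multiplying `f x` by this 1 and
  -- exchanging the sums groups the terms.
  ∑-fibres : ∀ {A B : Set} (xs : List A) (ys : List B) (D : A → B → Set) (D? : ∀ x y → Dec (D x y)) →
    (f : A → Carrier) → (∀ {x} → x ∈ xs → ∑ ys (λ y → [ D? x y ]· 1#) ≈ 1#) →
    ∑ xs f ≈ ∑ ys (λ y → ∑ (filter (flip D? y) xs) f)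
  ∑-fibres xs ys D D? f one = begin
    ∑ xs f ≈⟨ ∑-cong xs (λ {x} x∈ → begin
      f x ≈⟨ *-identityʳ _ ⟨
      f x * 1# ≈⟨ *-congˡ (one x∈) ⟨
      f x * ∑ ys (λ y → [ D? x y ]· 1#) ≈⟨ ∑-*ˡ ys _ _ ⟩
      ∑ ys (λ y → f x * [ D? x y ]· 1#) ≈⟨ ∑-cong ys (λ {y} _ → push x y) ⟩
      ∑ ys (λ y → [ D? x y ]· (f x)) ∎) ⟩
    ∑ xs (λ x → ∑ ys (λ y → [ D? x y ]· (f x))) ≈⟨ ∑-swap xs ys _ ⟩
    ∑ ys (λ y → ∑ xs (λ x → [ D? x y ]· (f x))) ≈⟨ ∑-cong ys (λ {y} _ → sym (∑-filter (flip D? y) xs f)) ⟩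
    ∑ ys (λ y → ∑ (filter (flip D? y) xs) f) ∎
    where
    push : ∀ x y → f x * [ D? x y ]· 1# ≈ [ D? x y ]· (f x)
    push x y with D? x y
    ... | yes _ = *-identityʳ _
    ... | no  _ = zeroʳ _

  [-]·-yes : ∀ {P : Set} (d : Dec P) x → P → [ d ]· x ≈ x
  [-]·-yes (yes _) x p = CommutativeRing.refl K
  [-]·-yes (no ¬p) x p = ⊥-elim (¬p p)

  [-]·-no : ∀ {P : Set} (d : Dec P) x → ¬ P → [ d ]· x ≈ 0#
  [-]·-no (yes p) x ¬p = ⊥-elim (¬p p)
  [-]·-no (no _)  x ¬p = CommutativeRing.refl K

  [-]·-cong : ∀ {P : Set} (d : Dec P) {x y} → (P → x ≈ y) → [ d ]· x ≈ [ d ]· y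
  [-]·-cong (yes p) h = h p
  [-]·-cong (no _)  h = CommutativeRing.refl K

  sum-delta : ∀ {n} (i : Fin n) (f : Fin n → Carrier) → (∀ j → j ≢ i → f j ≈ 0#) → sum f ≈ f i
  sum-delta zero    f h = trans (+-congˡ (sum-zero λ j → h (suc j) λ ())) (+-identityʳ _)
  sum-delta (suc i) f h = trans (+-cong (h zero λ ()) (sum-delta i (f ∘ suc) λ j j≢i → h (suc j) (j≢i ∘ Fin.suc-injective))) (+-identityˡ _)

-- Isomorphisms and disjoint unions

-- The blocks of the list differ in the image of `zero`, and inside a block `insert zero j` is
-- injective.
permutations-unique : ∀ m n → AllPairs (λ π ρ → ¬ π ≗ᴾ ρ) (permutations m n)
permutations-unique zero    zero    = [] ∷ []
permutations-unique zero    (suc n) = []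
permutations-unique (suc m) zero    = []
permutations-unique (suc m) (suc n) = AllPairs.concat⁺
  (All.map⁺ (All.tabulate λ {j} _ → AllPairs.map⁺ (AllPairs.map (λ π≉ρ → π≉ρ ∘ insert-injective j) (permutations-unique m n))))
  (AllPairs.map⁺ (AllPairs.map (λ i≢j → All.map⁺ (All.tabulate λ _ → All.map⁺ (All.tabulate λ _ eq → i≢j (eq zero)))) (Unique.allFin⁺ (suc n))))
  where
  insert-injective : ∀ j {π ρ : Permutation m n} → Perm.insert zero j π ≗ᴾ Perm.insert zero j ρ → π ≗ᴾ ρ
  insert-injective j {π} {ρ} eq k = Fin.punchIn-injective j _ _
    (≡.trans (≡.sym (Perm.insert-punchIn zero j π k)) (≡.trans (eq (suc k)) (Perm.insert-punchIn zero j ρ k)))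

isos : ∀ {m n} → Parents m → Parents n → List (Permutation m n)
isos {m} {n} p q = filter (isIso? p q) (permutations m n)

IsIso-resp : ∀ {m n} {p : Parents m} {q : Parents n} {π ρ : Permutation m n} → π ≗ᴾ ρ → IsIso p q π → IsIso p q ρ
IsIso-resp {p = p} {q} {π} {ρ} eq = IsIso-resp-≈ {p = p} {q} {π} {ρ} (≡.sym ∘ eq)

isos-enum : ∀ {m n} (p : Parents m) (q : Parents n) → Enumeration _≗ᴾ_ (IsIso p q) (isos p q)
isos-enum {m} {n} p q = record
  { sound    = λ π∈ → proj₂ (∈-filter⁻ (isIso? p q) {xs = permutations m n} π∈)
  ; complete = λ {π} iso → let ρ , ρ∈ , ρ≈π = permutations-complete π in
      ρ , ∈-filter⁺ (isIso? p q) ρ∈ (IsIso-resp-≈ {p = p} {q} {π} {ρ} ρ≈π iso) , ≡.sym ∘ ρ≈π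
  ; unique   = AllPairs.filter⁺ (isIso? p q) (permutations-unique m n)
  }

≗ᴾ-sym : ∀ {m n} {π ρ : Permutation m n} → π ≗ᴾ ρ → ρ ≗ᴾ π
≗ᴾ-sym eq i = ≡.sym (eq i)

perm-injective : ∀ {m n} (π : Permutation m n) {i j} → π ⟨$⟩ʳ i ≡ π ⟨$⟩ʳ j → i ≡ j
perm-injective π eq = ≡.trans (≡.sym (Perm.inverseˡ π)) (≡.trans (cong (π ⟨$⟩ˡ_) eq) (Perm.inverseˡ π))

IsIso-id : ∀ {n} (p : Parents n) → IsIso p p Perm.id
IsIso-id p i = Maybe.map-id (p i)

IsIso-flip : ∀ {m n} (p : Parents m) (q : Parents n) π → IsIso p q π → IsIso q p (Perm.flip π)
IsIso-flip p q π iso j = ≡.trans (cong (Maybe.map (π ⟨$⟩ˡ_)) (≡.trans (cong q (≡.sym (Perm.inverseʳ π))) (≡.sym (iso (π ⟨$⟩ˡ j)))))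
  (≡.trans (≡.sym (Maybe.map-∘ (p (π ⟨$⟩ˡ j)))) (≡.trans (Maybe.map-cong (λ _ → Perm.inverseˡ π) (p (π ⟨$⟩ˡ j))) (Maybe.map-id _)))

IsIso-∘ : ∀ {l m n} (p : Parents l) (q : Parents m) (r : Parents n) π ρ → IsIso p q π → IsIso q r ρ → IsIso p r (π ∘ₚ ρ)
IsIso-∘ p q r π ρ iso₁ iso₂ i = ≡.trans (Maybe.map-∘ (p i)) (≡.trans (cong (Maybe.map (ρ ⟨$⟩ʳ_)) (iso₁ i)) (iso₂ (π ⟨$⟩ʳ i)))

≅-refl : ∀ {n} {p : Parents n} → p ≅ p
≅-refl {p = p} = Perm.id , IsIso-id p

≅-sym : ∀ {m n} {p : Parents m} {q : Parents n} → p ≅ q → q ≅ p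
≅-sym {p = p} {q} (π , iso) = Perm.flip π , IsIso-flip p q π iso

≅-trans : ∀ {l m n} {p : Parents l} {q : Parents m} {r : Parents n} → p ≅ q → q ≅ r → p ≅ r
≅-trans {p = p} {q} {r} (π , iso₁) (ρ , iso₂) = (π ∘ₚ ρ) , IsIso-∘ p q r π ρ iso₁ iso₂

-- A view of the nodes of a disjoint union: functions built with `_⊹_` are then evaluated by
-- matching rather than by reasoning about `splitAt`.
data Side m n : Fin (m ℕ.+ n) → Set where
  left  : ∀ a → Side m n (a ↑ˡ n)
  right : ∀ b → Side m n (m ↑ʳ b)

side : ∀ m n i → Side m n i
side m n i = subst (Side m n) (Fin.join-splitAt m n i) (go (splitAt m i))
  where
  go : ∀ s → Side m n (join m n s)
  go (inj₁ a) = left a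
  go (inj₂ b) = right b

left≢right : ∀ {m n} {a : Fin m} {b : Fin n} → a ↑ˡ n ≢ m ↑ʳ b
left≢right {m} {n} {a} {b} eq with ≡.trans (≡.sym (Fin.splitAt-↑ˡ m a n)) (≡.trans (cong (splitAt m) eq) (Fin.splitAt-↑ʳ m n b))
... | ()

infixr 5 _⊕_

_⊕_ : ∀ {m n} → Parents m → Parents n → Parents (m ℕ.+ n)
_⊕_ {m} {n} p q = (Maybe.map (_↑ˡ n) ∘ p) ⊹ (Maybe.map (m ↑ʳ_) ∘ q)

module _ {m n} (p : Parents m) (q : Parents n) where

  ⊕-left : ∀ a → (p ⊕ q) (a ↑ˡ n) ≡ Maybe.map (_↑ˡ n) (p a)
  ⊕-left = lookup-++ˡ (Maybe.map (_↑ˡ n) ∘ p) (Maybe.map (m ↑ʳ_) ∘ q)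

  ⊕-right : ∀ b → (p ⊕ q) (m ↑ʳ b) ≡ Maybe.map (m ↑ʳ_) (q b)
  ⊕-right = lookup-++ʳ (Maybe.map (_↑ˡ n) ∘ p) (Maybe.map (m ↑ʳ_) ∘ q)

module _ {m m′ n n′ : ℕ} (α : Permutation m m′) (τ : Permutation n n′) where

  private
    to : Fin (m ℕ.+ n) → Fin (m′ ℕ.+ n′)
    to = (λ a → (α ⟨$⟩ʳ a) ↑ˡ n′) ⊹ (λ b → m′ ↑ʳ (τ ⟨$⟩ʳ b))
    from : Fin (m′ ℕ.+ n′) → Fin (m ℕ.+ n)
    from = (λ a → (α ⟨$⟩ˡ a) ↑ˡ n) ⊹ (λ b → m ↑ʳ (τ ⟨$⟩ˡ b))
    to-left : ∀ a → to (a ↑ˡ n) ≡ (α ⟨$⟩ʳ a) ↑ˡ n′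
    to-left a = lookup-++ˡ (λ a → (α ⟨$⟩ʳ a) ↑ˡ n′) (λ b → m′ ↑ʳ (τ ⟨$⟩ʳ b)) a
    to-right : ∀ b → to (m ↑ʳ b) ≡ m′ ↑ʳ (τ ⟨$⟩ʳ b)
    to-right b = lookup-++ʳ (λ a → (α ⟨$⟩ʳ a) ↑ˡ n′) (λ b → m′ ↑ʳ (τ ⟨$⟩ʳ b)) b
    from-left : ∀ a → from (a ↑ˡ n′) ≡ (α ⟨$⟩ˡ a) ↑ˡ n
    from-left a = lookup-++ˡ (λ a → (α ⟨$⟩ˡ a) ↑ˡ n) (λ b → m ↑ʳ (τ ⟨$⟩ˡ b)) a
    from-right : ∀ b → from (m′ ↑ʳ b) ≡ m ↑ʳ (τ ⟨$⟩ˡ b)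
    from-right b = lookup-++ʳ (λ a → (α ⟨$⟩ˡ a) ↑ˡ n) (λ b → m ↑ʳ (τ ⟨$⟩ˡ b)) b

  blockSum : Permutation (m ℕ.+ n) (m′ ℕ.+ n′)
  blockSum = permutation to from to-from from-to
    where
    to-from : ∀ j → to (from j) ≡ j
    to-from j with side m′ n′ j
    ... | left a  = ≡.trans (cong to (from-left a)) (≡.trans (to-left _) (cong (_↑ˡ n′) (Perm.inverseʳ α)))
    ... | right b = ≡.trans (cong to (from-right b)) (≡.trans (to-right _) (cong (m′ ↑ʳ_) (Perm.inverseʳ τ)))
    from-to : ∀ j → from (to j) ≡ j
    from-to j with side m n j
    ... | left a  = ≡.trans (cong from (to-left a)) (≡.trans (from-left _) (cong (_↑ˡ n) (Perm.inverseˡ α)))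
    ... | right b = ≡.trans (cong from (to-right b)) (≡.trans (from-right _) (cong (m ↑ʳ_) (Perm.inverseˡ τ)))

  blockSum-left : ∀ a → blockSum ⟨$⟩ʳ (a ↑ˡ n) ≡ (α ⟨$⟩ʳ a) ↑ˡ n′
  blockSum-left = to-left

  blockSum-right : ∀ b → blockSum ⟨$⟩ʳ (m ↑ʳ b) ≡ m′ ↑ʳ (τ ⟨$⟩ʳ b)
  blockSum-right = to-right

  blockSum-iso : ∀ p p′ q q′ → IsIso p p′ α → IsIso q q′ τ → IsIso (p ⊕ q) (p′ ⊕ q′) blockSum
  blockSum-iso p p′ q q′ iso₁ iso₂ i with side m n i
  ... | left a  = begin
    Maybe.map f ((p ⊕ q) (a ↑ˡ n))                 ≡⟨ cong (Maybe.map f) (⊕-left p q a) ⟩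
    Maybe.map f (Maybe.map (_↑ˡ n) (p a))          ≡⟨ Maybe.map-∘ (p a) ⟨
    Maybe.map (λ a → f (a ↑ˡ n)) (p a)             ≡⟨ Maybe.map-cong blockSum-left (p a) ⟩
    Maybe.map (λ a → (α ⟨$⟩ʳ a) ↑ˡ n′) (p a)       ≡⟨ Maybe.map-∘ (p a) ⟩
    Maybe.map (_↑ˡ n′) (Maybe.map (α ⟨$⟩ʳ_) (p a)) ≡⟨ cong (Maybe.map (_↑ˡ n′)) (iso₁ a) ⟩
    Maybe.map (_↑ˡ n′) (p′ (α ⟨$⟩ʳ a))             ≡⟨ ⊕-left p′ q′ _ ⟨
    (p′ ⊕ q′) ((α ⟨$⟩ʳ a) ↑ˡ n′)                   ≡⟨ cong (p′ ⊕ q′) (blockSum-left a) ⟨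
    (p′ ⊕ q′) (f (a ↑ˡ n))                         ∎
    where open ≡.≡-Reasoning
          f = blockSum ⟨$⟩ʳ_
  ... | right b = begin
    Maybe.map f ((p ⊕ q) (m ↑ʳ b))                 ≡⟨ cong (Maybe.map f) (⊕-right p q b) ⟩
    Maybe.map f (Maybe.map (m ↑ʳ_) (q b))          ≡⟨ Maybe.map-∘ (q b) ⟨
    Maybe.map (λ b → f (m ↑ʳ b)) (q b)             ≡⟨ Maybe.map-cong blockSum-right (q b) ⟩
    Maybe.map (λ b → m′ ↑ʳ (τ ⟨$⟩ʳ b)) (q b)       ≡⟨ Maybe.map-∘ (q b) ⟩
    Maybe.map (m′ ↑ʳ_) (Maybe.map (τ ⟨$⟩ʳ_) (q b)) ≡⟨ cong (Maybe.map (m′ ↑ʳ_)) (iso₂ b) ⟩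
    Maybe.map (m′ ↑ʳ_) (q′ (τ ⟨$⟩ʳ b))             ≡⟨ ⊕-right p′ q′ _ ⟨
    (p′ ⊕ q′) (m′ ↑ʳ (τ ⟨$⟩ʳ b))                   ≡⟨ cong (p′ ⊕ q′) (blockSum-right b) ⟨
    (p′ ⊕ q′) (f (m ↑ʳ b))                         ∎
    where open ≡.≡-Reasoning
          f = blockSum ⟨$⟩ʳ_

  blockSum-iso⁻ : ∀ p p′ q q′ → IsIso (p ⊕ q) (p′ ⊕ q′) blockSum → IsIso p p′ α × IsIso q q′ τ
  blockSum-iso⁻ p p′ q q′ iso = iso₁ , iso₂
    where
    open ≡.≡-Reasoning
    f = blockSum ⟨$⟩ʳ_
    iso₁ : IsIso p p′ α
    iso₁ a = Maybe.map-injective (Fin.↑ˡ-injective n′ _ _) (begin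
      Maybe.map (_↑ˡ n′) (Maybe.map (α ⟨$⟩ʳ_) (p a)) ≡⟨ Maybe.map-∘ (p a) ⟨
      Maybe.map (λ a → (α ⟨$⟩ʳ a) ↑ˡ n′) (p a)       ≡⟨ Maybe.map-cong blockSum-left (p a) ⟨
      Maybe.map (λ a → f (a ↑ˡ n)) (p a)             ≡⟨ Maybe.map-∘ (p a) ⟩
      Maybe.map f (Maybe.map (_↑ˡ n) (p a))          ≡⟨ cong (Maybe.map f) (⊕-left p q a) ⟨
      Maybe.map f ((p ⊕ q) (a ↑ˡ n))                 ≡⟨ iso (a ↑ˡ n) ⟩
      (p′ ⊕ q′) (f (a ↑ˡ n))                         ≡⟨ cong (p′ ⊕ q′) (blockSum-left a) ⟩
      (p′ ⊕ q′) ((α ⟨$⟩ʳ a) ↑ˡ n′)                   ≡⟨ ⊕-left p′ q′ _ ⟩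
      Maybe.map (_↑ˡ n′) (p′ (α ⟨$⟩ʳ a))             ∎)
    iso₂ : IsIso q q′ τ
    iso₂ b = Maybe.map-injective (Fin.↑ʳ-injective m′ _ _) (begin
      Maybe.map (m′ ↑ʳ_) (Maybe.map (τ ⟨$⟩ʳ_) (q b)) ≡⟨ Maybe.map-∘ (q b) ⟨
      Maybe.map (λ b → m′ ↑ʳ (τ ⟨$⟩ʳ b)) (q b)       ≡⟨ Maybe.map-cong blockSum-right (q b) ⟨
      Maybe.map (λ b → f (m ↑ʳ b)) (q b)             ≡⟨ Maybe.map-∘ (q b) ⟩
      Maybe.map f (Maybe.map (m ↑ʳ_) (q b))          ≡⟨ cong (Maybe.map f) (⊕-right p q b) ⟨
      Maybe.map f ((p ⊕ q) (m ↑ʳ b))                 ≡⟨ iso (m ↑ʳ b) ⟩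
      (p′ ⊕ q′) (f (m ↑ʳ b))                         ≡⟨ cong (p′ ⊕ q′) (blockSum-right b) ⟩
      (p′ ⊕ q′) (m′ ↑ʳ (τ ⟨$⟩ʳ b))                   ≡⟨ ⊕-right p′ q′ _ ⟩
      Maybe.map (m′ ↑ʳ_) (q′ (τ ⟨$⟩ʳ b))             ∎)

≅-⊕ : ∀ {m m′ n n′} {p : Parents m} {p′ : Parents m′} {q : Parents n} {q′ : Parents n′} → p ≅ p′ → q ≅ q′ → p ⊕ q ≅ p′ ⊕ q′
≅-⊕ {p = p} {p′} {q} {q′} (α , iso₁) (τ , iso₂) = blockSum α τ , blockSum-iso α τ p p′ q q′ iso₁ iso₂

module _ {m m′ n n′ : ℕ} (σ : Permutation (m ℕ.+ n) (m′ ℕ.+ n′))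
  (closed : ∀ a → ∃ λ a′ → σ ⟨$⟩ʳ (a ↑ˡ n) ≡ a′ ↑ˡ n′)
  (closed⁻¹ : ∀ a′ → ∃ λ a → σ ⟨$⟩ˡ (a′ ↑ˡ n′) ≡ a ↑ˡ n) where

  private
    -- A right index sent to the left would be brought back to the left by `closed⁻¹`, but the
    -- inverse returns it to the right.
    right-closed : ∀ b → ∃ λ b′ → σ ⟨$⟩ʳ (m ↑ʳ b) ≡ m′ ↑ʳ b′
    right-closed b with σ ⟨$⟩ʳ (m ↑ʳ b) in eq
    ... | j with side m′ n′ j
    ... | right b′ = b′ , refl
    ... | left a′  = let a , eq′ = closed⁻¹ a′ in
      ⊥-elim (left≢right (≡.trans (≡.sym eq′) (≡.trans (cong (σ ⟨$⟩ˡ_) (≡.sym eq)) (Perm.inverseˡ σ))))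

    right-closed⁻¹ : ∀ b′ → ∃ λ b → σ ⟨$⟩ˡ (m′ ↑ʳ b′) ≡ m ↑ʳ b
    right-closed⁻¹ b′ with σ ⟨$⟩ˡ (m′ ↑ʳ b′) in eq
    ... | j with side m n j
    ... | right b = b , refl
    ... | left a  = let a′ , eq′ = closed a in
      ⊥-elim (left≢right (≡.trans (≡.sym eq′) (≡.trans (cong (σ ⟨$⟩ʳ_) (≡.sym eq)) (Perm.inverseʳ σ))))

  restrictˡ : Permutation m m′
  restrictˡ = permutation (proj₁ ∘ closed) (proj₁ ∘ closed⁻¹)
    (λ a′ → Fin.↑ˡ-injective n′ _ _ (≡.trans (≡.sym (proj₂ (closed _))) (≡.trans (cong (σ ⟨$⟩ʳ_) (≡.sym (proj₂ (closed⁻¹ a′)))) (Perm.inverseʳ σ))))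
    (λ a → Fin.↑ˡ-injective n _ _ (≡.trans (≡.sym (proj₂ (closed⁻¹ _))) (≡.trans (cong (σ ⟨$⟩ˡ_) (≡.sym (proj₂ (closed a)))) (Perm.inverseˡ σ))))

  restrictʳ : Permutation n n′
  restrictʳ = permutation (proj₁ ∘ right-closed) (proj₁ ∘ right-closed⁻¹)
    (λ b′ → Fin.↑ʳ-injective m′ _ _ (≡.trans (≡.sym (proj₂ (right-closed _))) (≡.trans (cong (σ ⟨$⟩ʳ_) (≡.sym (proj₂ (right-closed⁻¹ b′)))) (Perm.inverseʳ σ))))
    (λ b → Fin.↑ʳ-injective m _ _ (≡.trans (≡.sym (proj₂ (right-closed⁻¹ _))) (≡.trans (cong (σ ⟨$⟩ˡ_) (≡.sym (proj₂ (right-closed b)))) (Perm.inverseˡ σ))))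

  restrict-blockSum : σ ≗ᴾ blockSum restrictˡ restrictʳ
  restrict-blockSum i with side m n i
  ... | left a  = ≡.trans (proj₂ (closed a)) (≡.sym (blockSum-left restrictˡ restrictʳ a))
  ... | right b = ≡.trans (proj₂ (right-closed b)) (≡.sym (blockSum-right restrictˡ restrictʳ b))

-- A parent-preserving map that need not be bijective, so that an isomorphism out of a disjoint
-- union can be checked on one summand at a time.
Embeds : ∀ {m n} → Parents m → Parents n → (Fin m → Fin n) → Set
Embeds p q e = ∀ i → q (e i) ≡ Maybe.map e (p i)

Embeds-∘ : ∀ {l m n} (p : Parents l) {q : Parents m} {r : Parents n} {e f} → Embeds p q e → Embeds q r f → Embeds p r (f ∘ e)
Embeds-∘ p {e = e} {f} he hf i = ≡.trans (hf (e i)) (≡.trans (cong (Maybe.map f) (he i)) (≡.sym (Maybe.map-∘ (p i))))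

Embeds-resp : ∀ {m n} (p : Parents m) {q : Parents n} {e f} → (∀ i → e i ≡ f i) → Embeds p q f → Embeds p q e
Embeds-resp p {q} e≡f h i = ≡.trans (cong q (e≡f i)) (≡.trans (h i) (Maybe.map-cong (≡.sym ∘ e≡f) (p i)))

Embeds-⊕ : ∀ {m n o} (p : Parents m) (q : Parents n) {r : Parents o} (e : Fin (m ℕ.+ n) → Fin o) →
  Embeds p r (λ a → e (a ↑ˡ n)) → Embeds q r (λ b → e (m ↑ʳ b)) → Embeds (p ⊕ q) r e
Embeds-⊕ {m} {n} p q e h₁ h₂ i with side m n i
... | left a  = ≡.trans (h₁ a) (≡.trans (Maybe.map-∘ (p a)) (cong (Maybe.map e) (≡.sym (⊕-left p q a))))
... | right b = ≡.trans (h₂ b) (≡.trans (Maybe.map-∘ (q b)) (cong (Maybe.map e) (≡.sym (⊕-right p q b))))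

exchangeʳ : ∀ a b c → Fin (b ℕ.+ c) → Fin (b ℕ.+ (a ℕ.+ c))
exchangeʳ a b c = _⊹_ {m = b} {n = c} (λ j → j ↑ˡ (a ℕ.+ c)) (λ k → b ↑ʳ (a ↑ʳ k))

exchange : ∀ a b c → Fin (a ℕ.+ (b ℕ.+ c)) → Fin (b ℕ.+ (a ℕ.+ c))
exchange a b c = (λ i → b ↑ʳ (i ↑ˡ c)) ⊹ exchangeʳ a b c

module _ (a b c : ℕ) where

  exchange₁ : ∀ i → exchange a b c (i ↑ˡ (b ℕ.+ c)) ≡ b ↑ʳ (i ↑ˡ c)
  exchange₁ = lookup-++ˡ (λ i → b ↑ʳ (i ↑ˡ c)) (exchangeʳ a b c)

  exchange₂ : ∀ j → exchange a b c (a ↑ʳ (j ↑ˡ c)) ≡ j ↑ˡ (a ℕ.+ c)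
  exchange₂ j = ≡.trans
    (lookup-++ʳ (λ i → b ↑ʳ (i ↑ˡ c)) (exchangeʳ a b c) (j ↑ˡ c))
    (lookup-++ˡ {m = b} {n = c} (λ j → j ↑ˡ (a ℕ.+ c)) (λ k → b ↑ʳ (a ↑ʳ k)) j)

  exchange₃ : ∀ k → exchange a b c (a ↑ʳ (b ↑ʳ k)) ≡ b ↑ʳ (a ↑ʳ k)
  exchange₃ k = ≡.trans
    (lookup-++ʳ (λ i → b ↑ʳ (i ↑ˡ c)) (exchangeʳ a b c) (b ↑ʳ k))
    (lookup-++ʳ {m = b} {n = c} (λ j → j ↑ˡ (a ℕ.+ c)) (λ k → b ↑ʳ (a ↑ʳ k)) k)

exchange-involutive : ∀ a b c i → exchange b a c (exchange a b c i) ≡ i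
exchange-involutive a b c i with side a (b ℕ.+ c) i
... | left x = ≡.trans (cong (exchange b a c) (exchange₁ a b c x)) (exchange₂ b a c x)
... | right y with side b c y
... | left x  = ≡.trans (cong (exchange b a c) (exchange₂ a b c x)) (exchange₁ b a c x)
... | right x = ≡.trans (cong (exchange b a c) (exchange₃ a b c x)) (exchange₃ b a c x)

exchangeₚ : ∀ a b c → Permutation (a ℕ.+ (b ℕ.+ c)) (b ℕ.+ (a ℕ.+ c))
exchangeₚ a b c = permutation (exchange a b c) (exchange b a c) (exchange-involutive b a c) (exchange-involutive a b c)

exchange-iso : ∀ {a b c} (p : Parents a) (q : Parents b) (r : Parents c) → IsIso (p ⊕ (q ⊕ r)) (q ⊕ (p ⊕ r)) (exchangeₚ a b c)
exchange-iso {a} {b} {c} p q r i = ≡.sym (Embeds-⊕ p (q ⊕ r) {q ⊕ (p ⊕ r)} (exchange a b c)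
  (Embeds-resp p {q ⊕ (p ⊕ r)} (exchange₁ a b c) (Embeds-∘ p {p ⊕ r} {q ⊕ (p ⊕ r)} (⊕-left p r) (⊕-right q (p ⊕ r))))
  (Embeds-⊕ q r {q ⊕ (p ⊕ r)} (λ x → exchange a b c (a ↑ʳ x))
    (Embeds-resp q {q ⊕ (p ⊕ r)} (exchange₂ a b c) (⊕-left q (p ⊕ r)))
    (Embeds-resp r {q ⊕ (p ⊕ r)} (exchange₃ a b c) (Embeds-∘ r {p ⊕ r} {q ⊕ (p ⊕ r)} (⊕-right p r) (⊕-right q (p ⊕ r)))))
  i)

-- Components of forests

rootᵗ : ∀ T → Fin ∣ T ∣ᵗ
rootᵗ (node F) = zero

parent-root : ∀ T → parentᵗ T (rootᵗ T) ≡ nothing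
parent-root (node F) = refl

root-unique : ∀ T i → parentᵗ T i ≡ nothing → i ≡ rootᵗ T
root-unique (node F) zero _ = refl

-- Induction from parents to children. Through it enters the fact that every chain of parents ends
-- at a root; an arbitrary parent map could have cycles.
tree-induction : ∀ T (Q : Fin ∣ T ∣ᵗ → Set) → Q (rootᵗ T) →
                 (∀ i j → parentᵗ T i ≡ just j → Q j → Q i) → ∀ i → Q i
forest-induction : ∀ F (Q : Fin ∣ F ∣ᶠ → Set) → (∀ i → parentᶠ F i ≡ nothing → Q i) →
                   (∀ i j → parentᶠ F i ≡ just j → Q j → Q i) → ∀ i → Q i
tree-induction (node F) Q base step zero    = base
tree-induction (node F) Q base step (suc i) = forest-induction F (Q ∘ suc)
  (λ i eq → step (suc i) zero (cong (just ∘ maybe suc zero) eq) base)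
  (λ i j eq → step (suc i) (suc j) (cong (just ∘ maybe suc zero) eq)) i
forest-induction (T ∷ F) Q base step i with side ∣ T ∣ᵗ ∣ F ∣ᶠ i
... | left a = tree-induction T (λ a → Q (a ↑ˡ ∣ F ∣ᶠ))
  (base _ (≡.trans (⊕-left (parentᵗ T) (parentᶠ F) _) (cong (Maybe.map _) (parent-root T))))
  (λ i j eq → step _ _ (≡.trans (⊕-left (parentᵗ T) (parentᶠ F) _) (cong (Maybe.map _) eq))) a
... | right b = forest-induction F (λ b → Q (∣ T ∣ᵗ ↑ʳ b))
  (λ i eq → base _ (≡.trans (⊕-right (parentᵗ T) (parentᶠ F) _) (cong (Maybe.map _) eq)))
  (λ i j eq → step _ _ (≡.trans (⊕-right (parentᵗ T) (parentᶠ F) _) (cong (Maybe.map _) eq))) b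

module _ (T U : Tree) {n n′} (q : Parents n) (q′ : Parents n′) (σ : Permutation (∣ T ∣ᵗ ℕ.+ n) (∣ U ∣ᵗ ℕ.+ n′))
  (iso : IsIso (parentᵗ T ⊕ q) (parentᵗ U ⊕ q′) σ) where

  MapsLeft : Fin ∣ T ∣ᵗ → Set
  MapsLeft a = ∃ λ a′ → σ ⟨$⟩ʳ (a ↑ˡ n) ≡ a′ ↑ˡ n′

  image-parent : ∀ i → Maybe.map (λ a → σ ⟨$⟩ʳ (a ↑ˡ n)) (parentᵗ T i) ≡ (parentᵗ U ⊕ q′) (σ ⟨$⟩ʳ (i ↑ˡ n))
  image-parent i = ≡.trans (Maybe.map-∘ (parentᵗ T i)) (≡.trans (cong (Maybe.map (σ ⟨$⟩ʳ_)) (≡.sym (⊕-left (parentᵗ T) q i))) (iso (i ↑ˡ n)))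

  -- Parents never cross between the summands of `_⊕_`: a node landing in `q′` would have the image
  -- of its parent there as well.
  mapsLeft-root⇒all : MapsLeft (rootᵗ T) → ∀ a → MapsLeft a
  mapsLeft-root⇒all base = tree-induction T MapsLeft base step
    where
    step : ∀ i j → parentᵗ T i ≡ just j → MapsLeft j → MapsLeft i
    step i j eq (j′ , eqⱼ) with σ ⟨$⟩ʳ (i ↑ˡ n) in eqᵢ
    ... | k with side ∣ U ∣ᵗ n′ k
    ... | left a′  = a′ , refl
    ... | right b′ with q′ b′ | ≡.trans (cong (Maybe.map _) (≡.sym eq)) (≡.trans (image-parent i) (≡.trans (cong (parentᵗ U ⊕ q′) eqᵢ) (⊕-right (parentᵗ U) q′ b′)))
    ... | just c′ | e = ⊥-elim (left≢right (≡.trans (≡.sym eqⱼ) (Maybe.just-injective e)))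
    ... | nothing | ()

  -- The image of the parent is the parent of the image, so it stays in `U`. Together with
  -- `root↦root`, an automorphism that fixes any node of `T` fixes the root of `T`.
  mapsLeft⇒root : ∀ a → MapsLeft a → MapsLeft (rootᵗ T)
  mapsLeft⇒root = tree-induction T (λ a → MapsLeft a → MapsLeft (rootᵗ T)) id step
    where
    step : ∀ i j → parentᵗ T i ≡ just j → (MapsLeft j → MapsLeft (rootᵗ T)) → MapsLeft i → MapsLeft (rootᵗ T)
    step i j eq ih (i′ , eqᵢ)
      with parentᵗ U i′ | ≡.trans (cong (Maybe.map _) (≡.sym eq)) (≡.trans (image-parent i) (≡.trans (cong (parentᵗ U ⊕ q′) eqᵢ) (⊕-left (parentᵗ U) q′ i′)))
    ... | just j′ | e = ih (j′ , Maybe.just-injective e)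
    ... | nothing | ()

  root↦root : MapsLeft (rootᵗ T) → σ ⟨$⟩ʳ (rootᵗ T ↑ˡ n) ≡ rootᵗ U ↑ˡ n′
  root↦root (x , eq) = ≡.trans eq (cong (_↑ˡ n′) (root-unique U x
    (nothing⁻ (≡.trans (≡.sym (⊕-left (parentᵗ U) q′ x)) (≡.trans (cong (parentᵗ U ⊕ q′) (≡.sym eq))
      (≡.trans (≡.sym (image-parent (rootᵗ T))) (cong (Maybe.map _) (parent-root T))))))))
    where
    nothing⁻ : ∀ {A B : Set} {f : A → B} {x} → Maybe.map f x ≡ nothing → x ≡ nothing
    nothing⁻ {x = nothing} _ = refl

module _ (T U : Tree) {n n′} (q : Parents n) (q′ : Parents n′) (σ : Permutation (∣ T ∣ᵗ ℕ.+ n) (∣ U ∣ᵗ ℕ.+ n′))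
  (iso : IsIso (parentᵗ T ⊕ q) (parentᵗ U ⊕ q′) σ) where

  blocks : MapsLeft T U q q′ σ iso (rootᵗ T) →
           ∃ λ α → ∃ λ τ → IsIso (parentᵗ T) (parentᵗ U) α × IsIso q q′ τ × σ ≗ᴾ blockSum α τ
  blocks l = α , τ , proj₁ isos′ , proj₂ isos′ , σ≗
    where
    iso⁻¹ = IsIso-flip (parentᵗ T ⊕ q) (parentᵗ U ⊕ q′) σ iso
    closed = mapsLeft-root⇒all T U q q′ σ iso l
    -- The root of `U` is the image of the root of `T`, so the inverse satisfies the same condition.
    closed⁻¹ = mapsLeft-root⇒all U T q′ q (Perm.flip σ) iso⁻¹
      (rootᵗ T , ≡.trans (cong (σ ⟨$⟩ˡ_) (≡.sym (root↦root T U q q′ σ iso l))) (Perm.inverseˡ σ))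
    α = restrictˡ σ closed closed⁻¹
    τ = restrictʳ σ closed closed⁻¹
    σ≗ = restrict-blockSum σ closed closed⁻¹
    isos′ = blockSum-iso⁻ α τ (parentᵗ T) (parentᵗ U) q q′
      (IsIso-resp {p = parentᵗ T ⊕ q} {parentᵗ U ⊕ q′} {σ} {blockSum α τ} σ≗ iso)

infix 4 _≅ᶠ_

-- A record, because the forests cannot be recovered from the unfolded type `parentᶠ F ≅ parentᶠ G`.
record _≅ᶠ_ (F G : Forest) : Set where
  constructor mk≅ᶠ
  field unwrap : parentᶠ F ≅ parentᶠ G

≅ᵗ-refl : ∀ T → T ≅ᵗ T
≅ᵗ-refl T = ≅-refl {p = parentᵗ T}

≅ᵗ-sym : ∀ T U → T ≅ᵗ U → U ≅ᵗ T
≅ᵗ-sym T U = ≅-sym {p = parentᵗ T} {parentᵗ U}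

≅ᵗ-trans : ∀ T U V → T ≅ᵗ U → U ≅ᵗ V → T ≅ᵗ V
≅ᵗ-trans T U V = ≅-trans {p = parentᵗ T} {parentᵗ U} {parentᵗ V}

≅ᶠ-refl : ∀ {F} → F ≅ᶠ F
≅ᶠ-refl {F} = mk≅ᶠ (≅-refl {p = parentᶠ F})

≅ᶠ-sym : ∀ {F G} → F ≅ᶠ G → G ≅ᶠ F
≅ᶠ-sym {F} {G} (mk≅ᶠ e) = mk≅ᶠ (≅-sym {p = parentᶠ F} {parentᶠ G} e)

≅ᶠ-trans : ∀ {F G H} → F ≅ᶠ G → G ≅ᶠ H → F ≅ᶠ H
≅ᶠ-trans {F} {G} {H} (mk≅ᶠ e) (mk≅ᶠ f) = mk≅ᶠ (≅-trans {p = parentᶠ F} {parentᶠ G} {parentᶠ H} e f)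

≅ᶠ-∷ : ∀ {T U F G} → T ≅ᵗ U → F ≅ᶠ G → T ∷ F ≅ᶠ U ∷ G
≅ᶠ-∷ {T} {U} {F} {G} e (mk≅ᶠ f) = mk≅ᶠ (≅-⊕ {p = parentᵗ T} {parentᵗ U} {parentᶠ F} {parentᶠ G} e f)

≅ᶠ-prep : ∀ T {F G} → F ≅ᶠ G → T ∷ F ≅ᶠ T ∷ G
≅ᶠ-prep T = ≅ᶠ-∷ (≅ᵗ-refl T)

≅ᶠ-swap : ∀ T U F → T ∷ U ∷ F ≅ᶠ U ∷ T ∷ F
≅ᶠ-swap T U F = mk≅ᶠ (exchangeₚ ∣ T ∣ᵗ ∣ U ∣ᵗ ∣ F ∣ᶠ , exchange-iso (parentᵗ T) (parentᵗ U) (parentᶠ F))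

↭⇒≅ᶠ : ∀ {F G} → F ↭ G → F ≅ᶠ G
↭⇒≅ᶠ ↭.refl = ≅ᶠ-refl
↭⇒≅ᶠ (↭.prep T F↭G) = ≅ᶠ-prep T (↭⇒≅ᶠ F↭G)
↭⇒≅ᶠ (↭.swap T U F↭G) = ≅ᶠ-trans (≅ᶠ-swap T U _) (≅ᶠ-prep U (≅ᶠ-prep T (↭⇒≅ᶠ F↭G)))
↭⇒≅ᶠ (↭.trans F↭G G↭H) = ≅ᶠ-trans (↭⇒≅ᶠ F↭G) (↭⇒≅ᶠ G↭H)

componentOf : ∀ G → Fin ∣ G ∣ᶠ → Σ Tree λ T → Fin ∣ T ∣ᵗ
componentOf (T ∷ F) = (T ,_) ⊹ componentOf F

componentOf-left : ∀ T F a → componentOf (T ∷ F) (a ↑ˡ ∣ F ∣ᶠ) ≡ (T , a)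
componentOf-left T F = lookup-++ˡ (T ,_) (componentOf F)

componentOf-right : ∀ T F b → componentOf (T ∷ F) (∣ T ∣ᵗ ↑ʳ b) ≡ componentOf F b
componentOf-right T F = lookup-++ʳ (T ,_) (componentOf F)

-- The lemma `blocks` speaks of the first tree on each side only. This record moves the component of
-- `i` to the front and remembers what the reordering does to `i`.
record Located (G : Forest) (i : Fin ∣ G ∣ᶠ) : Set where
  field
    component : Tree
    others    : Forest
    reorder   : G ↭ component ∷ others
    π         : Permutation ∣ G ∣ᶠ ∣ component ∷ others ∣ᶠ
    π-iso     : IsIso (parentᶠ G) (parentᶠ (component ∷ others)) π
    position  : Fin ∣ component ∣ᵗ
    π-position : π ⟨$⟩ʳ i ≡ position ↑ˡ ∣ others ∣ᶠ
    is-component : componentOf G i ≡ (component , position)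

locate : ∀ G i → Located G i
locate (T ∷ F) i with side ∣ T ∣ᵗ ∣ F ∣ᶠ i
... | left a = record
  { component = T ; others = F ; reorder = ↭.refl ; π = Perm.id ; π-iso = IsIso-id (parentᶠ (T ∷ F)) ; position = a ; π-position = refl
  ; is-component = componentOf-left T F a }
... | right b = record
  { component = U ; others = T ∷ G ; reorder = ↭.trans (prep T L.reorder) (↭.swap T U ↭.refl)
  ; π = ρ ∘ₚ ε
  ; π-iso = IsIso-∘ (parentᶠ (T ∷ F)) (parentᶠ (T ∷ U ∷ G)) (parentᶠ (U ∷ T ∷ G)) ρ ε
      (blockSum-iso Perm.id L.π (parentᵗ T) (parentᵗ T) (parentᶠ F) (parentᶠ (U ∷ G)) (IsIso-id (parentᵗ T)) L.π-iso)
      (exchange-iso (parentᵗ T) (parentᵗ U) (parentᶠ G))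
  ; position = L.position
  ; π-position = ≡.trans (cong (ε ⟨$⟩ʳ_) (≡.trans (blockSum-right Perm.id L.π b) (cong (∣ T ∣ᵗ ↑ʳ_) L.π-position)))
                       (exchange₂ ∣ T ∣ᵗ ∣ U ∣ᵗ ∣ G ∣ᶠ L.position)
  ; is-component = ≡.trans (componentOf-right T F b) L.is-component
  }
  where
  module L = Located (locate F b)
  U = L.component
  G = L.others
  ρ = blockSum Perm.id L.π
  ε = exchangeₚ ∣ T ∣ᵗ ∣ U ∣ᵗ ∣ G ∣ᶠ

filter-length-⇔ : ∀ {A : Set} {P Q : A → Set} (P? : ∀ x → Dec (P x)) (Q? : ∀ x → Dec (Q x)) →
  (∀ x → P x → Q x) → (∀ x → Q x → P x) → ∀ xs → length (filter P? xs) ≡ length (filter Q? xs)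
filter-length-⇔ P? Q? P⇒Q Q⇒P xs = cong length (List.filter-≐ P? Q? ((λ {x} → P⇒Q x) , (λ {x} → Q⇒P x)) xs)

mult-cong : ∀ T U → T ≅ᵗ U → ∀ F → multiplicity T F ≡ multiplicity U F
mult-cong T U T≅U = filter-length-⇔ (T ≅ᵗ?_) (U ≅ᵗ?_)
  (λ V → ≅ᵗ-trans U T V (≅ᵗ-sym T U T≅U)) (λ V → ≅ᵗ-trans T U V T≅U)

mult-↭ : ∀ T {F G} → F ↭ G → multiplicity T F ≡ multiplicity T G
mult-↭ T F↭G = ↭-length (filter-↭ (T ≅ᵗ?_) F↭G)

mult-yes : ∀ T U F → T ≅ᵗ U → multiplicity T (U ∷ F) ≡ suc (multiplicity T F)
mult-yes T U F T≅U = cong length (List.filter-accept (T ≅ᵗ?_) {xs = F} T≅U)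

mult-no : ∀ T U F → ¬ T ≅ᵗ U → multiplicity T (U ∷ F) ≡ multiplicity T F
mult-no T U F T≇U = cong length (List.filter-reject (T ≅ᵗ?_) {xs = F} T≇U)

mult-∷ : ∀ V T U F G → T ≅ᵗ U → multiplicity V F ≡ multiplicity V G → multiplicity V (T ∷ F) ≡ multiplicity V (U ∷ G)
mult-∷ V T U F G T≅U eq = case V ≅ᵗ? T of λ where
  (yes V≅T) → ≡.trans (mult-yes V T F V≅T) (≡.trans (cong suc eq) (≡.sym (mult-yes V U G (≅ᵗ-trans V T U V≅T T≅U))))
  (no  V≇T) → ≡.trans (mult-no V T F V≇T) (≡.trans eq (≡.sym (mult-no V U G λ V≅U → V≇T (≅ᵗ-trans V U T V≅U (≅ᵗ-sym T U T≅U)))))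

mult-∷⁻ : ∀ V T U F G → T ≅ᵗ U → multiplicity V (T ∷ F) ≡ multiplicity V (U ∷ G) → multiplicity V F ≡ multiplicity V G
mult-∷⁻ V T U F G T≅U eq = case V ≅ᵗ? T of λ where
  (yes V≅T) → ℕ.suc-injective (≡.trans (≡.sym (mult-yes V T F V≅T)) (≡.trans eq (mult-yes V U G (≅ᵗ-trans V T U V≅T T≅U))))
  (no  V≇T) → ≡.trans (≡.sym (mult-no V T F V≇T)) (≡.trans eq (mult-no V U G λ V≅U → V≇T (≅ᵗ-trans V U T V≅U (≅ᵗ-sym T U T≅U))))

mult-++ : ∀ V F G → multiplicity V (F ++ G) ≡ multiplicity V F ℕ.+ multiplicity V G
mult-++ V F G = ≡.trans (cong length (List.filter-++ (V ≅ᵗ?_) F G)) (List.length-++ (filter (V ≅ᵗ?_) F))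

mult-positive : ∀ T F → multiplicity T F ≢ 0 → ∃ λ U → U ∈ F × T ≅ᵗ U
mult-positive T [] m≢0 = ⊥-elim (m≢0 refl)
mult-positive T (U ∷ F) m≢0 = case T ≅ᵗ? U of λ where
  (yes T≅U) → U , here refl , T≅U
  (no  T≇U) → let V , V∈ , T≅V = mult-positive T F (m≢0 ∘ ≡.trans (mult-no T U F T≇U)) in V , there V∈ , T≅V

mult-absent : ∀ T F → (∀ {U} → U ∈ F → ¬ T ≅ᵗ U) → multiplicity T F ≡ 0
mult-absent T F h with multiplicity T F ℕ.≟ 0
... | yes m≡0 = m≡0
... | no  m≢0 = let U , U∈ , T≅U = mult-positive T F m≢0 in ⊥-elim (h U∈ T≅U)

mult≢0 : ∀ T U F → U ∈ F → T ≅ᵗ U → multiplicity T F ≢ 0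
mult≢0 T U F U∈ T≅U eq with ∈-∃++ U∈
... | G , H , refl with ≡.trans (≡.sym eq) (≡.trans (mult-↭ T (shift U G H)) (mult-yes T U (G ++ H) T≅U))
... | ()

-- The root of `T` lands in some component of `G`. With that component in front, `blocks` splits the
-- isomorphism into one between the two trees and one between the remaining forests, to which the
-- induction applies.
≅ᶠ⇒mult : ∀ F G → F ≅ᶠ G → ∀ V → multiplicity V F ≡ multiplicity V G
≅ᶠ⇒mult [] [] _ V = refl
≅ᶠ⇒mult [] (node G ∷ H) (mk≅ᶠ (π , _)) V with Perm.↔⇒≡ π
... | ()
≅ᶠ⇒mult (T ∷ F) G (mk≅ᶠ (σ , iso)) V =
  let α , τ , α-iso , τ-iso , _ = blocks T L.component (parentᶠ F) (parentᶠ L.others) (σ ∘ₚ L.π)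
        (IsIso-∘ (parentᶠ (T ∷ F)) (parentᶠ G) (parentᶠ (L.component ∷ L.others)) σ L.π iso L.π-iso)
        (L.position , L.π-position)
  in ≡.trans (mult-∷ V T L.component F L.others (α , α-iso) (≅ᶠ⇒mult F L.others (mk≅ᶠ (τ , τ-iso)) V)) (≡.sym (mult-↭ V L.reorder))
  where module L = Located (locate G (σ ⟨$⟩ʳ (rootᵗ T ↑ˡ ∣ F ∣ᶠ)))

-- Greedy matching: `T` has positive multiplicity in `G`, so some `U` isomorphic to it can be taken
-- out of `G`, and the multiplicities of the remaining forests still agree.
mult⇒≅ᶠ : ∀ F G → (∀ V → multiplicity V F ≡ multiplicity V G) → F ≅ᶠ G
mult⇒≅ᶠ [] [] eq = ≅ᶠ-refl
mult⇒≅ᶠ [] (T ∷ G) eq = ⊥-elim (mult≢0 T T (T ∷ G) (here refl) (≅ᵗ-refl T) (≡.sym (eq T)))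
mult⇒≅ᶠ (T ∷ F) G eq with mult-positive T G (mult≢0 T T (T ∷ F) (here refl) (≅ᵗ-refl T) ∘ ≡.trans (eq T))
... | U , U∈ , T≅U with ∈-∃++ U∈
... | G₁ , G₂ , refl = ≅ᶠ-trans
  (≅ᶠ-∷ T≅U (mult⇒≅ᶠ F (G₁ ++ G₂) λ V → mult-∷⁻ V T U F (G₁ ++ G₂) T≅U (≡.trans (eq V) (mult-↭ V (shift U G₁ G₂)))))
  (↭⇒≅ᶠ (↭-sym (shift U G₁ G₂)))

∼⇒mult : ∀ F G → F ∼ G → ∀ V → multiplicity V F ≡ multiplicity V G
∼⇒mult F G F∼G V = case Any.any? (V ≅ᵗ?_) (F ++ G) of λ where
  (yes a) → let U , U∈ , V≅U = find a in
    ≡.trans (mult-cong V U V≅U F) (≡.trans (All.lookup F∼G U∈) (≡.sym (mult-cong V U V≅U G)))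
  (no ¬a) → ≡.trans (mult-absent V F (λ U∈ V≅U → ¬a (lose (∈-++⁺ˡ U∈) V≅U)))
                  (≡.sym (mult-absent V G (λ U∈ V≅U → ¬a (lose (∈-++⁺ʳ F U∈) V≅U))))

∼⇒≅ᶠ : ∀ F G → F ∼ G → F ≅ᶠ G
∼⇒≅ᶠ F G F∼G = mult⇒≅ᶠ F G (∼⇒mult F G F∼G)

≅ᶠ⇒∼ : ∀ F G → F ≅ᶠ G → F ∼ G
≅ᶠ⇒∼ F G F≅G = All.tabulate λ {T} _ → ≅ᶠ⇒mult F G F≅G T

≅ᶠ-size : ∀ F G → F ≅ᶠ G → ∣ F ∣ᶠ ≡ ∣ G ∣ᶠ
≅ᶠ-size F G (mk≅ᶠ (π , _)) = Perm.↔⇒≡ π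

-- Automorphisms weighted by their fixed nodes

-- The colour `c` selects the nodes that carry a factor u. Inclusion-exclusion over the components
-- changes the colour of one tree at a time.
isFixed : ∀ {n} → (Fin n → Bool) → Permutation′ n → Fin n → ℕ
isFixed c σ i = if c i ∧ does (σ ⟨$⟩ʳ i Fin.≟ i) then 1 else 0

fixedIn : ∀ {n} → (Fin n → Bool) → Permutation′ n → ℕ
fixedIn c σ = ℕΣ.sum (isFixed c σ)

length-filter-tabulate : ∀ {A : Set} {P : A → Set} (P? : ∀ x → Dec (P x)) {n} (f : Fin n → A) →
  length (filter P? (tabulate f)) ≡ ℕΣ.sum (λ i → if does (P? (f i)) then 1 else 0)
length-filter-tabulate P? {zero}  f = refl
length-filter-tabulate P? {suc n} f with P? (f zero)
... | yes _ = cong suc (length-filter-tabulate P? (f ∘ suc))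
... | no  _ = length-filter-tabulate P? (f ∘ suc)

fixedPoints≡fixedIn : ∀ {n} (σ : Permutation′ n) → fixedPoints σ ≡ fixedIn (const true) σ
fixedPoints≡fixedIn σ = length-filter-tabulate (λ i → σ ⟨$⟩ʳ i Fin.≟ i) id

fixedIn-none : ∀ {n} (σ : Permutation′ n) → fixedIn (const false) σ ≡ 0
fixedIn-none {n} σ = ℕΣ.sum-replicate-zero n

does-⇔ : ∀ {P Q : Set} (p : Dec P) (q : Dec Q) → (P → Q) → (Q → P) → does p ≡ does q
does-⇔ (yes p) q f g = ≡.sym (dec-true q (f p))
does-⇔ (no ¬p) q f g = ≡.sym (dec-false q (¬p ∘ g))

isFixed-cong : ∀ {m n} (c : Fin m → Bool) (d : Fin n → Bool) (σ : Permutation′ m) (τ : Permutation′ n) {i j} →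
  c i ≡ d j → (σ ⟨$⟩ʳ i ≡ i → τ ⟨$⟩ʳ j ≡ j) → (τ ⟨$⟩ʳ j ≡ j → σ ⟨$⟩ʳ i ≡ i) → isFixed c σ i ≡ isFixed d τ j
isFixed-cong c d σ τ c≡d f g = cong (if_then 1 else 0) (cong₂ _∧_ c≡d (does-⇔ (_ Fin.≟ _) (_ Fin.≟ _) f g))

fixedIn-conjugate : ∀ {m n} (c : Fin m → Bool) (d : Fin n → Bool) (σ : Permutation′ m) (τ : Permutation′ n) (π : Permutation m n) →
  (∀ i → c i ≡ d (π ⟨$⟩ʳ i)) → (∀ i → τ ⟨$⟩ʳ (π ⟨$⟩ʳ i) ≡ π ⟨$⟩ʳ (σ ⟨$⟩ʳ i)) → fixedIn c σ ≡ fixedIn d τ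
fixedIn-conjugate c d σ τ π c≡d eq = ≡.trans
  (ℕΣ.sum-cong-≗ λ i → isFixed-cong c d σ τ (c≡d i) (λ e → ≡.trans (eq i) (cong (π ⟨$⟩ʳ_) e)) (λ e → perm-injective π (≡.trans (≡.sym (eq i)) e)))
  (≡.sym (ℕΣ.sum-permute (isFixed d τ) π))

fixedIn-resp : ∀ {n} (c : Fin n → Bool) {σ τ : Permutation′ n} → σ ≗ᴾ τ → fixedIn c σ ≡ fixedIn c τ
fixedIn-resp c {σ} {τ} eq = fixedIn-conjugate c c σ τ Perm.id (λ _ → refl) (≡.sym ∘ eq)

fixedIn-blockSum : ∀ {m n} (c : Fin m → Bool) (d : Fin n → Bool) (α : Permutation′ m) (τ : Permutation′ n) →
  fixedIn (c ⊹ d) (blockSum α τ) ≡ fixedIn c α ℕ.+ fixedIn d τ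
fixedIn-blockSum {m} {n} c d α τ = ≡.trans (sum-split ℕ.+-0-monoid m (isFixed (c ⊹ d) (blockSum α τ))) (cong₂ ℕ._+_
  (ℕΣ.sum-cong-≗ λ a → isFixed-cong (c ⊹ d) c (blockSum α τ) α (lookup-++ˡ c d a)
    (λ e → Fin.↑ˡ-injective n _ _ (≡.trans (≡.sym (blockSum-left α τ a)) e)) (λ e → ≡.trans (blockSum-left α τ a) (cong (_↑ˡ n) e)))
  (ℕΣ.sum-cong-≗ λ b → isFixed-cong (c ⊹ d) d (blockSum α τ) τ (lookup-++ʳ c d b)
    (λ e → Fin.↑ʳ-injective m _ _ (≡.trans (≡.sym (blockSum-right α τ b)) e)) (λ e → ≡.trans (blockSum-right α τ b) (cong (m ↑ʳ_) e))))

mark : ∀ A B → Fin ∣ A ++ B ∣ᶠ → Bool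
mark []      B = const false
mark (T ∷ A) B = const true ⊹ mark A B

record ColouredIso {m n} (p : Parents m) (c : Fin m → Bool) (q : Parents n) (d : Fin n → Bool) : Set where
  field
    π      : Permutation m n
    iso    : IsIso p q π
    colour : ∀ i → c i ≡ d (π ⟨$⟩ʳ i)

coloured-∘ : ∀ {l m n} {p : Parents l} {c} {q : Parents m} {d} {r : Parents n} {e} →
  ColouredIso p c q d → ColouredIso q d r e → ColouredIso p c r e
coloured-∘ {p = p} {q = q} {r = r} f g = record
  { π = F.π ∘ₚ G.π ; iso = IsIso-∘ p q r F.π G.π F.iso G.iso ; colour = λ i → ≡.trans (F.colour i) (G.colour _) }
  where module F = ColouredIso f
        module G = ColouredIso g

coloured-⊕ : ∀ {m n n′} (p : Parents m) (c : Fin m → Bool) {q : Parents n} {d} {q′ : Parents n′} {d′} →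
  ColouredIso q d q′ d′ → ColouredIso (p ⊕ q) (c ⊹ d) (p ⊕ q′) (c ⊹ d′)
coloured-⊕ {m} {n} {n′} p c {q} {d} {q′} {d′} f = record
  { π = β ; iso = blockSum-iso Perm.id F.π p p q q′ (IsIso-id p) F.iso ; colour = colour }
  where
  module F = ColouredIso f
  β = blockSum Perm.id F.π
  colour : ∀ i → (c ⊹ d) i ≡ (c ⊹ d′) (β ⟨$⟩ʳ i)
  colour i with side m n i
  ... | left a  = ≡.trans (lookup-++ˡ c d a) (≡.sym (≡.trans (cong (c ⊹ d′) (blockSum-left Perm.id F.π a)) (lookup-++ˡ c d′ a)))
  ... | right b = ≡.trans (lookup-++ʳ c d b) (≡.trans (F.colour b) (≡.sym (≡.trans (cong (c ⊹ d′) (blockSum-right Perm.id F.π b)) (lookup-++ʳ c d′ _))))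

coloured-exchange : ∀ {l m n} (p : Parents l) (c : Fin l → Bool) (q : Parents m) (d : Fin m → Bool) (r : Parents n) (e : Fin n → Bool) →
  ColouredIso (p ⊕ (q ⊕ r)) (c ⊹ (d ⊹ e)) (q ⊕ (p ⊕ r)) (d ⊹ (c ⊹ e))
coloured-exchange {l} {m} {n} p c q d r e = record
  { π = exchangeₚ l m n ; iso = exchange-iso p q r ; colour = colour }
  where
  colour : ∀ i → (c ⊹ (d ⊹ e)) i ≡ (d ⊹ (c ⊹ e)) (exchange l m n i)
  colour i with side l (m ℕ.+ n) i
  ... | left x = ≡.trans (lookup-++ˡ c (d ⊹ e) x) (≡.sym (≡.trans (cong (d ⊹ (c ⊹ e)) (exchange₁ l m n x))
                   (≡.trans (lookup-++ʳ d (c ⊹ e) (x ↑ˡ n)) (lookup-++ˡ c e x))))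
  ... | right y with side m n y
  ... | left x  = ≡.trans (lookup-++ʳ c (d ⊹ e) (x ↑ˡ n)) (≡.trans (lookup-++ˡ d e x) (≡.sym (≡.trans (cong (d ⊹ (c ⊹ e)) (exchange₂ l m n x))
                   (lookup-++ˡ d (c ⊹ e) x))))
  ... | right x = ≡.trans (lookup-++ʳ c (d ⊹ e) (m ↑ʳ x)) (≡.trans (lookup-++ʳ d e x) (≡.sym (≡.trans (cong (d ⊹ (c ⊹ e)) (exchange₃ l m n x))
                   (≡.trans (lookup-++ʳ d (c ⊹ e) (l ↑ʳ x)) (lookup-++ʳ c e x)))))

-- The splitting of automorphisms at a root treats the first tree only, so an unmarked tree behind
-- `A` has to be brought to the front together with its colour.
mark-shift : ∀ A T B → ColouredIso (parentᶠ (A ++ T ∷ B)) (mark A (T ∷ B)) (parentᵗ T ⊕ parentᶠ (A ++ B)) (const false ⊹ mark A B)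
mark-shift [] T B = record
  { π = Perm.id ; iso = IsIso-id (parentᶠ (T ∷ B)) ; colour = colour }
  where
  colour : ∀ i → false ≡ _⊹_ {m = ∣ T ∣ᵗ} {n = ∣ B ∣ᶠ} (const false) (const false) i
  colour i with side ∣ T ∣ᵗ ∣ B ∣ᶠ i
  ... | left a  = ≡.sym (lookup-++ˡ {m = ∣ T ∣ᵗ} {n = ∣ B ∣ᶠ} (const false) (const false) a)
  ... | right b = ≡.sym (lookup-++ʳ {m = ∣ T ∣ᵗ} {n = ∣ B ∣ᶠ} (const false) (const false) b)
mark-shift (U ∷ A) T B = coloured-∘
  {p = parentᵗ U ⊕ parentᶠ (A ++ T ∷ B)} {q = parentᵗ U ⊕ (parentᵗ T ⊕ parentᶠ (A ++ B))} {r = parentᵗ T ⊕ (parentᵗ U ⊕ parentᶠ (A ++ B))}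
  (coloured-⊕ (parentᵗ U) (const true) {parentᶠ (A ++ T ∷ B)} {q′ = parentᵗ T ⊕ parentᶠ (A ++ B)} (mark-shift A T B))
  (coloured-exchange (parentᵗ U) (const true) (parentᵗ T) (const false) (parentᶠ (A ++ B)) (mark A B))

module Weights (K : CommutativeRing 0ℓ 0ℓ) (u : CommutativeRing.Carrier K) where

  open CommutativeRing K hiding (zero; refl)
  open Sums K public
  open import Algebra.Properties.Semiring.Exp semiring public using (_^_; ^-homo-*)
  open import Relation.Binary.Reasoning.Setoid setoid

  weight : ∀ {n} → (Fin n → Bool) → Permutation′ n → Carrier
  weight c σ = u ^ fixedIn c σ

  W : ∀ {n} → Parents n → (Fin n → Bool) → Carrier
  W p c = ∑ (automorphisms p) (weight c)

  card : ∀ {n} → Parents n → Carrier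
  card p = ∑ (automorphisms p) (const 1#)

  W-none : ∀ {n} (p : Parents n) → W p (const false) ≈ card p
  W-none p = ∑-cong (automorphisms p) λ {σ} _ → reflexive (cong (u ^_) (fixedIn-none σ))

  -- Conjugation by `π` carries automorphisms to automorphisms and coloured fixed nodes to coloured
  -- fixed nodes. The relation `R σ τ` expresses it as τπ = πσ, without an inverse.
  W-conjugate : ∀ {m n} (p : Parents m) c (q : Parents n) d → ColouredIso p c q d → W p c ≈ W q d
  W-conjugate p c q d e = ∑-bijection (isos-enum p p) (isos-enum q q)
    (λ {x} {y} → ≗ᴾ-sym {π = x} {y}) (λ {x} {y} → ≗ᴾ-sym {π = x} {y})
    R (λ {σ} {σ′} {τ} → respˡ {σ} {σ′} {τ}) (λ {σ} {τ} {τ′} → respʳ {σ} {τ} {τ′}) (λ {σ} → to {σ}) (λ {τ} → from {τ})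
    (λ {σ} {τ} {τ′} _ → func {σ} {τ} {τ′}) (λ {σ} {σ′} {τ} _ r r′ i → perm-injective π (≡.trans (≡.sym (r i)) (r′ i)))
    (weight c) (weight d) (λ {σ} {τ} _ _ r → reflexive (cong (u ^_) (fixedIn-conjugate c d σ τ π colour r)))
    where
    open ColouredIso e
    R : _ → _ → Set
    R σ τ = ∀ i → τ ⟨$⟩ʳ (π ⟨$⟩ʳ i) ≡ π ⟨$⟩ʳ (σ ⟨$⟩ʳ i)
    respˡ : ∀ {σ σ′ τ} → σ ≗ᴾ σ′ → R σ τ → R σ′ τ
    respˡ e r i = ≡.trans (r i) (cong (π ⟨$⟩ʳ_) (e i))
    respʳ : ∀ {σ τ τ′} → τ ≗ᴾ τ′ → R σ τ → R σ τ′
    respʳ e r i = ≡.trans (≡.sym (e _)) (r i)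
    iso⁻¹ = IsIso-flip p q π iso
    to : ∀ {σ} → IsIso p p σ → ∃ λ τ → IsIso q q τ × R σ τ
    to {σ} σ-iso = (Perm.flip π ∘ₚ (σ ∘ₚ π)) ,
      IsIso-∘ q p q (Perm.flip π) (σ ∘ₚ π) iso⁻¹ (IsIso-∘ p p q σ π σ-iso iso) ,
      λ i → cong (λ j → π ⟨$⟩ʳ (σ ⟨$⟩ʳ j)) (Perm.inverseˡ π)
    from : ∀ {τ} → IsIso q q τ → ∃ λ σ → IsIso p p σ × R σ τ
    from {τ} τ-iso = (π ∘ₚ (τ ∘ₚ Perm.flip π)) ,
      IsIso-∘ p q p π (τ ∘ₚ Perm.flip π) iso (IsIso-∘ q q p τ (Perm.flip π) τ-iso iso⁻¹) ,
      λ i → ≡.sym (Perm.inverseʳ π)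
    func : ∀ {σ τ τ′} → R σ τ → R σ τ′ → τ ≗ᴾ τ′
    func {σ} {τ} {τ′} r r′ j = ≡.trans (cong (τ ⟨$⟩ʳ_) (≡.sym (Perm.inverseʳ π)))
      (≡.trans (≡.trans (r (π ⟨$⟩ˡ j)) (≡.sym (r′ (π ⟨$⟩ˡ j)))) (cong (τ′ ⟨$⟩ʳ_) (Perm.inverseʳ π)))

  W-cong : ∀ {m n} {p : Parents m} {q : Parents n} {b} → p ≅ q → W p (const b) ≈ W q (const b)
  W-cong {p = p} {q} (π , iso) = W-conjugate p _ q _ (record { π = π ; iso = iso ; colour = λ _ → refl })

  card-cong : ∀ {m n} (p : Parents m) (q : Parents n) → p ≅ q → card p ≈ card q
  card-cong p q p≅q = trans (sym (W-none p)) (trans (W-cong {p = p} {q} p≅q) (W-none q))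

  -- The bijection sends σ to the composite of `ρ`, then σ, then `ρ′`. With one of the two the
  -- identity, this is the coset argument of orbit-stabiliser: to every node of an orbit lead as
  -- many automorphisms as the stabiliser has.
  translate : ∀ {n} (p : Parents n) ρ ρ′ → IsIso p p ρ → IsIso p p ρ′ → ∀ v w →
    ∑ (filter (λ σ → σ ⟨$⟩ʳ (ρ ⟨$⟩ʳ v) Fin.≟ w) (automorphisms p)) (const 1#)
    ≈ ∑ (filter (λ σ → σ ⟨$⟩ʳ v Fin.≟ (ρ′ ⟨$⟩ʳ w)) (automorphisms p)) (const 1#)
  translate p ρ ρ′ ρ-iso ρ′-iso v w = ∑-bijection
    (enum-filter {_≈_ = _≗ᴾ_} _ (λ {x} {y} → moves {x} {y}) (isos-enum p p)) (enum-filter {_≈_ = _≗ᴾ_} _ (λ {x} {y} → moves {x} {y}) (isos-enum p p))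
    (λ {x} {y} → ≗ᴾ-sym {π = x} {y}) (λ {x} {y} → ≗ᴾ-sym {π = x} {y})
    (λ σ τ → (ρ ∘ₚ (σ ∘ₚ ρ′)) ≗ᴾ τ)
    (λ e r i → ≡.trans (cong (ρ′ ⟨$⟩ʳ_) (≡.sym (e _))) (r i)) (λ e r i → ≡.trans (r i) (e i))
    (λ {σ} (σ-iso , eq) → (ρ ∘ₚ (σ ∘ₚ ρ′)) ,
      (IsIso-∘ p p p ρ (σ ∘ₚ ρ′) ρ-iso (IsIso-∘ p p p σ ρ′ σ-iso ρ′-iso) , cong (ρ′ ⟨$⟩ʳ_) eq) , λ _ → refl)
    (λ {τ} (τ-iso , eq) → (Perm.flip ρ ∘ₚ (τ ∘ₚ Perm.flip ρ′)) ,
      (IsIso-∘ p p p (Perm.flip ρ) (τ ∘ₚ Perm.flip ρ′) (IsIso-flip p p ρ ρ-iso) (IsIso-∘ p p p τ (Perm.flip ρ′) τ-iso (IsIso-flip p p ρ′ ρ′-iso))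
      , ≡.trans (cong (λ i → ρ′ ⟨$⟩ˡ (τ ⟨$⟩ʳ i)) (Perm.inverseˡ ρ)) (≡.trans (cong (ρ′ ⟨$⟩ˡ_) eq) (Perm.inverseˡ ρ′)))
      , λ i → ≡.trans (Perm.inverseʳ ρ′) (cong (τ ⟨$⟩ʳ_) (Perm.inverseˡ ρ)))
    (λ _ r r′ i → ≡.trans (≡.sym (r i)) (r′ i))
    (λ {σ} {σ′} _ r r′ i → ≡.trans (≡.trans (cong (σ ⟨$⟩ʳ_) (≡.sym (Perm.inverseʳ ρ))) (perm-injective ρ′ (≡.trans (r (ρ ⟨$⟩ˡ i)) (≡.sym (r′ (ρ ⟨$⟩ˡ i)))))) (cong (σ′ ⟨$⟩ʳ_) (Perm.inverseʳ ρ)))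
    (const 1#) (const 1#) (λ _ _ _ → CommutativeRing.refl K)
    where
    moves : ∀ {σ τ i j} → σ ≗ᴾ τ → σ ⟨$⟩ʳ i ≡ j → τ ⟨$⟩ʳ i ≡ j
    moves {i = i} e eq = ≡.trans (≡.sym (e i)) eq

  card-by-image : ∀ {n} (p : Parents n) v →
    card p ≈ sum (λ w → ∑ (filter (λ σ → σ ⟨$⟩ʳ v Fin.≟ w) (automorphisms p)) (const 1#))
  card-by-image {n} p v = begin
    ∑ (automorphisms p) (const 1#)
      ≈⟨ ∑-cong (automorphisms p) (λ {σ} _ → trans (sym ([-]·-yes (σ ⟨$⟩ʳ v Fin.≟ _) 1# refl))
          (sym (sum-delta (σ ⟨$⟩ʳ v) (λ w → [ σ ⟨$⟩ʳ v Fin.≟ w ]· 1#) λ w w≢ → [-]·-no (_ Fin.≟ _) 1# (w≢ ∘ ≡.sym)))) ⟩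
    ∑ (automorphisms p) (λ σ → sum (λ w → [ σ ⟨$⟩ʳ v Fin.≟ w ]· 1#)) ≈⟨ ∑-sum (automorphisms p) (λ σ w → [ σ ⟨$⟩ʳ v Fin.≟ w ]· 1#) ⟩
    sum (λ w → ∑ (automorphisms p) (λ σ → [ σ ⟨$⟩ʳ v Fin.≟ w ]· 1#))
      ≈⟨ sum-cong-≋ (λ w → sym (∑-filter (λ σ → σ ⟨$⟩ʳ v Fin.≟ w) (automorphisms p) (const 1#))) ⟩
    sum (λ w → ∑ (filter (λ σ → σ ⟨$⟩ʳ v Fin.≟ w) (automorphisms p)) (const 1#)) ∎

  module _ (T : Tree) {n} (q : Parents n) where

    private
      p = parentᵗ T ⊕ q
      r = rootᵗ T ↑ˡ n

    fixesRoot? : ∀ σ → Dec (σ ⟨$⟩ʳ r ≡ r)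
    fixesRoot? σ = σ ⟨$⟩ʳ r Fin.≟ r

    -- An automorphism fixing the root of `T` is a block sum in exactly one way up to pointwise
    -- equality, so these automorphisms form the product of the two groups.
    ∑-fixesRoot : ∀ f (g : Permutation′ ∣ T ∣ᵗ → Permutation′ n → Carrier) → (∀ σ α τ → σ ≗ᴾ blockSum α τ → f σ ≈ g α τ) →
      ∑ (filter fixesRoot? (automorphisms p)) f ≈ ∑ (automorphisms (parentᵗ T)) (λ α → ∑ (automorphisms q) (g α))
    ∑-fixesRoot f g f≈g = trans
      (∑-bijection
        (enum-filter {_≈_ = _≗ᴾ_} fixesRoot? (λ e eq → ≡.trans (≡.sym (e r)) eq) (isos-enum p p))
        (enum-product {_≈_ = _≗ᴾ_} {_≗ᴾ_} (isos-enum (parentᵗ T) (parentᵗ T)) (isos-enum q q))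
        (λ {x} {y} → ≗ᴾ-sym {π = x} {y}) (λ {(α , τ)} {(α′ , τ′)} (e , e′) → ≗ᴾ-sym {π = α} {α′} e , ≗ᴾ-sym {π = τ} {τ′} e′)
        (λ σ (α , τ) → σ ≗ᴾ blockSum α τ)
        (λ e h i → ≡.trans (≡.sym (e i)) (h i))
        (λ {σ} {(α , τ)} {(α′ , τ′)} (e , e′) h i → ≡.trans (h i) (block-cong α α′ τ τ′ e e′ i))
        (λ {σ} (σ-iso , eq) → let α , τ , α-iso , τ-iso , h = blocks T T q q σ σ-iso (rootᵗ T , eq) in (α , τ) , (α-iso , τ-iso) , h)
        (λ {(α , τ)} (α-iso , τ-iso) → blockSum α τ ,
          (blockSum-iso α τ (parentᵗ T) (parentᵗ T) q q α-iso τ-iso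
          , root↦root T T q q (blockSum α τ) (blockSum-iso α τ (parentᵗ T) (parentᵗ T) q q α-iso τ-iso) (_ , blockSum-left α τ (rootᵗ T)))
          , λ _ → refl)
        (λ {σ} {(α , τ)} {(α′ , τ′)} _ h h′ →
          (λ a → Fin.↑ˡ-injective n _ _ (≡.trans (≡.sym (blockSum-left α τ a)) (≡.trans (≡.trans (≡.sym (h _)) (h′ _)) (blockSum-left α′ τ′ a))))
          , (λ b → Fin.↑ʳ-injective ∣ T ∣ᵗ _ _ (≡.trans (≡.sym (blockSum-right α τ b)) (≡.trans (≡.trans (≡.sym (h _)) (h′ _)) (blockSum-right α′ τ′ b)))))
        (λ _ h h′ i → ≡.trans (h i) (≡.sym (h′ i)))
        f (λ (α , τ) → g α τ) (λ {σ} {(α , τ)} _ _ h → f≈g σ α τ h))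
      (∑-cartesianProduct (automorphisms (parentᵗ T)) (automorphisms q) g)
      where
      block-cong : ∀ (α α′ : Permutation′ ∣ T ∣ᵗ) (τ τ′ : Permutation′ n) → α ≗ᴾ α′ → τ ≗ᴾ τ′ → blockSum α τ ≗ᴾ blockSum α′ τ′
      block-cong α α′ τ τ′ e e′ i with side ∣ T ∣ᵗ n i
      ... | left a  = ≡.trans (blockSum-left α τ a) (≡.trans (cong (_↑ˡ n) (e a)) (≡.sym (blockSum-left α′ τ′ a)))
      ... | right b = ≡.trans (blockSum-right α τ b) (≡.trans (cong (∣ T ∣ᵗ ↑ʳ_) (e′ b)) (≡.sym (blockSum-right α′ τ′ b)))

    -- Any constant colour on `T` would give the same value, since an automorphism that moves the
    -- root of `T` fixes no node of `T`. Hence this summand is common to `Z-true` and `Z-false`.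
    movingRoot : (Fin n → Bool) → Carrier
    movingRoot c = ∑ (filter (¬? ∘ fixesRoot?) (automorphisms p)) (weight (const false ⊹ c))

    -- An automorphism fixing some node of T fixes its root, and so restricts to T and q.
    W-split : ∀ b c → W p (const b ⊹ c) ≈ W (parentᵗ T) (const b) * W q c + movingRoot c
    W-split b c = trans (∑-partition fixesRoot? (automorphisms p) (weight (const b ⊹ c))) (+-cong fixing moving)
      where
      fixing : ∑ (filter fixesRoot? (automorphisms p)) (weight (const b ⊹ c)) ≈ W (parentᵗ T) (const b) * W q c
      fixing = begin
        ∑ (filter fixesRoot? (automorphisms p)) (weight (const b ⊹ c))
          ≈⟨ ∑-fixesRoot (weight (const b ⊹ c)) (λ α τ → weight (const b) α * weight c τ) (λ σ α τ h →
              trans (reflexive (cong (u ^_) (≡.trans (fixedIn-resp (const b ⊹ c) {σ} {blockSum α τ} h) (fixedIn-blockSum (const b) c α τ))))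
                    (^-homo-* u (fixedIn (const b) α) (fixedIn c τ))) ⟩
        ∑ (automorphisms (parentᵗ T)) (λ α → ∑ (automorphisms q) (λ τ → weight (const b) α * weight c τ))
          ≈⟨ ∑-cong (automorphisms (parentᵗ T)) (λ {α} _ → ∑-*ˡ (automorphisms q) (weight (const b) α) (weight c)) ⟨
        ∑ (automorphisms (parentᵗ T)) (λ α → weight (const b) α * W q c)
          ≈⟨ ∑-*ʳ (automorphisms (parentᵗ T)) (W q c) (weight (const b)) ⟨
        W (parentᵗ T) (const b) * W q c ∎
      same : ∀ σ → IsIso p p σ → σ ⟨$⟩ʳ r ≢ r → fixedIn (const b ⊹ c) σ ≡ fixedIn (const false ⊹ c) σ
      same σ σ-iso σr≢r = ℕΣ.sum-cong-≗ each
        where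
        each : ∀ i → isFixed (const b ⊹ c) σ i ≡ isFixed (const false ⊹ c) σ i
        each i with side ∣ T ∣ᵗ n i
        ... | left a rewrite dec-false (σ ⟨$⟩ʳ (a ↑ˡ n) Fin.≟ a ↑ˡ n)
                (λ e → σr≢r (root↦root T T q q σ σ-iso (mapsLeft⇒root T T q q σ σ-iso a (a , e))))
              with (const b ⊹ c) (a ↑ˡ n) | (const false ⊹ c) (a ↑ˡ n)
        ... | true  | true  = refl
        ... | true  | false = refl
        ... | false | true  = refl
        ... | false | false = refl
        each i | right y = isFixed-cong (const b ⊹ c) (const false ⊹ c) σ σ
          (≡.trans (lookup-++ʳ {m = ∣ T ∣ᵗ} (const b) c y) (≡.sym (lookup-++ʳ {m = ∣ T ∣ᵗ} (const false) c y))) id id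
      moving : ∑ (filter (¬? ∘ fixesRoot?) (automorphisms p)) (weight (const b ⊹ c)) ≈ movingRoot c
      moving = ∑-cong (filter (¬? ∘ fixesRoot?) (automorphisms p)) λ {σ} σ∈ →
        let σ∈′ , ¬fix = ∈-filter⁻ (¬? ∘ fixesRoot?) {xs = automorphisms p} σ∈ in
        reflexive (cong (u ^_) (same σ (Enumeration.sound (isos-enum p p) σ∈′) ¬fix))

  -- Only the fixed nodes in the trees of A carry a factor u.
  Z : Forest → Forest → Carrier
  Z A B = W (parentᶠ (A ++ B)) (mark A B)

  Z-[] : ∀ B → Z [] B ≈ card (parentᶠ B)
  Z-[] B = W-none (parentᶠ B)

  Zᵗ : Tree → Carrier
  Zᵗ T = W (parentᵗ T) (const true)

  cardᵗ : Tree → Carrier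
  cardᵗ T = card (parentᵗ T)

  Z-true : ∀ T A B → Z (T ∷ A) B ≈ Zᵗ T * Z A B + movingRoot T (parentᶠ (A ++ B)) (mark A B)
  Z-true T A B = W-split T (parentᶠ (A ++ B)) true (mark A B)

  Z-false : ∀ T A B → Z A (T ∷ B) ≈ cardᵗ T * Z A B + movingRoot T (parentᶠ (A ++ B)) (mark A B)
  Z-false T A B = trans
    (W-conjugate (parentᶠ (A ++ T ∷ B)) (mark A (T ∷ B)) (parentᵗ T ⊕ parentᶠ (A ++ B)) (const false ⊹ mark A B) (mark-shift A T B))
    (trans (W-split T (parentᶠ (A ++ B)) false (mark A B)) (+-congʳ (*-congʳ (W-none (parentᵗ T)))))

enum-deduplicate : ∀ {A : Set} {_≈_ : A → A → Set} (_≈?_ : ∀ x y → Dec (x ≈ y)) →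
  (∀ {x y} → x ≈ y → y ≈ x) → (∀ {x y z} → x ≈ y → y ≈ z → x ≈ z) → (∀ {x} → x ≈ x) →
  ∀ xs → Enumeration _≈_ (_∈ xs) (deduplicate _≈?_ xs)
enum-deduplicate {_≈_ = _≈_} _≈?_ ≈-sym ≈-trans ≈-refl xs = record
  { sound    = Any.deduplicate⁻ _≈?_
  ; complete = λ x∈ → find (Any.deduplicate⁺ _≈?_ (λ y≈z x≈y → ≈-trans x≈y (≈-sym y≈z)) (lose {P = _ ≈_} x∈ ≈-refl))
  ; unique   = go xs
  }
  where
  go : ∀ xs → AllPairs (λ x y → ¬ x ≈ y) (deduplicate _≈?_ xs)
  go []       = []
  go (x ∷ xs) = All.all-filter (¬? ∘ (x ≈?_)) (deduplicate _≈?_ xs) ∷ AllPairs.filter⁺ (¬? ∘ (x ≈?_)) (go xs)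

-- Adding and removing a root; copies of a tree in a forest

lift-maybe : ∀ {m n} (τ : Permutation m n) x → Perm.lift₀ τ ⟨$⟩ʳ (maybe suc zero x) ≡ maybe suc zero (Maybe.map (τ ⟨$⟩ʳ_) x)
lift-maybe τ nothing  = refl
lift-maybe τ (just _) = refl

node-iso : ∀ F G τ → IsIso (parentᶠ F) (parentᶠ G) τ → IsIso (parentᵗ (node F)) (parentᵗ (node G)) (Perm.lift₀ τ)
node-iso F G τ iso zero    = refl
node-iso F G τ iso (suc i) = cong just (≡.trans (lift-maybe τ (parentᶠ F i)) (cong (maybe suc zero) (iso i)))

maybe-suc-zero-injective : ∀ {n} {x y : Maybe (Fin n)} → maybe suc zero x ≡ maybe {B = λ _ → Fin (suc n)} suc zero y → x ≡ y
maybe-suc-zero-injective {x = nothing} {nothing} eq = refl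
maybe-suc-zero-injective {x = just _}  {just _}  eq = cong just (Fin.suc-injective eq)

-- The root is the only node without a parent, so an isomorphism sends `zero` to `zero` and is the
-- lift of its restriction.
node-iso⁻ : ∀ F G σ → IsIso (parentᵗ (node F)) (parentᵗ (node G)) σ →
  ∃ λ τ → IsIso (parentᶠ F) (parentᶠ G) τ × Perm.lift₀ τ ≗ᴾ σ
node-iso⁻ F G σ iso = τ , τ-iso , lifted
  where
  σ0 : σ ⟨$⟩ʳ zero ≡ zero
  σ0 = root-unique (node G) _ (≡.sym (iso zero))
  τ = Perm.remove zero σ
  lifted : Perm.lift₀ τ ≗ᴾ σ
  lifted = Perm.lift₀-remove σ σ0
  iso′ : IsIso (parentᵗ (node F)) (parentᵗ (node G)) (Perm.lift₀ τ)
  iso′ = IsIso-resp {p = parentᵗ (node F)} {parentᵗ (node G)} {σ} {Perm.lift₀ τ} (≡.sym ∘ lifted) iso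
  τ-iso : IsIso (parentᶠ F) (parentᶠ G) τ
  τ-iso i = maybe-suc-zero-injective (≡.trans (≡.sym (lift-maybe τ (parentᶠ F i))) (Maybe.just-injective (iso′ (suc i))))

node-≅ : ∀ F G → F ≅ᶠ G → node F ≅ᵗ node G
node-≅ F G (mk≅ᶠ (τ , iso)) = Perm.lift₀ τ , node-iso F G τ iso

node-≅⁻ : ∀ F G → node F ≅ᵗ node G → F ≅ᶠ G
node-≅⁻ F G (σ , iso) = let τ , τ-iso , _ = node-iso⁻ F G σ iso in mk≅ᶠ (τ , τ-iso)

IsCopy : Tree → Σ Tree (λ V → Fin ∣ V ∣ᵗ) → Set
IsCopy T (V , x) = T ≅ᵗ V × x ≡ rootᵗ V

isCopy? : ∀ T V → Dec (IsCopy T V)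
isCopy? T (V , x) = (T ≅ᵗ? V) ×-dec (x Fin.≟ rootᵗ V)

mult-replicate : ∀ T k R → multiplicity T R ≡ 0 → multiplicity T (replicate k T ++ R) ≡ k
mult-replicate T zero    R eq = eq
mult-replicate T (suc k) R eq = ≡.trans (mult-yes T T (replicate k T ++ R) (≅ᵗ-refl T)) (cong suc (mult-replicate T k R eq))

mark-[] : ∀ F → ColouredIso (parentᶠ (F ++ [])) (mark F []) (parentᶠ F) (const true)
mark-[] [] = record { π = Perm.id ; iso = λ () ; colour = λ () }
mark-[] (T ∷ F) = coloured-∘ {p = parentᵗ T ⊕ parentᶠ (F ++ [])} {q = parentᵗ T ⊕ parentᶠ F} {r = parentᵗ T ⊕ parentᶠ F}
  (coloured-⊕ (parentᵗ T) (const true) {parentᶠ (F ++ [])} {q′ = parentᶠ F} (mark-[] F))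
  (record { π = Perm.id ; iso = IsIso-id (parentᵗ T ⊕ parentᶠ F) ; colour = colour })
  where
  colour : ∀ i → _⊹_ {m = ∣ T ∣ᵗ} {n = ∣ F ∣ᶠ} (const true) (const true) i ≡ true
  colour i with side ∣ T ∣ᵗ ∣ F ∣ᶠ i
  ... | left a  = lookup-++ˡ {m = ∣ T ∣ᵗ} {n = ∣ F ∣ᶠ} (const true) (const true) a
  ... | right b = lookup-++ʳ {m = ∣ T ∣ᵗ} {n = ∣ F ∣ᶠ} (const true) (const true) b

-- Orders of automorphism groups, and weighted totals for copies of one tree

module Counting (K : CommutativeRing 0ℓ 0ℓ) (u : CommutativeRing.Carrier K) where

  open CommutativeRing K hiding (zero; refl)
  open Weights K u public
  open import Algebra.Solver.Ring.NaturalCoefficients.Default commutativeSemiring using (solve; _:=_; _:+_; _:*_; con)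
  open import Relation.Binary.Reasoning.Setoid setoid

  ∑-tabulate : ∀ {A : Set} {n} (g : Fin n → A) (f : A → Carrier) → ∑ (tabulate g) f ≈ sum (f ∘ g)
  ∑-tabulate {n = zero}  g f = ∑-[]
  ∑-tabulate {n = suc n} g f = trans (∑-∷ _ _) (+-congˡ (∑-tabulate (g ∘ suc) f))

  -- The class of `x` has a representative by completeness and no second one by uniqueness.
  ∑-enum-one : ∀ {A : Set} {_≈₁_ : A → A → Set} {P xs} (_≈?_ : ∀ x y → Dec (x ≈₁ y)) →
    (∀ {x y} → x ≈₁ y → y ≈₁ x) → (∀ {x y z} → x ≈₁ y → y ≈₁ z → x ≈₁ z) →
    Enumeration _≈₁_ P xs → ∀ {x} → P x → ∑ xs (λ y → [ y ≈? x ]· 1#) ≈ 1#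
  ∑-enum-one {_≈₁_ = _≈₁_} {xs = xs} _≈?_ ≈-sym ≈-trans e {x} p = let y , y∈ , x≈y = complete p in begin
    ∑ xs (λ y → [ y ≈? x ]· 1#) ≡⟨ ∑-lookup xs _ ⟩
    sum (λ i → [ lookup xs i ≈? x ]· 1#)
      ≈⟨ sum-delta (Any.index y∈) _ (λ j j≢i → [-]·-no (_ ≈? _) 1# λ yⱼ≈x → j≢i
           (AllPairs-lookup-injective ≈-sym unique j (Any.index y∈) (≈-trans yⱼ≈x (subst (x ≈₁_) (Any.lookup-index y∈) x≈y)))) ⟩
    [ lookup xs (Any.index y∈) ≈? x ]· 1# ≈⟨ [-]·-yes (_ ≈? _) 1# (≈-sym (subst (x ≈₁_) (Any.lookup-index y∈) x≈y)) ⟩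
    1# ∎
    where open Enumeration e

  sum-isCopy : ∀ T G s → sum (λ j → [ isCopy? T (componentOf G j) ]· s) ≈ multiplicity T G ·ₙ s
  sum-isCopy T []      s = CommutativeRing.refl K
  sum-isCopy T (U ∷ G) s = begin
    sum (λ j → [ isCopy? T (componentOf (U ∷ G) j) ]· s) ≈⟨ sum-split +-monoid ∣ U ∣ᵗ (λ j → [ isCopy? T (componentOf (U ∷ G) j) ]· s) ⟩
    sum (λ a → [ isCopy? T (componentOf (U ∷ G) (a ↑ˡ ∣ G ∣ᶠ)) ]· s) + sum (λ b → [ isCopy? T (componentOf (U ∷ G) (∣ U ∣ᵗ ↑ʳ b)) ]· s)
      ≈⟨ +-cong (sum-cong-≋ λ a → reflexive (cong (λ V → [ isCopy? T V ]· s) (componentOf-left U G a)))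
                (trans (sum-cong-≋ λ b → reflexive (cong (λ V → [ isCopy? T V ]· s) (componentOf-right U G b))) (sum-isCopy T G s)) ⟩
    sum (λ a → [ isCopy? T (U , a) ]· s) + multiplicity T G ·ₙ s ≈⟨ case T ≅ᵗ? U of (λ where
      (yes T≅U) → trans
        (+-congʳ (trans (sum-delta (rootᵗ U) (λ a → [ isCopy? T (U , a) ]· s) (λ a a≢ → [-]·-no (isCopy? T (U , a)) s (a≢ ∘ proj₂)))
                        ([-]·-yes (isCopy? T (U , rootᵗ U)) s (T≅U , refl))))
        (reflexive (≡.sym (cong (_·ₙ s) (mult-yes T U G T≅U))))
      (no T≇U) → trans
        (trans (+-congʳ (sum-zero λ a → [-]·-no (isCopy? T (U , a)) s (T≇U ∘ proj₁))) (+-identityˡ _))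
        (reflexive (≡.sym (cong (_·ₙ s) (mult-no T U G T≇U))))) ⟩
    multiplicity T (U ∷ G) ·ₙ s ∎

  module _ (T : Tree) (B : Forest) where

    private
      G = T ∷ B
      p = parentᶠ G
      r = rootᵗ T ↑ˡ ∣ B ∣ᶠ

    image⇒copy : ∀ σ → IsIso p p σ → IsCopy T (componentOf G (σ ⟨$⟩ʳ r))
    image⇒copy σ iso = subst (IsCopy T) (≡.sym L.is-component) ((α , α-iso) ,
      Fin.↑ˡ-injective ∣ L.others ∣ᶠ _ _ (≡.trans (≡.sym L.π-position)
        (root↦root T L.component (parentᶠ B) (parentᶠ L.others) (σ ∘ₚ L.π) iso′ (L.position , L.π-position))))
      where
      module L = Located (locate G (σ ⟨$⟩ʳ r))
      iso′ = IsIso-∘ p p (parentᶠ (L.component ∷ L.others)) σ L.π iso L.π-iso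
      bl = blocks T L.component (parentᶠ B) (parentᶠ L.others) (σ ∘ₚ L.π) iso′ (L.position , L.π-position)
      α = proj₁ bl
      α-iso = proj₁ (proj₂ (proj₂ bl))

    -- The component at `j` is isomorphic to `T`; cancelling the two trees leaves forests with equal
    -- multiplicities, hence isomorphic ones. The two isomorphisms are glued, and the reordering
    -- that brought the component to the front is undone.
    copy⇒image : ∀ j → IsCopy T (componentOf G j) → ∃ λ σ → IsIso p p σ × σ ⟨$⟩ʳ r ≡ j
    copy⇒image j copy with locate G j
    ... | L with subst (IsCopy T) (Located.is-component L) copy
    ... | T≅V , x≡root with mult⇒≅ᶠ B (Located.others L) (λ V → mult-∷⁻ V T (Located.component L) B (Located.others L) T≅V (mult-↭ V (Located.reorder L)))
    ... | mk≅ᶠ (τ , τ-iso) = (β ∘ₚ Perm.flip L.π) ,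
      IsIso-∘ p q p β (Perm.flip L.π) β-iso (IsIso-flip p q L.π L.π-iso) ,
      ≡.trans (cong (L.π ⟨$⟩ˡ_) (≡.trans (root↦root T L.component (parentᶠ B) (parentᶠ L.others) β β-iso (_ , blockSum-left (proj₁ T≅V) τ (rootᵗ T)))
        (≡.trans (cong (_↑ˡ ∣ L.others ∣ᶠ) (≡.sym x≡root)) (≡.sym L.π-position)))) (Perm.inverseˡ L.π)
      where
      module L = Located L
      q = parentᶠ (L.component ∷ L.others)
      β = blockSum (proj₁ T≅V) τ
      β-iso : IsIso p q β
      β-iso = blockSum-iso (proj₁ T≅V) τ (parentᵗ T) (parentᵗ L.component) (parentᶠ B) (parentᶠ L.others) (proj₂ T≅V) τ-iso

    private
      S : Fin ∣ G ∣ᶠ → Carrier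
      S j = ∑ (filter (λ σ → σ ⟨$⟩ʳ r Fin.≟ j) (automorphisms p)) (const 1#)

      S-root : S r ≈ cardᵗ T * card (parentᶠ B)
      S-root = begin
        S r ≈⟨ ∑-fixesRoot T (parentᶠ B) (const 1#) (λ _ _ → 1#) (λ _ _ _ _ → CommutativeRing.refl K) ⟩
        ∑ (automorphisms (parentᵗ T)) (const (card (parentᶠ B)))
          ≈⟨ ∑-cong (automorphisms (parentᵗ T)) (λ _ → sym (*-identityˡ _)) ⟩
        ∑ (automorphisms (parentᵗ T)) (λ _ → 1# * card (parentᶠ B)) ≈⟨ ∑-*ʳ (automorphisms (parentᵗ T)) (card (parentᶠ B)) (const 1#) ⟨
        cardᵗ T * card (parentᶠ B) ∎

      S-value : ∀ j → S j ≈ [ isCopy? T (componentOf G j) ]· (cardᵗ T * card (parentᶠ B))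
      S-value j = case isCopy? T (componentOf G j) of λ where
        (yes copy) → let ρ , ρ-iso , ρr≡j = copy⇒image j copy in begin
          S j ≡⟨ cong S ρr≡j ⟨
          S (ρ ⟨$⟩ʳ r) ≈⟨ translate p Perm.id ρ (IsIso-id p) ρ-iso r r ⟨
          S r ≈⟨ S-root ⟩
          cardᵗ T * card (parentᶠ B) ≈⟨ [-]·-yes (isCopy? T (componentOf G j)) _ copy ⟨
          [ isCopy? T (componentOf G j) ]· (cardᵗ T * card (parentᶠ B)) ∎
        (no ¬copy) → trans
          (∑-zero (filter (λ σ → σ ⟨$⟩ʳ r Fin.≟ j) (automorphisms p)) λ {σ} σ∈ →
            let σ∈′ , σr≡j = ∈-filter⁻ (λ σ → σ ⟨$⟩ʳ r Fin.≟ j) {xs = automorphisms p} σ∈ in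
            ⊥-elim (¬copy (subst (IsCopy T ∘ componentOf G) σr≡j (image⇒copy σ (Enumeration.sound (isos-enum p p) σ∈′)))))
          (sym ([-]·-no (isCopy? T (componentOf G j)) _ ¬copy))

    -- Orbit-stabiliser for the root of T: the orbit consists of the roots of the copies of T.
    card-∷ : card p ≈ suc (multiplicity T B) ·ₙ (cardᵗ T * card (parentᶠ B))
    card-∷ = begin
      card p ≈⟨ card-by-image p r ⟩
      sum S ≈⟨ sum-cong-≋ S-value ⟩
      sum (λ j → [ isCopy? T (componentOf G j) ]· (cardᵗ T * card (parentᶠ B))) ≈⟨ sum-isCopy T G _ ⟩
      multiplicity T G ·ₙ (cardᵗ T * card (parentᶠ B)) ≡⟨ cong (_·ₙ (cardᵗ T * card (parentᶠ B))) (mult-yes T T B (≅ᵗ-refl T)) ⟩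
      suc (multiplicity T B) ·ₙ (cardᵗ T * card (parentᶠ B)) ∎

  excess : Tree → Carrier
  excess T = Zᵗ T - cardᵗ T

  Zᵗ≈cardᵗ+excess : ∀ T → Zᵗ T ≈ cardᵗ T + excess T
  Zᵗ≈cardᵗ+excess T = begin
    Zᵗ T                          ≈⟨ +-identityʳ _ ⟨
    Zᵗ T + 0#                     ≈⟨ +-congˡ (-‿inverseˡ (cardᵗ T)) ⟨
    Zᵗ T + (- cardᵗ T + cardᵗ T)  ≈⟨ +-assoc _ _ _ ⟨
    excess T + cardᵗ T                 ≈⟨ +-comm _ _ ⟩
    cardᵗ T + excess T                 ∎

  -- The automorphisms moving the root of `T` contribute equally to `Z-true` and `Z-false`. What
  -- remains of the difference comes from those fixing the root, where `T` contributes a factor of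
  -- its own: `Zᵗ T` or `cardᵗ T`.
  Z-∷ : ∀ T A B → Z (T ∷ A) B ≈ Z A (T ∷ B) + excess T * Z A B
  Z-∷ T A B = begin
    Z (T ∷ A) B ≈⟨ Z-true T A B ⟩
    Zᵗ T * z + m ≈⟨ +-congʳ (*-congʳ (Zᵗ≈cardᵗ+excess T)) ⟩
    (cardᵗ T + excess T) * z + m ≈⟨ solve 4 (λ a y z m → (a :+ y) :* z :+ m := (a :* z :+ m) :+ y :* z) (CommutativeRing.refl K) _ _ _ _ ⟩
    (cardᵗ T * z + m) + excess T * z ≈⟨ +-congʳ (Z-false T A B) ⟨
    Z A (T ∷ B) + excess T * Z A B ∎
    where
    z = Z A B
    m = movingRoot T (parentᶠ (A ++ B)) (mark A B)

  Z-swap : ∀ A T U B → Z A (U ∷ T ∷ B) ≈ Z A (T ∷ U ∷ B)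
  Z-swap A T U B = begin
    Z A (U ∷ T ∷ B) ≈⟨ W-conjugate _ _ _ _ (to-front U T) ⟩
    W (parentᵗ U ⊕ (parentᵗ T ⊕ parentᶠ (A ++ B))) (front U T)
      ≈⟨ W-conjugate (parentᵗ U ⊕ (parentᵗ T ⊕ parentᶠ (A ++ B))) _ (parentᵗ T ⊕ (parentᵗ U ⊕ parentᶠ (A ++ B))) _
           (coloured-exchange (parentᵗ U) (const false) (parentᵗ T) (const false) (parentᶠ (A ++ B)) (mark A B)) ⟩
    W (parentᵗ T ⊕ (parentᵗ U ⊕ parentᶠ (A ++ B))) (front T U) ≈⟨ W-conjugate _ _ _ _ (to-front T U) ⟨
    Z A (T ∷ U ∷ B) ∎
    where
    front : ∀ T U → Fin (∣ T ∣ᵗ ℕ.+ (∣ U ∣ᵗ ℕ.+ ∣ A ++ B ∣ᶠ)) → Bool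
    front T U = _⊹_ {m = ∣ T ∣ᵗ} (const false) (_⊹_ {m = ∣ U ∣ᵗ} (const false) (mark A B))
    to-front : ∀ T U → ColouredIso (parentᶠ (A ++ T ∷ U ∷ B)) (mark A (T ∷ U ∷ B)) (parentᵗ T ⊕ (parentᵗ U ⊕ parentᶠ (A ++ B))) (front T U)
    to-front T U = coloured-∘
      {p = parentᶠ (A ++ T ∷ U ∷ B)} {q = parentᵗ T ⊕ parentᶠ (A ++ U ∷ B)} {r = parentᵗ T ⊕ (parentᵗ U ⊕ parentᶠ (A ++ B))}
      (mark-shift A T (U ∷ B))
      (coloured-⊕ (parentᵗ T) (const false) {parentᶠ (A ++ U ∷ B)} {q′ = parentᵗ U ⊕ parentᶠ (A ++ B)} (mark-shift A U B))

  -- Without marked trees this is the formula for the order of the group. Expanding a marked `U` by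
  -- `Z-∷` preserves the shape on both sides, because `U` is no copy of `T` and so, once unmarked,
  -- leaves the multiplicity of `T` unchanged.
  Z-fresh : ∀ A T B → multiplicity T A ≡ 0 → Z A (T ∷ B) ≈ ι (suc (multiplicity T B)) * (cardᵗ T * Z A B)
  Z-fresh [] T B _ = begin
    Z [] (T ∷ B) ≈⟨ Z-[] (T ∷ B) ⟩
    card (parentᶠ (T ∷ B)) ≈⟨ card-∷ T B ⟩
    suc (multiplicity T B) ·ₙ (cardᵗ T * card (parentᶠ B)) ≈⟨ ·ₙ≈ι* (suc (multiplicity T B)) _ ⟩
    ι (suc (multiplicity T B)) * (cardᵗ T * card (parentᶠ B)) ≈⟨ *-congˡ (*-congˡ (Z-[] B)) ⟨
    ι (suc (multiplicity T B)) * (cardᵗ T * Z [] B) ∎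
  Z-fresh (U ∷ A) T B absent = case T ≅ᵗ? U of λ where
    (yes T≅U) → case ≡.trans (≡.sym absent) (mult-yes T U A T≅U) of λ ()
    (no T≇U) → let absent′ = ≡.trans (≡.sym (mult-no T U A T≇U)) absent
                   k = suc (multiplicity T B) in begin
      Z (U ∷ A) (T ∷ B) ≈⟨ Z-∷ U A (T ∷ B) ⟩
      Z A (U ∷ T ∷ B) + excess U * Z A (T ∷ B) ≈⟨ +-cong (Z-swap A T U B) (*-congˡ (Z-fresh A T B absent′)) ⟩
      Z A (T ∷ U ∷ B) + excess U * (ι k * (cardᵗ T * Z A B))
        ≈⟨ +-congʳ (trans (Z-fresh A T (U ∷ B) absent′) (*-congʳ (reflexive (cong (ι ∘ suc) (mult-no T U B T≇U))))) ⟩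
      ι k * (cardᵗ T * Z A (U ∷ B)) + excess U * (ι k * (cardᵗ T * Z A B))
        ≈⟨ solve 5 (λ k a z y z′ → k :* (a :* z) :+ y :* (k :* (a :* z′)) := k :* (a :* (z :+ y :* z′))) (CommutativeRing.refl K) _ _ _ _ _ ⟩
      ι k * (cardᵗ T * (Z A (U ∷ B) + excess U * Z A B)) ≈⟨ *-congˡ (*-congˡ (Z-∷ U A B)) ⟨
      ι k * (cardᵗ T * Z (U ∷ A) B) ∎

  Zᶠ : Forest → Carrier
  Zᶠ F = W (parentᶠ F) (const true)

  Z≈Zᶠ : ∀ F → Z F [] ≈ Zᶠ F
  Z≈Zᶠ F = W-conjugate (parentᶠ (F ++ [])) (mark F []) (parentᶠ F) (const true) (mark-[] F)

  module _ (T : Tree) (R : Forest) (T∉R : multiplicity T R ≡ 0) where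

    copies : ℕ → Forest
    copies k = replicate k T ++ R

    private
      a = cardᵗ T
      w : ℕ → ℕ → Carrier
      w j k = Z (copies k) (replicate j T)

      mult-copies : ∀ j → multiplicity T (replicate j T) ≡ j
      mult-copies j = ≡.trans (cong (multiplicity T) (≡.sym (List.++-identityʳ (replicate j T)))) (mult-replicate T j [] refl)

      -- Integration by parts for the functional t^j ↦ w j 0 (morally j! a^j w 0 0), with w j k the value at t^j (t + excess T)^k.
      w-suc : ∀ k j → w (suc j) k ≈ ι (suc j) * (a * w j k) + ι k * (a * w (suc j) (ℕ.pred k))
      w-suc zero j = begin
        w (suc j) 0 ≈⟨ Z-fresh R T (replicate j T) T∉R ⟩
        ι (suc (multiplicity T (replicate j T))) * (a * w j 0) ≡⟨ cong (λ m → ι (suc m) * (a * w j 0)) (mult-copies j) ⟩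
        ι (suc j) * (a * w j 0) ≈⟨ +-identityʳ _ ⟨
        ι (suc j) * (a * w j 0) + 0# ≈⟨ +-congˡ (zeroˡ _) ⟨
        ι (suc j) * (a * w j 0) + ι 0 * (a * w (suc j) 0) ∎
      w-suc (suc k) j = begin
        w (suc j) (suc k) ≈⟨ Z-∷ T (copies k) (replicate (suc j) T) ⟩
        w (suc (suc j)) k + excess T * w (suc j) k ≈⟨ +-cong (w-suc k (suc j)) (*-congˡ (w-suc k j)) ⟩
        (ι (suc (suc j)) * (a * w (suc j) k) + ι k * (a * w (suc (suc j)) (ℕ.pred k))) + excess T * (ι (suc j) * (a * w j k) + ι k * (a * w (suc j) (ℕ.pred k)))
          ≈⟨ solve 8 (λ J k a w₁ w₂ w₀ w₃ y → ((con 1 :+ J) :* (a :* w₁) :+ k :* (a :* w₂)) :+ y :* (J :* (a :* w₀) :+ k :* (a :* w₃))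
               := J :* (a :* (w₁ :+ y :* w₀)) :+ (a :* w₁ :+ a :* (k :* (w₂ :+ y :* w₃)))) (CommutativeRing.refl K)
               (ι (suc j)) (ι k) a (w (suc j) k) (w (suc (suc j)) (ℕ.pred k)) (w j k) (w (suc j) (ℕ.pred k)) (excess T) ⟩
        ι (suc j) * (a * (w (suc j) k + excess T * w j k)) + (a * w (suc j) k + a * (ι k * (w (suc (suc j)) (ℕ.pred k) + excess T * w (suc j) (ℕ.pred k))))
          ≈⟨ +-cong (*-congˡ (*-congˡ (Z-∷ T (copies k) (replicate j T)))) (+-congˡ (*-congˡ (lower k))) ⟨
        ι (suc j) * (a * w j (suc k)) + (a * w (suc j) k + a * (ι k * w (suc j) k))
          ≈⟨ +-congˡ (solve 3 (λ a w k → a :* w :+ a :* (k :* w) := (con 1 :+ k) :* (a :* w)) (CommutativeRing.refl K) a (w (suc j) k) (ι k)) ⟩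
        ι (suc j) * (a * w j (suc k)) + ι (suc k) * (a * w (suc j) k) ∎
        where
        lower : ∀ k → ι k * w (suc j) k ≈ ι k * (w (suc (suc j)) (ℕ.pred k) + excess T * w (suc j) (ℕ.pred k))
        lower zero    = trans (zeroˡ _) (sym (zeroˡ _))
        lower (suc k) = *-congˡ (Z-∷ T (copies k) (replicate (suc j) T))

      -- Integration by parts once more, now with the boundary term: t^0 (t + excess)^k has the
      -- value excess^k at t = 0.
      w-zero : ∀ k → w 0 k ≈ ι k * (a * w 0 (ℕ.pred k)) + excess T ^ k * w 0 0
      w-zero zero = begin
        w 0 0 ≈⟨ *-identityˡ _ ⟨
        1# * w 0 0 ≈⟨ +-identityˡ _ ⟨
        0# + 1# * w 0 0 ≈⟨ +-congʳ (zeroˡ _) ⟨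
        ι 0 * (a * w 0 0) + 1# * w 0 0 ∎
      w-zero (suc k) = begin
        w 0 (suc k) ≈⟨ Z-∷ T (copies k) [] ⟩
        w 1 k + excess T * w 0 k ≈⟨ +-cong (w-suc k 0) (*-congˡ (w-zero k)) ⟩
        (ι 1 * (a * w 0 k) + ι k * (a * w 1 (ℕ.pred k))) + excess T * (ι k * (a * w 0 (ℕ.pred k)) + excess T ^ k * w 0 0)
          ≈⟨ solve 8 (λ a w₀ k w₁ w₂ y p c → ((con 1 :+ con 0) :* (a :* w₀) :+ k :* (a :* w₁)) :+ y :* (k :* (a :* w₂) :+ p :* c)
               := a :* w₀ :+ a :* (k :* (w₁ :+ y :* w₂)) :+ (y :* p) :* c) (CommutativeRing.refl K)
               a (w 0 k) (ι k) (w 1 (ℕ.pred k)) (w 0 (ℕ.pred k)) (excess T) (excess T ^ k) (w 0 0) ⟩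
        a * w 0 k + a * (ι k * (w 1 (ℕ.pred k) + excess T * w 0 (ℕ.pred k))) + excess T ^ suc k * w 0 0
          ≈⟨ +-congʳ (+-congˡ (*-congˡ (lower k))) ⟨
        a * w 0 k + a * (ι k * w 0 k) + excess T ^ suc k * w 0 0
          ≈⟨ +-congʳ (solve 3 (λ a w k → a :* w :+ a :* (k :* w) := (con 1 :+ k) :* (a :* w)) (CommutativeRing.refl K) a (w 0 k) (ι k)) ⟩
        ι (suc k) * (a * w 0 k) + excess T ^ suc k * w 0 0 ∎
        where
        -- The factor `ι k` makes both sides vanish for `k` = 0, so the default value of `pred` at 0
        -- does no harm.
        lower : ∀ k → ι k * w 0 k ≈ ι k * (w 1 (ℕ.pred k) + excess T * w 0 (ℕ.pred k))
        lower zero    = trans (zeroˡ _) (sym (zeroˡ _))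
        lower (suc k) = *-congˡ (Z-∷ T (copies k) [])

    Zᶠ-copies : ∀ k → Zᶠ (copies (suc k)) ≈ ι (suc k) * (cardᵗ T * Zᶠ (copies k)) + excess T ^ suc k * Zᶠ R
    Zᶠ-copies k = begin
      Zᶠ (copies (suc k)) ≈⟨ Z≈Zᶠ (copies (suc k)) ⟨
      w 0 (suc k) ≈⟨ w-zero (suc k) ⟩
      ι (suc k) * (a * w 0 k) + excess T ^ suc k * w 0 0 ≈⟨ +-cong (*-congˡ (*-congˡ (Z≈Zᶠ (copies k)))) (*-congˡ (Z≈Zᶠ R)) ⟩
      ι (suc k) * (a * Zᶠ (copies k)) + excess T ^ suc k * Zᶠ R ∎

    card-copies : ∀ k → card (parentᶠ (copies (suc k))) ≈ ι (suc k) * (cardᵗ T * card (parentᶠ (copies k)))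
    card-copies k = begin
      card (parentᶠ (copies (suc k))) ≈⟨ card-∷ T (copies k) ⟩
      suc (multiplicity T (copies k)) ·ₙ (cardᵗ T * card (parentᶠ (copies k))) ≡⟨ cong (λ m → suc m ·ₙ (cardᵗ T * card (parentᶠ (copies k)))) (mult-replicate T k R T∉R) ⟩
      suc k ·ₙ (cardᵗ T * card (parentᶠ (copies k))) ≈⟨ ·ₙ≈ι* (suc k) _ ⟩
      ι (suc k) * (cardᵗ T * card (parentᶠ (copies k))) ∎

-- Means over automorphism groups and their recursion in the number of copies

module Normalised (K : CommutativeRing 0ℓ 0ℓ) (u : CommutativeRing.Carrier K) (recip : ℕ → CommutativeRing.Carrier K)
  (recip-inverse : ∀ n → CommutativeRing._≈_ K (CommutativeRing._*_ K (Counting.ι K u (suc n)) (recip (suc n))) (CommutativeRing.1# K)) where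

  open CommutativeRing K hiding (refl; zero)
  open Counting K u public

  open import Algebra.Solver.Ring.NaturalCoefficients.Default commutativeSemiring using (solve; _:=_; _:+_; _:*_; con)
  open import Relation.Binary.Reasoning.Setoid setoid

  recip-Aut : ∀ {n} → Parents n → Carrier
  recip-Aut p = recip ∣Aut p ∣

  card-recip : ∀ {n} (p : Parents n) → card p * recip-Aut p ≈ 1#
  card-recip p = go ∣Aut p ∣ {{∣Aut∣≢0 p}} (∑-const (automorphisms p) 1#)
    where
    go : ∀ n .{{_ : ℕ.NonZero n}} → card p ≈ ι n → card p * recip n ≈ 1#
    go (suc n) eq = trans (*-congʳ eq) (recip-inverse n)

  inverse-unique : ∀ {a b r s} → a ≈ b → a * r ≈ 1# → b * s ≈ 1# → r ≈ s
  inverse-unique {a} {b} {r} {s} a≈b ar bs = begin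
    r            ≈⟨ *-identityʳ r ⟨
    r * 1#       ≈⟨ *-congˡ bs ⟨
    r * (b * s)  ≈⟨ *-assoc r b s ⟨
    r * b * s    ≈⟨ *-congʳ (trans (*-comm r b) (trans (*-congʳ (sym a≈b)) ar)) ⟩
    1# * s       ≈⟨ *-identityˡ s ⟩
    s            ∎

  P : Forest → Carrier
  P F = recip-Aut (parentᶠ F) * Zᶠ F

  Pᵗ : Tree → Carrier
  Pᵗ T = recip-Aut (parentᵗ T) * Zᵗ T

  P-cong : ∀ F G → F ≅ᶠ G → P F ≈ P G
  P-cong F G (mk≅ᶠ e) = *-cong
    (inverse-unique (card-cong (parentᶠ F) (parentᶠ G) e) (card-recip (parentᶠ F)) (card-recip (parentᶠ G)))
    (W-cong {p = parentᶠ F} {parentᶠ G} e)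

  Pᵗ-cong : ∀ T U → T ≅ᵗ U → Pᵗ T ≈ Pᵗ U
  Pᵗ-cong T U e = *-cong
    (inverse-unique (card-cong (parentᵗ T) (parentᵗ U) e) (card-recip (parentᵗ T)) (card-recip (parentᵗ U)))
    (W-cong {p = parentᵗ T} {parentᵗ U} e)

  ∑-node : ∀ F (f : Permutation′ (suc ∣ F ∣ᶠ) → Carrier) (g : Permutation′ ∣ F ∣ᶠ → Carrier) → (∀ σ τ → Perm.lift₀ τ ≗ᴾ σ → f σ ≈ g τ) →
    ∑ (automorphisms (parentᵗ (node F))) f ≈ ∑ (automorphisms (parentᶠ F)) g
  ∑-node F f g f≈g = ∑-bijection (isos-enum (parentᵗ (node F)) (parentᵗ (node F))) (isos-enum (parentᶠ F) (parentᶠ F))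
    (λ {x} {y} → ≗ᴾ-sym {π = x} {y}) (λ {x} {y} → ≗ᴾ-sym {π = x} {y})
    (λ σ τ → Perm.lift₀ τ ≗ᴾ σ)
    (λ e r i → ≡.trans (r i) (e i))
    (λ {σ} {τ} {τ′} e r i → ≡.trans (≡.sym (Perm.lift₀-cong τ τ′ e i)) (r i))
    (λ {σ} iso → node-iso⁻ F F σ iso)
    (λ {τ} iso → Perm.lift₀ τ , node-iso F F τ iso , λ _ → refl)
    (λ _ r r′ i → Fin.suc-injective (≡.trans (r (suc i)) (≡.sym (r′ (suc i)))))
    (λ _ r r′ i → ≡.trans (≡.sym (r i)) (r′ i))
    f g (λ {σ} {τ} _ _ r → f≈g σ τ r)

  card-node : ∀ F → cardᵗ (node F) ≈ card (parentᶠ F)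
  card-node F = ∑-node F (const 1#) (const 1#) (λ _ _ _ → CommutativeRing.refl K)

  Z-node : ∀ F → Zᵗ (node F) ≈ u * Zᶠ F
  Z-node F = trans
    (∑-node F (weight (const true)) (λ τ → u * weight (const true) τ) (λ σ τ r →
      reflexive (cong (u ^_) (fixedIn-resp (const true) {σ} {Perm.lift₀ τ} (≡.sym ∘ r)))))
    (sym (∑-*ˡ (automorphisms (parentᶠ F)) u (weight (const true))))

  P-node : ∀ F → Pᵗ (node F) ≈ u * P F
  P-node F = begin
    recip-Aut (parentᵗ (node F)) * Zᵗ (node F)
      ≈⟨ *-cong (inverse-unique (card-node F) (card-recip (parentᵗ (node F))) (card-recip (parentᶠ F))) (Z-node F) ⟩
    recip-Aut (parentᶠ F) * (u * Zᶠ F) ≈⟨ solve 3 (λ r u z → r :* (u :* z) := u :* (r :* z)) (CommutativeRing.refl K) _ _ _ ⟩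
    u * P F ∎

  module _ (T : Tree) (R : Forest) (T∉R : multiplicity T R ≡ 0) where

    private
      Fₖ = copies T R T∉R
      a = cardᵗ T
      α = recip-Aut (parentᵗ T)
      r : ℕ → Carrier
      r k = recip-Aut (parentᶠ (Fₖ k))
      -- By `δ-suc` this is x^k/k! times `P R`, and by `P-suc` the means for k copies are the
      -- partial sums of the δ's. In generating functions, that is the factor exp(x z)/(1 - z).
      δ : ℕ → Carrier
      δ k = r k * (excess T ^ k * Zᶠ R)
      x = α * excess T

      r-suc : ∀ k → ι (suc k) * (a * r (suc k)) ≈ r k
      r-suc k = inverse-unique (CommutativeRing.refl K) (begin
        A * (ι (suc k) * (a * r (suc k))) ≈⟨ solve 4 (λ A i a r → A :* (i :* (a :* r)) := i :* (a :* A) :* r) (CommutativeRing.refl K) A (ι (suc k)) a (r (suc k)) ⟩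
        ι (suc k) * (a * A) * r (suc k)   ≈⟨ *-congʳ (card-copies T R T∉R k) ⟨
        card (parentᶠ (Fₖ (suc k))) * r (suc k) ≈⟨ card-recip (parentᶠ (Fₖ (suc k))) ⟩
        1# ∎) (card-recip (parentᶠ (Fₖ k)))
        where A = card (parentᶠ (Fₖ k))

      P-suc : ∀ k → P (Fₖ (suc k)) ≈ P (Fₖ k) + δ (suc k)
      P-suc k = begin
        r (suc k) * Zᶠ (Fₖ (suc k)) ≈⟨ *-congˡ (Zᶠ-copies T R T∉R k) ⟩
        r (suc k) * (ι (suc k) * (a * Zᶠ (Fₖ k)) + excess T ^ suc k * Zᶠ R)
          ≈⟨ solve 5 (λ r i a z t → r :* (i :* (a :* z) :+ t) := i :* (a :* r) :* z :+ r :* t) (CommutativeRing.refl K) _ _ _ _ _ ⟩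
        ι (suc k) * (a * r (suc k)) * Zᶠ (Fₖ k) + δ (suc k) ≈⟨ +-congʳ (*-congʳ (r-suc k)) ⟩
        P (Fₖ k) + δ (suc k) ∎

      δ-suc : ∀ k → ι (suc k) * δ (suc k) ≈ x * δ k
      δ-suc k = begin
        ι (suc k) * (r (suc k) * (excess T * excess T ^ k * Zᶠ R)) ≈⟨ *-identityˡ _ ⟨
        1# * (ι (suc k) * (r (suc k) * (excess T * excess T ^ k * Zᶠ R))) ≈⟨ *-congʳ (card-recip (parentᵗ T)) ⟨
        a * α * (ι (suc k) * (r (suc k) * (excess T * excess T ^ k * Zᶠ R)))
          ≈⟨ solve 7 (λ a α i r y p c → a :* α :* (i :* (r :* (y :* p :* c))) := α :* y :* (i :* (a :* r) :* (p :* c))) (CommutativeRing.refl K)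
               a α (ι (suc k)) (r (suc k)) (excess T) (excess T ^ k) (Zᶠ R) ⟩
        x * (ι (suc k) * (a * r (suc k)) * (excess T ^ k * Zᶠ R)) ≈⟨ *-congˡ (*-congʳ (r-suc k)) ⟩
        x * δ k ∎

      Pᵗ≈1+x : Pᵗ T ≈ 1# + x
      Pᵗ≈1+x = begin
        α * Zᵗ T         ≈⟨ *-congˡ (Zᵗ≈cardᵗ+excess T) ⟩
        α * (a + excess T)    ≈⟨ distribˡ α a (excess T) ⟩
        α * a + x        ≈⟨ +-congʳ (trans (*-comm α a) (card-recip (parentᵗ T))) ⟩
        1# + x           ∎

      lower : ℕ → Carrier
      lower k = sum {k} (λ i → P (Fₖ (k ℕ.∸ suc (toℕ i))))

    -- The coefficients of z F′(z) = (P_T z + z²/(1-z)) F(z), which characterise F(z) = exp (P_T z + z²/2 + z³/3 + ⋯).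
    P-copies : ∀ k → ι (suc k) * P (Fₖ (suc k)) ≈ Pᵗ T * P (Fₖ k) + lower k
    P-copies zero = begin
      ι 1 * P (Fₖ 1) ≈⟨ *-congˡ (P-suc 0) ⟩
      ι 1 * (P R + δ 1) ≈⟨ solve 2 (λ p d → (con 1 :+ con 0) :* (p :+ d) := p :+ (con 1 :+ con 0) :* d) (CommutativeRing.refl K) _ _ ⟩
      P R + ι 1 * δ 1 ≈⟨ +-congˡ (δ-suc 0) ⟩
      P R + x * (r 0 * (1# * Zᶠ R)) ≈⟨ solve 4 (λ p x r z → p :+ x :* (r :* (con 1 :* z)) := p :+ x :* (r :* z)) (CommutativeRing.refl K) (P R) x (r 0) (Zᶠ R) ⟩
      P R + x * P R ≈⟨ solve 2 (λ p x → p :+ x :* p := (con 1 :+ x) :* p :+ con 0) (CommutativeRing.refl K) (P R) x ⟩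
      (1# + x) * P R + 0# ≈⟨ +-congʳ (*-congʳ Pᵗ≈1+x) ⟨
      Pᵗ T * P R + 0# ∎
    P-copies (suc k) = begin
      ι (suc (suc k)) * P (Fₖ (suc (suc k))) ≈⟨ *-congˡ (P-suc (suc k)) ⟩
      ι (suc (suc k)) * (P₁ + δ (suc (suc k))) ≈⟨ solve 3 (λ i p d → (con 1 :+ i) :* (p :+ d) := p :+ i :* p :+ (con 1 :+ i) :* d) (CommutativeRing.refl K) _ _ _ ⟩
      P₁ + ι (suc k) * P₁ + ι (suc (suc k)) * δ (suc (suc k)) ≈⟨ +-cong (+-congˡ (P-copies k)) (δ-suc (suc k)) ⟩
      P₁ + (Pᵗ T * P (Fₖ k) + lower k) + x * δ (suc k) ≈⟨ +-congʳ (+-congˡ (+-congʳ (*-congʳ Pᵗ≈1+x))) ⟩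
      P₁ + ((1# + x) * P (Fₖ k) + lower k) + x * δ (suc k)
        ≈⟨ solve 5 (λ p x q l d → p :+ ((con 1 :+ x) :* q :+ l) :+ x :* d := p :+ x :* (q :+ d) :+ (q :+ l)) (CommutativeRing.refl K) _ _ _ _ _ ⟩
      P₁ + x * (P (Fₖ k) + δ (suc k)) + (P (Fₖ k) + lower k) ≈⟨ +-congʳ (+-congˡ (*-congˡ (P-suc k))) ⟨
      P₁ + x * P₁ + (P (Fₖ k) + lower k) ≈⟨ +-congʳ (solve 2 (λ p x → p :+ x :* p := (con 1 :+ x) :* p) (CommutativeRing.refl K) P₁ x) ⟩
      (1# + x) * P₁ + (P (Fₖ k) + lower k) ≈⟨ +-congʳ (*-congʳ Pᵗ≈1+x) ⟨
      Pᵗ T * P₁ + lower (suc k) ∎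
      where P₁ = P (Fₖ (suc k))

-- Pointed trees and Burnside's lemma

≅•-refl : ∀ {P} → P ≅• P
≅•-refl {T , v} = Perm.id , IsIso-id (parentᵗ T) , refl

≅•-sym : ∀ {P Q} → P ≅• Q → Q ≅• P
≅•-sym {T , v} {U , w} (π , iso , eq) = Perm.flip π , IsIso-flip (parentᵗ T) (parentᵗ U) π iso ,
  ≡.trans (cong (π ⟨$⟩ˡ_) (≡.sym eq)) (Perm.inverseˡ π)

≅•-trans : ∀ {P Q R} → P ≅• Q → Q ≅• R → P ≅• R
≅•-trans {T , _} {U , _} {V , _} (π , iso , eq) (ρ , iso′ , eq′) =
  π ∘ₚ ρ , IsIso-∘ (parentᵗ T) (parentᵗ U) (parentᵗ V) π ρ iso iso′ , ≡.trans (cong (ρ ⟨$⟩ʳ_) eq) eq′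

module Burnside (K : CommutativeRing 0ℓ 0ℓ) where

  open CommutativeRing K hiding (refl; zero)
  open Counting K 1#
  open import Relation.Binary.Reasoning.Setoid setoid

  ι-sum : ∀ {n} (f : Fin n → ℕ) → ι (ℕΣ.sum f) ≈ sum (ι ∘ f)
  ι-sum {zero}  f = CommutativeRing.refl K
  ι-sum {suc n} f = trans (×-homo-+ 1# (f zero) (ℕΣ.sum (f ∘ suc))) (+-congˡ (ι-sum (f ∘ suc)))

  -- Pairs (σ, v) with σ v = v are counted by v, which gives the stabilisers `S v v`, and then
  -- grouped by orbits, which `pointings T` represents. In the orbit of `w`, the number `S v v`
  -- equals `S w v`, outside it `S w v` is 0, and the sum of `S w v` over all v is |Aut T|.
  burnside : ∀ T → ∑ (automorphisms (parentᵗ T)) (λ σ → ι (fixedIn (const true) σ)) ≈ length (pointings T) ·ₙ cardᵗ T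
  burnside T = begin
    ∑ auts (λ σ → ι (fixedIn (const true) σ)) ≈⟨ ∑-cong auts (λ {σ} _ → trans (ι-sum (isFixed (const true) σ)) (sum-cong-≋ λ v → indicator (σ ⟨$⟩ʳ v Fin.≟ v))) ⟩
    ∑ auts (λ σ → sum (λ v → [ σ ⟨$⟩ʳ v Fin.≟ v ]· 1#)) ≈⟨ ∑-sum auts (λ σ v → [ σ ⟨$⟩ʳ v Fin.≟ v ]· 1#) ⟩
    sum (λ v → ∑ auts (λ σ → [ σ ⟨$⟩ʳ v Fin.≟ v ]· 1#)) ≈⟨ sum-cong-≋ (λ v → sym (∑-filter (λ σ → σ ⟨$⟩ʳ v Fin.≟ v) auts (const 1#))) ⟩
    sum (λ v → S v v) ≈⟨ ∑-tabulate id (λ v → S v v) ⟨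
    ∑ (allFin ∣ T ∣ᵗ) (λ v → S v v)
      ≈⟨ ∑-fibres (allFin ∣ T ∣ᵗ) (pointings T) (λ v O → O ≅• (T , v)) (λ v O → O ≅•? (T , v)) (λ v → S v v)
           (λ {v} _ → ∑-enum-one _≅•?_ ≅•-sym ≅•-trans points (∈-map⁺ (T ,_) (∈-allFin v))) ⟩
    ∑ (pointings T) (λ O → ∑ (filter (λ v → O ≅•? (T , v)) (allFin ∣ T ∣ᵗ)) (λ v → S v v))
      ≈⟨ ∑-cong (pointings T) (λ O∈ → let w , _ , eq = ∈-map⁻ (T ,_) (Enumeration.sound points O∈) in
           trans (reflexive (cong (λ O → ∑ (filter (λ v → O ≅•? (T , v)) (allFin ∣ T ∣ᵗ)) (λ v → S v v)) eq)) (orbit w)) ⟩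
    ∑ (pointings T) (const (cardᵗ T)) ≈⟨ ∑-const (pointings T) (cardᵗ T) ⟩
    length (pointings T) ·ₙ cardᵗ T ∎
    where
    p = parentᵗ T
    auts = automorphisms p
    S : Fin ∣ T ∣ᵗ → Fin ∣ T ∣ᵗ → Carrier
    S v w = ∑ (filter (λ σ → σ ⟨$⟩ʳ v Fin.≟ w) auts) (const 1#)
    points = enum-deduplicate _≅•?_ ≅•-sym ≅•-trans ≅•-refl (List.map (T ,_) (allFin ∣ T ∣ᵗ))
    indicator : ∀ {Q : Set} (d : Dec Q) → ι (if does d then 1 else 0) ≈ [ d ]· 1#
    indicator (yes _) = +-identityʳ 1#
    indicator (no _)  = CommutativeRing.refl K
    orbit : ∀ w → ∑ (filter (λ v → (T , w) ≅•? (T , v)) (allFin ∣ T ∣ᵗ)) (λ v → S v v) ≈ cardᵗ T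
    orbit w = begin
      ∑ (filter (λ v → (T , w) ≅•? (T , v)) (allFin ∣ T ∣ᵗ)) (λ v → S v v) ≈⟨ ∑-filter (λ v → (T , w) ≅•? (T , v)) (allFin ∣ T ∣ᵗ) (λ v → S v v) ⟩
      ∑ (allFin ∣ T ∣ᵗ) (λ v → [ (T , w) ≅•? (T , v) ]· (S v v)) ≈⟨ ∑-cong (allFin ∣ T ∣ᵗ) (λ {v} _ → each v) ⟩
      ∑ (allFin ∣ T ∣ᵗ) (S w) ≈⟨ ∑-tabulate id (S w) ⟩
      sum (S w) ≈⟨ card-by-image p w ⟨
      cardᵗ T ∎
      where
      each : ∀ v → [ (T , w) ≅•? (T , v) ]· (S v v) ≈ S w v
      each v = case (T , w) ≅•? (T , v) of λ where
        (yes w≅v) → let ρ , ρ-iso , ρw≡v = w≅v in begin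
          [ (T , w) ≅•? (T , v) ]· (S v v) ≈⟨ [-]·-yes ((T , w) ≅•? (T , v)) _ w≅v ⟩
          S v v                            ≡⟨ cong (λ x → S x v) ρw≡v ⟨
          S (ρ ⟨$⟩ʳ w) v                   ≈⟨ translate p ρ Perm.id ρ-iso (IsIso-id p) w v ⟩
          S w v                            ∎
        (no w≇v) → trans ([-]·-no ((T , w) ≅•? (T , v)) _ w≇v)
          (sym (∑-zero (filter (λ σ → σ ⟨$⟩ʳ w Fin.≟ v) auts) λ {σ} σ∈ →
            let σ∈′ , σw≡v = ∈-filter⁻ (λ σ → σ ⟨$⟩ʳ w Fin.≟ v) {xs = auts} σ∈ in
            ⊥-elim (w≇v (σ , Enumeration.sound (isos-enum p p) σ∈′ , σw≡v))))

-- Formal power series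

module SeriesTheory (K : CommutativeRing 0ℓ 0ℓ) (η : ℚ → CommutativeRing.Carrier K) where

  open CommutativeRing K hiding (refl; zero)
  open Sums K
  open PowerSeries (Semiring.rawSemiring (CommutativeRing.semiring K)) η using (Series; monomial; _*ˢ_; _≈ˢ_; exp; series)
  open import Algebra.Definitions.RawSemiring series using () renaming (_^_ to _^ˢ_)
  open import Algebra.Solver.Ring.NaturalCoefficients.Default commutativeSemiring using (solve; _:=_; _:+_; _:*_; con)
  open import Relation.Binary.Reasoning.Setoid setoid

  refl≈ : ∀ {x} → x ≈ x
  refl≈ = CommutativeRing.refl K

  tail : Series → Series
  tail A = A ∘ suc

  infixl 6 _+ˢ_
  _+ˢ_ : Series → Series → Series
  (A +ˢ B) n = A n + B n

  infixr 7 _•_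
  _•_ : Carrier → Series → Series
  (c • A) n = c * A n

  -- The operator z d/dz. Unlike d/dz it preserves degrees, so no index shifts occur in the product
  -- rule and in the differential equations.
  θ : Series → Series
  θ A n = ι n * A n

  one : Series
  one = monomial 1# 0

  infix 4 _≈[_]_
  _≈[_]_ : Series → ℕ → Series → Set
  A ≈[ n ] B = ∀ k → k ℕ.≤ n → A k ≈ B k

  *ˢ-cong-≤ : ∀ {A A′ B B′} n → A ≈[ n ] A′ → B ≈[ n ] B′ → A *ˢ B ≈[ n ] A′ *ˢ B′
  *ˢ-cong-≤ {A} {A′} {B} {B′} n A≈ B≈ k k≤n = Σ<-cong (suc k) (λ j → A j * B (k ℕ.∸ j)) (λ j → A′ j * B′ (k ℕ.∸ j)) λ j j<sk →
    *-cong (A≈ j (ℕ.≤-trans (ℕ.s≤s⁻¹ j<sk) k≤n)) (B≈ (k ℕ.∸ j) (ℕ.≤-trans (ℕ.m∸n≤m k j) k≤n))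

  *ˢ-cong : ∀ {A A′ B B′} → A ≈ˢ A′ → B ≈ˢ B′ → A *ˢ B ≈ˢ A′ *ˢ B′
  *ˢ-cong {A} {A′} {B} {B′} A≈ B≈ n = *ˢ-cong-≤ {A} {A′} {B} {B′} n (λ k _ → A≈ k) (λ k _ → B≈ k) n ℕ.≤-refl

  *ˢ-distribʳ : ∀ A B C → (A +ˢ B) *ˢ C ≈ˢ (A *ˢ C) +ˢ (B *ˢ C)
  *ˢ-distribʳ A B C n = trans (Σ<-cong (suc n) (λ k → (A +ˢ B) k * C (n ℕ.∸ k)) (λ k → A k * C (n ℕ.∸ k) + B k * C (n ℕ.∸ k)) λ k _ → distribʳ _ _ _)
    (Σ<-+ (suc n) (λ k → A k * C (n ℕ.∸ k)) (λ k → B k * C (n ℕ.∸ k)))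

  •-*ˢ : ∀ c A B → (c • A) *ˢ B ≈ˢ c • (A *ˢ B)
  •-*ˢ c A B n = trans (Σ<-cong (suc n) (λ k → c * A k * B (n ℕ.∸ k)) (λ k → c * (A k * B (n ℕ.∸ k))) λ k _ → *-assoc _ _ _) (sym (Σ<-*ˡ (suc n) c (λ k → A k * B (n ℕ.∸ k))))

  *ˢ-zero : ∀ A B → (A *ˢ B) 0 ≈ A 0 * B 0
  *ˢ-zero A B = +-identityʳ _

  *ˢ-assoc : ∀ A B C → (A *ˢ B) *ˢ C ≈ˢ A *ˢ (B *ˢ C)
  *ˢ-assoc A B C zero = begin
    ((A *ˢ B) *ˢ C) 0     ≈⟨ *ˢ-zero (A *ˢ B) C ⟩
    (A *ˢ B) 0 * C 0      ≈⟨ *-congʳ (*ˢ-zero A B) ⟩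
    A 0 * B 0 * C 0       ≈⟨ *-assoc _ _ _ ⟩
    A 0 * (B 0 * C 0)     ≈⟨ *-congˡ (*ˢ-zero B C) ⟨
    A 0 * (B *ˢ C) 0      ≈⟨ *ˢ-zero A (B *ˢ C) ⟨
    (A *ˢ (B *ˢ C)) 0     ∎
  *ˢ-assoc A B C (suc n) = begin
    -- The Cauchy product unfolds in this way: the tail of `A *ˢ B` is `A 0 • tail B` plus
    -- `tail A *ˢ B`.
    (A *ˢ B) 0 * C (suc n) + (tail (A *ˢ B) *ˢ C) n ≈⟨ +-cong (*-congʳ (*ˢ-zero A B)) (*ˢ-distribʳ (A 0 • tail B) (tail A *ˢ B) C n) ⟩
    A 0 * B 0 * C (suc n) + (((A 0 • tail B) *ˢ C) n + ((tail A *ˢ B) *ˢ C) n)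
      ≈⟨ +-congˡ (+-cong (•-*ˢ (A 0) (tail B) C n) (*ˢ-assoc (tail A) B C n)) ⟩
    A 0 * B 0 * C (suc n) + (A 0 * (tail B *ˢ C) n + (tail A *ˢ (B *ˢ C)) n)
      ≈⟨ solve 5 (λ a b c d e → a :* b :* c :+ (a :* d :+ e) := a :* (b :* c :+ d) :+ e) refl≈ _ _ _ _ _ ⟩
    A 0 * (B *ˢ C) (suc n) + (tail A *ˢ (B *ˢ C)) n ∎

  -- The definition splits off the first term of the sum, this lemma the last one; commutativity
  -- compares the two.
  *ˢ-suc′ : ∀ A B n → (A *ˢ B) (suc n) ≈ (A *ˢ tail B) n + A (suc n) * B 0
  *ˢ-suc′ A B zero = begin
    A 0 * B 1 + (A 1 * B 0 + 0#)  ≈⟨ solve 2 (λ x y → x :+ (y :+ con 0) := (x :+ con 0) :+ y) refl≈ _ _ ⟩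
    (A 0 * B 1 + 0#) + A 1 * B 0  ∎
  *ˢ-suc′ A B (suc n) = trans (+-congˡ (*ˢ-suc′ (tail A) B n)) (sym (+-assoc _ _ _))

  *ˢ-comm : ∀ A B → A *ˢ B ≈ˢ B *ˢ A
  *ˢ-comm A B zero    = trans (*ˢ-zero A B) (trans (*-comm _ _) (sym (*ˢ-zero B A)))
  *ˢ-comm A B (suc n) = begin
    A 0 * B (suc n) + (tail A *ˢ B) n ≈⟨ +-cong (*-comm _ _) (*ˢ-comm (tail A) B n) ⟩
    B (suc n) * A 0 + (B *ˢ tail A) n ≈⟨ +-comm _ _ ⟩
    (B *ˢ tail A) n + B (suc n) * A 0 ≈⟨ *ˢ-suc′ B A n ⟨
    (B *ˢ A) (suc n) ∎

  monomial₀-* : ∀ c A → monomial c 0 *ˢ A ≈ˢ c • A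
  monomial₀-* c A zero    = *ˢ-zero (monomial c 0) A
  monomial₀-* c A (suc n) = trans (+-congˡ (Σ<-zero (suc n) (λ k → 0# * A (n ℕ.∸ k)) λ _ _ → zeroˡ _)) (+-identityʳ _)

  monomial₁-*-zero : ∀ c A → (monomial c 1 *ˢ A) 0 ≈ 0#
  monomial₁-*-zero c A = trans (*ˢ-zero (monomial c 1) A) (zeroˡ _)

  monomial₁-*-suc : ∀ c A n → (monomial c 1 *ˢ A) (suc n) ≈ c * A n
  monomial₁-*-suc c A n = begin
    0# * A (suc n) + (tail (monomial c 1) *ˢ A) n ≈⟨ +-cong (zeroˡ _) (*ˢ-cong {tail (monomial c 1)} {monomial c 0} {A} shifted (λ _ → refl≈) n) ⟩
    0# + (monomial c 0 *ˢ A) n                    ≈⟨ +-identityˡ _ ⟩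
    (monomial c 0 *ˢ A) n                         ≈⟨ monomial₀-* c A n ⟩
    c * A n                                       ∎
    where
    shifted : tail (monomial c 1) ≈ˢ monomial c 0
    shifted zero    = refl≈
    shifted (suc n) = refl≈

  θ-*ˢ : ∀ A B → θ (A *ˢ B) ≈ˢ (θ A *ˢ B) +ˢ (A *ˢ θ B)
  θ-*ˢ A B n = begin
    ι n * Σ< (suc n) (λ k → A k * B (n ℕ.∸ k)) ≈⟨ Σ<-*ˡ (suc n) (ι n) (λ k → A k * B (n ℕ.∸ k)) ⟩
    Σ< (suc n) (λ k → ι n * (A k * B (n ℕ.∸ k))) ≈⟨ Σ<-cong (suc n) (λ k → ι n * (A k * B (n ℕ.∸ k))) (λ k → θ A k * B (n ℕ.∸ k) + A k * θ B (n ℕ.∸ k)) (λ k k<sn → begin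
      ι n * (A k * B (n ℕ.∸ k)) ≡⟨ cong (λ m → ι m * (A k * B (n ℕ.∸ k))) (ℕ.m+[n∸m]≡n (ℕ.s≤s⁻¹ k<sn)) ⟨
      ι (k ℕ.+ (n ℕ.∸ k)) * (A k * B (n ℕ.∸ k)) ≈⟨ *-congʳ (×-homo-+ 1# k (n ℕ.∸ k)) ⟩
      (ι k + ι (n ℕ.∸ k)) * (A k * B (n ℕ.∸ k)) ≈⟨ solve 4 (λ i j a b → (i :+ j) :* (a :* b) := i :* a :* b :+ a :* (j :* b)) refl≈ _ _ _ _ ⟩
      θ A k * B (n ℕ.∸ k) + A k * θ B (n ℕ.∸ k) ∎) ⟩
    Σ< (suc n) (λ k → θ A k * B (n ℕ.∸ k) + A k * θ B (n ℕ.∸ k))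
      ≈⟨ Σ<-+ (suc n) (λ k → θ A k * B (n ℕ.∸ k)) (λ k → A k * θ B (n ℕ.∸ k)) ⟩
    (θ A *ˢ B) n + (A *ˢ θ B) n ∎

  ^ˢ-vanish : ∀ A → A 0 ≈ 0# → ∀ k n → n ℕ.< k → (A ^ˢ k) n ≈ 0#
  ^ˢ-vanish A A₀ (suc k) n n<sk = Σ<-zero (suc n) (λ j → A j * (A ^ˢ k) (n ℕ.∸ j)) go
    where
    go : ∀ j → j ℕ.< suc n → A j * (A ^ˢ k) (n ℕ.∸ j) ≈ 0#
    go zero    _      = trans (*-congʳ A₀) (zeroˡ _)
    go (suc j) (s≤s j<n) = trans (*-congˡ (^ˢ-vanish A A₀ k (n ℕ.∸ suc j) (ℕ.<-≤-trans (ℕ.∸-monoʳ-< {o = 0} (s≤s z≤n) j<n) (ℕ.s≤s⁻¹ n<sk)))) (zeroʳ _)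

  θ-one : ∀ n → θ one n ≈ 0#
  θ-one zero    = zeroˡ _
  θ-one (suc n) = zeroʳ _

  θ-^ˢ : ∀ A k → θ (A ^ˢ suc k) ≈ˢ ι (suc k) • (A ^ˢ k *ˢ θ A)
  θ-^ˢ A zero n = begin
    θ (A *ˢ one) n                   ≈⟨ θ-*ˢ A one n ⟩
    (θ A *ˢ one) n + (A *ˢ θ one) n  ≈⟨ +-cong (*ˢ-comm (θ A) one n) (Σ<-zero (suc n) (λ k → A k * θ one (n ℕ.∸ k)) λ k _ → trans (*-congˡ (θ-one (n ℕ.∸ k))) (zeroʳ _)) ⟩
    (one *ˢ θ A) n + 0#              ≈⟨ solve 1 (λ x → x :+ con 0 := (con 1 :+ con 0) :* x) refl≈ _ ⟩
    ι 1 * (one *ˢ θ A) n             ∎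
  θ-^ˢ A (suc k) n = begin
    θ (A *ˢ B) n                            ≈⟨ θ-*ˢ A B n ⟩
    (θ A *ˢ B) n + (A *ˢ θ B) n             ≈⟨ +-cong (*ˢ-comm (θ A) B n) (*ˢ-cong {A} {A} {θ B} (λ _ → refl≈) (θ-^ˢ A k) n) ⟩
    (B *ˢ θ A) n + (A *ˢ (ι (suc k) • C)) n ≈⟨ +-congˡ (begin
      (A *ˢ (ι (suc k) • C)) n              ≈⟨ *ˢ-comm A (ι (suc k) • C) n ⟩
      ((ι (suc k) • C) *ˢ A) n              ≈⟨ •-*ˢ (ι (suc k)) C A n ⟩
      ι (suc k) * (C *ˢ A) n                ≈⟨ *-congˡ (*ˢ-comm C A n) ⟩
      ι (suc k) * (A *ˢ C) n                ≈⟨ *-congˡ (*ˢ-assoc A (A ^ˢ k) (θ A) n) ⟨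
      ι (suc k) * (B *ˢ θ A) n              ∎) ⟩
    (B *ˢ θ A) n + ι (suc k) * (B *ˢ θ A) n ≈⟨ solve 2 (λ x i → x :+ i :* x := (con 1 :+ i) :* x) refl≈ _ _ ⟩
    ι (suc (suc k)) * (B *ˢ θ A) n          ∎
    where
    B = A ^ˢ suc k
    C = A ^ˢ k *ˢ θ A

  ^ˢ-cong-≤ : ∀ {A B} n → A ≈[ n ] B → ∀ k → A ^ˢ k ≈[ n ] B ^ˢ k
  ^ˢ-cong-≤ n A≈B zero    j _ = refl≈
  ^ˢ-cong-≤ {A} {B} n A≈B (suc k) = *ˢ-cong-≤ {A} {B} {A ^ˢ k} {B ^ˢ k} n A≈B (^ˢ-cong-≤ {A} {B} n A≈B k)

  1/!_ : ℕ → ℚ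
  1/! k = (+ 1 / k !) {{k ℕ.!≢0}}

  exp-cong-≤ : ∀ {A B} n → A ≈[ n ] B → exp A ≈[ n ] exp B
  exp-cong-≤ {A} {B} n A≈B k k≤n = Σ<-cong (suc k) (λ j → η (1/! j) * (A ^ˢ j) k) (λ j → η (1/! j) * (B ^ˢ j) k) λ j _ → *-congˡ (^ˢ-cong-≤ {A} {B} n A≈B j k k≤n)

  module _ (η-1 : η 1ℚ ≈ 1#) (η-! : ∀ k → ι (suc k) * η (1/! (suc k)) ≈ η (1/! k)) where

    exp-zero : ∀ A → exp A 0 ≈ 1#
    exp-zero A = trans (+-identityʳ _) (trans (*-identityʳ _) η-1)

    module _ (A : Series) (A₀ : A 0 ≈ 0#) where

      private
        c : ℕ → Carrier
        c k = η (1/! k)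

      -- The definition of `exp` stops the sum over the powers at the degree in question. Since
      -- `A ^ˢ k` vanishes below degree k, stopping later changes nothing. The proof of `θ-exp`
      -- needs one common bound for several degrees.
      exp-truncate : ∀ d n → Σ< (suc (d ℕ.+ n)) (λ k → c k * (A ^ˢ k) n) ≈ exp A n
      exp-truncate zero    n = refl≈
      exp-truncate (suc d) n = begin
        Σ< (suc (suc (d ℕ.+ n))) (λ k → c k * (A ^ˢ k) n) ≈⟨ Σ<-last (suc (d ℕ.+ n)) (λ k → c k * (A ^ˢ k) n) ⟩
        Σ< (suc (d ℕ.+ n)) (λ k → c k * (A ^ˢ k) n) + c (suc (d ℕ.+ n)) * (A ^ˢ suc (d ℕ.+ n)) n
          ≈⟨ +-cong (exp-truncate d n) (trans (*-congˡ (^ˢ-vanish A A₀ (suc (d ℕ.+ n)) n (s≤s (ℕ.m≤n+m n d)))) (zeroʳ _)) ⟩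
        exp A n + 0# ≈⟨ +-identityʳ _ ⟩
        exp A n ∎

      θ-exp : θ (exp A) ≈ˢ exp A *ˢ θ A
      θ-exp n = begin
        ι n * Σ< (suc n) (λ k → c k * (A ^ˢ k) n) ≈⟨ Σ<-*ˡ (suc n) (ι n) (λ k → c k * (A ^ˢ k) n) ⟩
        Σ< (suc n) (λ k → ι n * (c k * (A ^ˢ k) n))
          ≈⟨ +-cong (trans (solve 3 (λ i c x → i :* (c :* x) := c :* (i :* x)) refl≈ _ _ _) (trans (*-congˡ (θ-one n)) (zeroʳ _))) (Σ<-cong n (λ k → ι n * (c (suc k) * (A ^ˢ suc k) n)) (λ k → Σ< (suc n) (λ j → c k * ((A ^ˢ k) j * θ A (n ℕ.∸ j)))) λ k _ → begin
            ι n * (c (suc k) * (A ^ˢ suc k) n) ≈⟨ solve 3 (λ i c x → i :* (c :* x) := c :* (i :* x)) refl≈ _ _ _ ⟩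
            c (suc k) * θ (A ^ˢ suc k) n ≈⟨ *-congˡ (θ-^ˢ A k n) ⟩
            c (suc k) * (ι (suc k) * (A ^ˢ k *ˢ θ A) n) ≈⟨ solve 3 (λ c i x → c :* (i :* x) := i :* c :* x) refl≈ _ _ _ ⟩
            ι (suc k) * c (suc k) * (A ^ˢ k *ˢ θ A) n ≈⟨ *-congʳ (η-! k) ⟩
            c k * (A ^ˢ k *ˢ θ A) n ≈⟨ Σ<-*ˡ (suc n) (c k) (λ j → (A ^ˢ k) j * θ A (n ℕ.∸ j)) ⟩
            Σ< (suc n) (λ j → c k * ((A ^ˢ k) j * θ A (n ℕ.∸ j))) ∎) ⟩
        0# + Σ< n (λ k → Σ< (suc n) (λ j → c k * ((A ^ˢ k) j * θ A (n ℕ.∸ j)))) ≈⟨ +-identityˡ _ ⟩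
        Σ< n (λ k → Σ< (suc n) (λ j → c k * ((A ^ˢ k) j * θ A (n ℕ.∸ j)))) ≈⟨ Σ<-swap n (suc n) (λ k j → c k * ((A ^ˢ k) j * θ A (n ℕ.∸ j))) ⟩
        Σ< (suc n) (λ j → Σ< n (λ k → c k * ((A ^ˢ k) j * θ A (n ℕ.∸ j)))) ≈⟨ Σ<-cong (suc n) (λ j → Σ< n (λ k → c k * ((A ^ˢ k) j * θ A (n ℕ.∸ j)))) (λ j → exp A j * θ A (n ℕ.∸ j)) (λ j j<sn → begin
            Σ< n (λ k → c k * ((A ^ˢ k) j * θ A (n ℕ.∸ j))) ≈⟨ Σ<-cong n (λ k → c k * ((A ^ˢ k) j * θ A (n ℕ.∸ j))) (λ k → c k * (A ^ˢ k) j * θ A (n ℕ.∸ j)) (λ k _ → sym (*-assoc _ _ _)) ⟩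
            Σ< n (λ k → c k * (A ^ˢ k) j * θ A (n ℕ.∸ j)) ≈⟨ Σ<-*ʳ n (θ A (n ℕ.∸ j)) (λ k → c k * (A ^ˢ k) j) ⟨
            Σ< n (λ k → c k * (A ^ˢ k) j) * θ A (n ℕ.∸ j) ≈⟨ truncated j (ℕ.s≤s⁻¹ j<sn) ⟩
            exp A j * θ A (n ℕ.∸ j) ∎) ⟩
        (exp A *ˢ θ A) n ∎
        where
        -- For j < n the first n powers suffice. For j = n they miss the power with exponent n, but
        -- there the factor `θ A 0` is 0.
        truncated : ∀ j → j ℕ.≤ n → Σ< n (λ k → c k * (A ^ˢ k) j) * θ A (n ℕ.∸ j) ≈ exp A j * θ A (n ℕ.∸ j)
        truncated j j≤n with n ℕ.∸ j in eq
        ... | zero  = trans (trans (*-congˡ (zeroˡ _)) (zeroʳ _)) (sym (trans (*-congˡ (zeroˡ _)) (zeroʳ _)))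
        ... | suc d = *-congʳ (trans (reflexive (cong (λ m → Σ< m (λ k → c k * (A ^ˢ k) j)) (≡.trans (≡.sym (ℕ.m∸n+n≡m j≤n)) (cong (ℕ._+ j) eq)))) (exp-truncate d j))

  module _ (inv : ℕ → Carrier) (ι-inv : ∀ n → ι (suc n) * inv n ≈ 1#) where

    ι-cancel : ∀ n x y → ι (suc n) * x ≈ ι (suc n) * y → x ≈ y
    ι-cancel n x y eq = begin
      x                         ≈⟨ *-identityˡ x ⟨
      1# * x                    ≈⟨ *-congʳ (ι-inv n) ⟨
      ι (suc n) * inv n * x     ≈⟨ solve 3 (λ i r x → i :* r :* x := r :* (i :* x)) refl≈ _ _ _ ⟩
      inv n * (ι (suc n) * x)   ≈⟨ *-congˡ eq ⟩
      inv n * (ι (suc n) * y)   ≈⟨ solve 3 (λ i r x → i :* r :* x := r :* (i :* x)) refl≈ _ _ _ ⟨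
      ι (suc n) * inv n * y     ≈⟨ *-congʳ (ι-inv n) ⟩
      1# * y                    ≈⟨ *-identityˡ y ⟩
      y                         ∎

    -- As `Ξ 0` vanishes, the coefficient n + 1 of `Ξ *ˢ X` involves the coefficients of `X` only up
    -- to n, and the factor n + 1 on the left can be cancelled.
    ode-unique : ∀ Ξ X Y → Ξ 0 ≈ 0# → X 0 ≈ Y 0 → θ X ≈ˢ Ξ *ˢ X → θ Y ≈ˢ Ξ *ˢ Y → X ≈ˢ Y
    ode-unique Ξ X Y Ξ₀ X₀≈Y₀ θX θY n = below n n ℕ.≤-refl
      where
      below : ∀ n → X ≈[ n ] Y
      below zero    zero    _ = X₀≈Y₀
      below (suc n) k k≤sn with ℕ.m≤n⇒m<n∨m≡n k≤sn
      ... | inj₁ k<sn = below n k (ℕ.s≤s⁻¹ k<sn)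
      ... | inj₂ refl = ι-cancel n (X (suc n)) (Y (suc n)) (begin
        ι (suc n) * X (suc n) ≈⟨ θX (suc n) ⟩
        Ξ 0 * X (suc n) + (tail Ξ *ˢ X) n
          ≈⟨ +-cong (trans (trans (*-congʳ Ξ₀) (zeroˡ _)) (sym (trans (*-congʳ Ξ₀) (zeroˡ _)))) (*ˢ-cong-≤ {tail Ξ} {tail Ξ} {X} {Y} n (λ _ _ → refl≈) (below n) n ℕ.≤-refl) ⟩
        Ξ 0 * Y (suc n) + (tail Ξ *ˢ Y) n ≈⟨ θY (suc n) ⟨
        ι (suc n) * Y (suc n) ∎)

-- Rational numbers and reciprocals of factorials

ℚ-ring : CommutativeRing 0ℓ 0ℓ
ℚ-ring = ℚ.+-*-commutativeRing

module ℚΣ = Sums ℚ-ring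
module ℚˢ = SeriesTheory ℚ-ring id

ι-/1 : ∀ n → ℚΣ.ι n ≡ + n / 1
ι-/1 zero    = refl
ι-/1 (suc n) = ≡.trans (cong (λ x → 1ℚ ℚ.+ x) (ι-/1 n)) (ℚ.toℚᵘ-injective (begin
  toℚᵘ (1ℚ ℚ.+ (+ n / 1))                ≈⟨ ℚ.toℚᵘ-homo-+ 1ℚ (+ n / 1) ⟩
  toℚᵘ 1ℚ ℚᵘ.+ toℚᵘ (+ n / 1)            ≈⟨ ℚᵘ.+-congʳ (toℚᵘ 1ℚ) (ℚ.toℚᵘ-fromℚᵘ (mkℚᵘ (+ n) 0)) ⟩
  mkℚᵘ (+ 1) 0 ℚᵘ.+ mkℚᵘ (+ n) 0         ≈⟨ *≡* (cong (ℤ._* (+ 1)) (cong₂ ℤ._+_ (ℤ.*-identityʳ (+ 1)) (ℤ.*-identityʳ (+ n)))) ⟩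
  mkℚᵘ (+ suc n) 0                       ≈⟨ ℚ.toℚᵘ-fromℚᵘ (mkℚᵘ (+ suc n) 0) ⟨
  toℚᵘ (+ suc n / 1)                     ∎))
  where open ℚᵘ.≃-Reasoning

ι-* : ∀ m n .{{_ : ℕ.NonZero n}} → ℚΣ.ι n ℚ.* (+ m / n) ≡ ℚΣ.ι m
ι-* m (suc n) = ≡.trans (cong (ℚ._* (+ m / suc n)) (ι-/1 (suc n))) (≡.trans (ℚ.toℚᵘ-injective (begin
  toℚᵘ ((+ suc n / 1) ℚ.* (+ m / suc n))          ≈⟨ ℚ.toℚᵘ-homo-* (+ suc n / 1) (+ m / suc n) ⟩
  toℚᵘ (+ suc n / 1) ℚᵘ.* toℚᵘ (+ m / suc n)      ≈⟨ ℚᵘ.*-cong (ℚ.toℚᵘ-fromℚᵘ (mkℚᵘ (+ suc n) 0)) (ℚ.toℚᵘ-fromℚᵘ (mkℚᵘ (+ m) n)) ⟩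
  mkℚᵘ (+ suc n) 0 ℚᵘ.* mkℚᵘ (+ m) n              ≈⟨ *≡* (≡.trans (ℤ.*-identityʳ _) (≡.trans (ℤ.*-comm (+ suc n) (+ m)) (cong (+ m ℤ.*_) (≡.sym (ℤ.*-identityˡ (+ suc n)))))) ⟩
  mkℚᵘ (+ m) 0                                    ≈⟨ ℚ.toℚᵘ-fromℚᵘ (mkℚᵘ (+ m) 0) ⟨
  toℚᵘ (+ m / 1)                                  ∎)) (≡.sym (ι-/1 m)))
  where open ℚᵘ.≃-Reasoning

1/ : ℕ → ℚ
1/ zero    = 0ℚ
1/ (suc n) = + 1 / suc n

1/≡ : ∀ n .{{_ : ℕ.NonZero n}} → + 1 / n ≡ 1/ n
1/≡ (suc n) = refl

ι-1/ : ∀ n → ℚΣ.ι (suc n) ℚ.* 1/ (suc n) ≡ 1ℚ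
ι-1/ n = ι-* 1 (suc n)

/≡ : ∀ m n .{{_ : ℕ.NonZero n}} → + m / n ≡ 1/ n ℚ.* ℚΣ.ι m
/≡ m (suc n) = begin
  + m / suc n                                       ≡⟨ ℚ.*-identityˡ _ ⟨
  1ℚ ℚ.* (+ m / suc n)                              ≡⟨ cong (ℚ._* (+ m / suc n)) (≡.trans (ℚ.*-comm (1/ (suc n)) _) (ι-1/ n)) ⟨
  1/ (suc n) ℚ.* ℚΣ.ι (suc n) ℚ.* (+ m / suc n)     ≡⟨ ℚ.*-assoc (1/ (suc n)) _ _ ⟩
  1/ (suc n) ℚ.* (ℚΣ.ι (suc n) ℚ.* (+ m / suc n))   ≡⟨ cong (1/ (suc n) ℚ.*_) (ι-* m (suc n)) ⟩
  1/ (suc n) ℚ.* ℚΣ.ι m                             ∎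
  where open ≡.≡-Reasoning

ι-1/! : ∀ k → ℚΣ.ι (suc k) ℚ.* ℚˢ.1/! (suc k) ≡ ℚˢ.1/! k
ι-1/! k = go (k !) {{k ℕ.!≢0}} {{suc k ℕ.!≢0}}
  where
  open ≡.≡-Reasoning
  -- The factorial of k is generalised to an arbitrary nonzero `n`; the next factorial is `suc k`
  -- times it by definition.
  go : ∀ n .{{_ : ℕ.NonZero n}} .{{_ : ℕ.NonZero (suc k ℕ.* n)}} → ℚΣ.ι (suc k) ℚ.* (+ 1 / (suc k ℕ.* n)) ≡ + 1 / n
  go (suc n) = ℚˢ.ι-cancel (1/ ∘ suc) ι-1/ n _ _ (begin
    ℚΣ.ι (suc n) ℚ.* (ℚΣ.ι (suc k) ℚ.* x)   ≡⟨ ℚ.*-assoc (ℚΣ.ι (suc n)) _ _ ⟨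
    ℚΣ.ι (suc n) ℚ.* ℚΣ.ι (suc k) ℚ.* x     ≡⟨ cong (ℚ._* x) (≡.trans (ℚ.*-comm (ℚΣ.ι (suc n)) _) (≡.sym (ℚΣ.×1-homo-* (suc k) (suc n)))) ⟩
    ℚΣ.ι (suc k ℕ.* suc n) ℚ.* x            ≡⟨ ι-* 1 (suc k ℕ.* suc n) ⟩
    1ℚ                                      ≡⟨ ι-1/ n ⟨
    ℚΣ.ι (suc n) ℚ.* (+ 1 / suc n)          ∎)
    where x = + 1 / (suc k ℕ.* suc n)

open ℚ⟦z⟧ using () renaming (_*ˢ_ to _⊛_)

-- The ring of polynomials

coeff-+ : ∀ p q k → coeff (p +ᵖ q) k ≡ coeff p k ℚ.+ coeff q k
coeff-+ []      q       k       = ≡.sym (ℚ.+-identityˡ _)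
coeff-+ (a ∷ p) []      k       = ≡.sym (ℚ.+-identityʳ _)
coeff-+ (a ∷ p) (b ∷ q) zero    = refl
coeff-+ (a ∷ p) (b ∷ q) (suc k) = coeff-+ p q k

coeff-map : ∀ {f : ℚ → ℚ} → f 0ℚ ≡ 0ℚ → ∀ p k → coeff (List.map f p) k ≡ f (coeff p k)
coeff-map f0 []      k       = ≡.sym f0
coeff-map f0 (a ∷ p) zero    = refl
coeff-map f0 (a ∷ p) (suc k) = coeff-map f0 p k

-- Together with `coeff-+` this is why polynomials form a ring: `coeff` turns the operations into
-- those of series, and `_≈ᵖ_` compares coefficients, so the laws are inherited from series.
coeff-* : ∀ p q k → coeff (p *ᵖ q) k ≡ (coeff p ⊛ coeff q) k
coeff-* []      q k = ≡.sym (ℚΣ.Σ<-zero (suc k) (λ j → 0ℚ ℚ.* coeff q (k ℕ.∸ j)) λ j _ → ℚ.*-zeroˡ (coeff q (k ℕ.∸ j)))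
coeff-* (a ∷ p) q k = ≡.trans (coeff-+ (List.map (a ℚ.*_) q) (0ℚ ∷ p *ᵖ q) k)
  (≡.trans (cong (ℚ._+ coeff (0ℚ ∷ p *ᵖ q) k) (coeff-map (ℚ.*-zeroʳ a) q k)) (go k))
  where
  go : ∀ k → a ℚ.* coeff q k ℚ.+ coeff (0ℚ ∷ p *ᵖ q) k ≡ (coeff (a ∷ p) ⊛ coeff q) k
  go zero    = refl
  go (suc k) = cong (λ x → a ℚ.* coeff q (suc k) ℚ.+ x) (coeff-* p q k)

⊛-cong : ∀ {A A′ B B′} → (∀ k → A k ≡ A′ k) → (∀ k → B k ≡ B′ k) → ∀ k → (A ⊛ B) k ≡ (A′ ⊛ B′) k
⊛-cong {A} {A′} {B} {B′} = ℚˢ.*ˢ-cong {A} {A′} {B} {B′}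

coeff-constᵖ : ∀ a k → coeff (constᵖ a) k ≡ ℚ⟦z⟧.monomial a 0 k
coeff-constᵖ a zero    = refl
coeff-constᵖ a (suc k) = refl

coeff-constᵖ-* : ∀ a p k → coeff (constᵖ a *ᵖ p) k ≡ a ℚ.* coeff p k
coeff-constᵖ-* a p k = ≡.trans (coeff-* (constᵖ a) p k)
  (≡.trans (⊛-cong {B = coeff p} (coeff-constᵖ a) (λ _ → refl) k) (ℚˢ.monomial₀-* a (coeff p) k))

Poly-ring : CommutativeRing 0ℓ 0ℓ
Poly-ring = record
  { Carrier = Poly
  ; _≈_ = _≈ᵖ_
  ; _+_ = _+ᵖ_
  ; _*_ = _*ᵖ_
  ; -_ = List.map (ℚ.-_)
  ; 0# = []
  ; 1# = constᵖ 1ℚ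
  ; isCommutativeRing = record
    { isRing = record
      { +-isAbelianGroup = record
        { isGroup = record
          { isMonoid = record
            { isSemigroup = record
              { isMagma = record
                { isEquivalence = record { refl = λ _ → refl ; sym = λ e k → ≡.sym (e k) ; trans = λ e f k → ≡.trans (e k) (f k) }
                ; ∙-cong = λ {p} {p′} {q} {q′} e f k → ≡.trans (coeff-+ p q k) (≡.trans (cong₂ ℚ._+_ (e k) (f k)) (≡.sym (coeff-+ p′ q′ k)))
                }
              ; assoc = λ p q r k → via (coeff-+ (p +ᵖ q) r k) (cong (ℚ._+ coeff r k) (coeff-+ p q k))
                  (coeff-+ p (q +ᵖ r) k) (cong (λ x → coeff p k ℚ.+ x) (coeff-+ q r k)) (ℚ.+-assoc (coeff p k) (coeff q k) (coeff r k))
              }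
            ; identity = (λ _ _ → refl) , (λ p k → ≡.trans (coeff-+ p [] k) (ℚ.+-identityʳ _))
            }
          ; inverse = (λ p k → ≡.trans (coeff-+ (neg p) p k) (≡.trans (cong (ℚ._+ coeff p k) (coeff-map refl p k)) (ℚ.+-inverseˡ (coeff p k))))
                    , (λ p k → ≡.trans (coeff-+ p (neg p) k) (≡.trans (cong (λ x → coeff p k ℚ.+ x) (coeff-map refl p k)) (ℚ.+-inverseʳ (coeff p k))))
          ; ⁻¹-cong = λ {p} {q} e k → ≡.trans (coeff-map refl p k) (≡.trans (cong ℚ.-_ (e k)) (≡.sym (coeff-map refl q k)))
          }
        ; comm = λ p q k → ≡.trans (coeff-+ p q k) (≡.trans (ℚ.+-comm (coeff p k) (coeff q k)) (≡.sym (coeff-+ q p k)))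
        }
      ; *-cong = λ {p} {p′} {q} {q′} e f k → ≡.trans (coeff-* p q k) (≡.trans (⊛-cong {coeff p} {coeff p′} {coeff q} {coeff q′} e f k) (≡.sym (coeff-* p′ q′ k)))
      ; *-assoc = λ p q r k → via (coeff-* (p *ᵖ q) r k) (⊛-cong {B = coeff r} (coeff-* p q) (λ _ → refl) k)
          (coeff-* p (q *ᵖ r) k) (⊛-cong {coeff p} (λ _ → refl) (coeff-* q r) k) (ℚˢ.*ˢ-assoc (coeff p) (coeff q) (coeff r) k)
      ; *-identity = one-* , λ p k → ≡.trans (comm* p (constᵖ 1ℚ) k) (one-* p k)
      ; distrib = (λ p q r k → ≡.trans (comm* p (q +ᵖ r) k) (≡.trans (distribʳ p q r k)
            (≡.trans (coeff-+ (q *ᵖ p) (r *ᵖ p) k) (≡.trans (cong₂ ℚ._+_ (comm* q p k) (comm* r p k)) (≡.sym (coeff-+ (p *ᵖ q) (p *ᵖ r) k))))))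
          , distribʳ
      }
    ; *-comm = comm*
    }
  }
  where
  neg : Poly → Poly
  neg = List.map (ℚ.-_)
  via : ∀ {a b c a′ b′ : ℚ} → a ≡ b → b ≡ c → a′ ≡ b′ → ∀ {c′} → b′ ≡ c′ → c ≡ c′ → a ≡ a′
  via refl refl refl refl refl = refl
  comm* : ∀ p q → p *ᵖ q ≈ᵖ q *ᵖ p
  comm* p q k = ≡.trans (coeff-* p q k) (≡.trans (ℚˢ.*ˢ-comm (coeff p) (coeff q) k) (≡.sym (coeff-* q p k)))
  one-* : ∀ p → constᵖ 1ℚ *ᵖ p ≈ᵖ p
  one-* p k = ≡.trans (coeff-constᵖ-* 1ℚ p k) (ℚ.*-identityˡ _)
  distribʳ : ∀ p q r → (q +ᵖ r) *ᵖ p ≈ᵖ (q *ᵖ p) +ᵖ (r *ᵖ p)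
  distribʳ p q r k = ≡.trans (coeff-* (q +ᵖ r) p k) (≡.trans (⊛-cong {B = coeff p} (coeff-+ q r) (λ _ → refl) k)
    (≡.trans (ℚˢ.*ˢ-distribʳ (coeff q) (coeff r) (coeff p) k)
      (≡.trans (cong₂ ℚ._+_ (≡.sym (coeff-* q p k)) (≡.sym (coeff-* r p k))) (≡.sym (coeff-+ (q *ᵖ p) (r *ᵖ p) k)))))

constᵖ-+ : ∀ a b → constᵖ (a ℚ.+ b) ≈ᵖ constᵖ a +ᵖ constᵖ b
constᵖ-+ a b zero    = refl
constᵖ-+ a b (suc k) = refl

constᵖ-* : ∀ a b → constᵖ (a ℚ.* b) ≈ᵖ constᵖ a *ᵖ constᵖ b
constᵖ-* a b zero    = ≡.sym (coeff-constᵖ-* a (constᵖ b) 0)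
constᵖ-* a b (suc k) = ≡.sym (≡.trans (coeff-constᵖ-* a (constᵖ b) (suc k)) (ℚ.*-zeroʳ a))

constᵖ-0 : constᵖ 0ℚ ≈ᵖ []
constᵖ-0 zero    = refl
constᵖ-0 (suc k) = refl

-- Series over a commutative ℚ-algebra, and the functional equation of C-trees

module ℚ-Algebra (K : CommutativeRing 0ℓ 0ℓ) (η : ℚ → CommutativeRing.Carrier K)
  (η-0 : CommutativeRing._≈_ K (η 0ℚ) (CommutativeRing.0# K))
  (η-1 : CommutativeRing._≈_ K (η 1ℚ) (CommutativeRing.1# K))
  (η-+ : ∀ a b → CommutativeRing._≈_ K (η (a ℚ.+ b)) (CommutativeRing._+_ K (η a) (η b)))
  (η-* : ∀ a b → CommutativeRing._≈_ K (η (a ℚ.* b)) (CommutativeRing._*_ K (η a) (η b))) where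

  open CommutativeRing K hiding (refl; zero)
  open Sums K using (ι; Σ<; Σ<-cong)
  open SeriesTheory K η public
  open PowerSeries (Semiring.rawSemiring (CommutativeRing.semiring K)) η using (Series; monomial; _*ˢ_; _≈ˢ_; exp)
  open import Relation.Binary.Reasoning.Setoid setoid

  η-ι : ∀ n → η (ℚΣ.ι n) ≈ ι n
  η-ι zero    = η-0
  η-ι (suc n) = trans (η-+ 1ℚ (ℚΣ.ι n)) (+-cong η-1 (η-ι n))

  η-Σ< : ∀ n f → η (ℚΣ.Σ< n f) ≈ Σ< n (η ∘ f)
  η-Σ< zero    f = η-0
  η-Σ< (suc n) f = trans (η-+ (f 0) (ℚΣ.Σ< n (f ∘ suc))) (+-congˡ (η-Σ< n (f ∘ suc)))

  η-ι* : ∀ n x y → ℚΣ.ι n ℚ.* x ≡ y → ι n * η x ≈ η y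
  η-ι* n x y eq = trans (*-congʳ (sym (η-ι n))) (trans (sym (η-* (ℚΣ.ι n) x)) (reflexive (cong η eq)))

  inverse : ℕ → Carrier
  inverse n = η (1/ n)

  ι-inverse : ∀ n → ι (suc n) * inverse (suc n) ≈ 1#
  ι-inverse n = trans (η-ι* (suc n) _ _ (ι-1/ n)) η-1

  η-! : ∀ k → ι (suc k) * η (1/! (suc k)) ≈ η (1/! k)
  η-! k = η-ι* (suc k) _ _ (ι-1/! k)

  η-*ˢ : ∀ A B → (λ n → η (ℚ⟦z⟧._*ˢ_ A B n)) ≈ˢ (η ∘ A) *ˢ (η ∘ B)
  η-*ˢ A B n = trans (η-Σ< (suc n) (λ k → A k ℚ.* B (n ℕ.∸ k))) (Σ<-cong (suc n) (λ k → η (A k ℚ.* B (n ℕ.∸ k))) (λ k → η (A k) * η (B (n ℕ.∸ k))) (λ k _ → η-* _ _))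

  exp-product : ∀ G Λ D H → G 0 ≈ 0# → Λ 0 ≈ 0# → D 0 ≈ 1# → H 0 ≈ 1# →
    θ D ≈ˢ Λ *ˢ D → θ H ≈ˢ (θ G +ˢ Λ) *ˢ H → H ≈ˢ exp G *ˢ D
  exp-product G Λ D H G₀ Λ₀ D₀ H₀ θD θH = ode-unique (inverse ∘ suc) ι-inverse (θ G +ˢ Λ) H (E *ˢ D)
    (trans (+-cong (zeroˡ _) Λ₀) (+-identityʳ _))
    (trans H₀ (sym (trans (*ˢ-zero E D) (trans (*-cong (exp-zero η-1 η-! G) D₀) (*-identityˡ 1#)))))
    θH ode
    where
    E = exp G
    ode : θ (E *ˢ D) ≈ˢ (θ G +ˢ Λ) *ˢ (E *ˢ D)
    ode n = begin
      θ (E *ˢ D) n ≈⟨ θ-*ˢ E D n ⟩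
      (θ E *ˢ D) n + (E *ˢ θ D) n
        ≈⟨ +-cong (*ˢ-cong {θ E} {θ G *ˢ E} {D} {D} (λ k → trans (θ-exp η-1 η-! G G₀ k) (*ˢ-comm E (θ G) k)) (λ _ → refl≈) n)
                  (*ˢ-cong {E} {E} {θ D} {Λ *ˢ D} (λ _ → refl≈) θD n) ⟩
      ((θ G *ˢ E) *ˢ D) n + (E *ˢ (Λ *ˢ D)) n ≈⟨ +-cong (*ˢ-assoc (θ G) E D n) (begin
        (E *ˢ (Λ *ˢ D)) n ≈⟨ *ˢ-assoc E Λ D n ⟨
        ((E *ˢ Λ) *ˢ D) n ≈⟨ *ˢ-cong {E *ˢ Λ} {Λ *ˢ E} {D} {D} (*ˢ-comm E Λ) (λ _ → refl≈) n ⟩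
        ((Λ *ˢ E) *ˢ D) n ≈⟨ *ˢ-assoc Λ E D n ⟩
        (Λ *ˢ (E *ˢ D)) n ∎) ⟩
      (θ G *ˢ (E *ˢ D)) n + (Λ *ˢ (E *ˢ D)) n ≈⟨ *ˢ-distribʳ (θ G) Λ (E *ˢ D) n ⟨
      ((θ G +ˢ Λ) *ˢ (E *ˢ D)) n ∎

  Solution : Carrier → Series → Series → Set
  Solution u D A = A 0 ≈ 0# × A ≈ˢ (monomial u 1 *ˢ exp A) *ˢ D

  module _ (u : Carrier) (D : Series) where

    solution-intro : ∀ A → A 0 ≈ 0# → (∀ n → A (suc n) ≈ u * (exp A *ˢ D) n) → Solution u D A
    solution-intro A A₀ A-suc = A₀ , eq
      where
      eq : A ≈ˢ (monomial u 1 *ˢ exp A) *ˢ D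
      eq zero    = trans A₀ (sym (trans (*ˢ-assoc (monomial u 1) (exp A) D 0) (monomial₁-*-zero u (exp A *ˢ D))))
      eq (suc n) = trans (A-suc n) (sym (trans (*ˢ-assoc (monomial u 1) (exp A) D (suc n)) (monomial₁-*-suc u (exp A *ˢ D) n)))

    solution-suc : ∀ A → Solution u D A → ∀ n → A (suc n) ≈ u * (exp A *ˢ D) n
    solution-suc A (_ , eq) n = trans (eq (suc n)) (trans (*ˢ-assoc (monomial u 1) (exp A) D (suc n)) (monomial₁-*-suc u (exp A *ˢ D) n))

    -- The factor z makes the coefficient n + 1 of a solution depend on its coefficients up to n
    -- only.
    solution-unique : ∀ A B → Solution u D A → Solution u D B → A ≈ˢ B
    solution-unique A B solA solB n = below n n ℕ.≤-refl
      where
      below : ∀ n → A ≈[ n ] B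
      below zero    zero    _ = trans (proj₁ solA) (sym (proj₁ solB))
      below (suc n) k k≤sn with ℕ.m≤n⇒m<n∨m≡n k≤sn
      ... | inj₁ k<sn = below n k (ℕ.s≤s⁻¹ k<sn)
      ... | inj₂ refl = begin
        A (suc n)               ≈⟨ solution-suc A solA n ⟩
        u * (exp A *ˢ D) n      ≈⟨ *-congˡ (*ˢ-cong-≤ {exp A} {exp B} {D} {D} n (exp-cong-≤ {A} {B} n (below n)) (λ _ _ → refl≈) n ℕ.≤-refl) ⟩
        u * (exp B *ˢ D) n      ≈⟨ solution-suc B solB n ⟨
        B (suc n)               ∎

-- The generating functions of trees and forests

enum-≈ : ∀ {A : Set} {_≈₁_ _≈₂_ : A → A → Set} {P xs} → (∀ {x y} → x ≈₁ y → x ≈₂ y) → (∀ {x y} → x ≈₂ y → x ≈₁ y) →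
  Enumeration _≈₁_ P xs → Enumeration _≈₂_ P xs
enum-≈ f g e = record
  { sound    = sound
  ; complete = λ p → let y , y∈ , x≈y = complete p in y , y∈ , f x≈y
  ; unique   = AllPairs.map (λ x≉y → x≉y ∘ g) unique
  }
  where open Enumeration e

enum-⇔ : ∀ {A : Set} {_≈_ : A → A → Set} {P Q : A → Set} {xs} → (∀ {x} → P x → Q x) → (∀ {x} → Q x → P x) →
  Enumeration _≈_ P xs → Enumeration _≈_ Q xs
enum-⇔ f g e = record { sound = f ∘ sound ; complete = complete ∘ g ; unique = unique }
  where open Enumeration e

enum-∼ : ∀ Fs → Enumeration _≅ᶠ_ (_∈ Fs) (deduplicate _∼?_ Fs)
enum-∼ Fs = enum-≈ {_≈₁_ = _∼_} {_≅ᶠ_} (λ {F} {G} → ∼⇒≅ᶠ F G) (λ {F} {G} → ≅ᶠ⇒∼ F G)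
  (enum-deduplicate _∼?_
    (λ {F} {G} e → ≅ᶠ⇒∼ G F (≅ᶠ-sym (∼⇒≅ᶠ F G e)))
    (λ {F} {G} {H} e f → ≅ᶠ⇒∼ F H (≅ᶠ-trans (∼⇒≅ᶠ F G e) (∼⇒≅ᶠ G H f)))
    (λ {F} → ≅ᶠ⇒∼ F F ≅ᶠ-refl) Fs)

forests : ℕ → List Forest
forests n = deduplicate _∼?_ (planeForests n)

forests-enum : ∀ n → Enumeration _≅ᶠ_ (λ F → ∣ F ∣ᶠ ≡ n) (forests n)
forests-enum n = enum-⇔ (λ {F} → planeForests-sound n F) (λ {F} → planeForests-complete n F) (enum-∼ (planeForests n))

MSET≥2-enum : ∀ n → Enumeration _≅ᶠ_ (λ F → ∣ F ∣ᶠ ≡ n × Repeated F) (MSET≥2 n)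
MSET≥2-enum n = enum-⇔
  (λ {F} F∈ → let F∈′ , r = ∈-filter⁻ repeated? {xs = planeForests n} F∈ in planeForests-sound n F F∈′ , r)
  (λ {F} (eq , r) → ∈-filter⁺ repeated? (planeForests-complete n F eq) r)
  (enum-∼ (filter repeated? (planeForests n)))

planeTrees-sound : ∀ n T → T ∈ planeTrees n → ∣ T ∣ᵗ ≡ n
planeTrees-sound (suc n) T T∈ with ∈-map⁻ node T∈
... | F , F∈ , refl = cong suc (planeForests-sound n F F∈)

planeTrees-complete : ∀ n T → ∣ T ∣ᵗ ≡ n → T ∈ planeTrees n
planeTrees-complete (suc n) (node F) eq = ∈-map⁺ node (planeForests-complete n F (ℕ.suc-injective eq))

polyaTrees-enum : ∀ n → Enumeration _≅ᵗ_ (λ T → ∣ T ∣ᵗ ≡ n) (polyaTrees n)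
polyaTrees-enum n = enum-⇔ {_≈_ = _≅ᵗ_} (λ {T} → planeTrees-sound n T) (λ {T} → planeTrees-complete n T)
  (enum-deduplicate _≅ᵗ?_ (λ {T} {U} → ≅ᵗ-sym T U) (λ {T} {U} {V} → ≅ᵗ-trans T U V) (λ {T} → ≅ᵗ-refl T) (planeTrees n))

rest : Tree → Forest → Forest
rest T = filter (¬? ∘ (T ≅ᵗ?_))

mult-rest : ∀ T F → multiplicity T (rest T F) ≡ 0
mult-rest T F = mult-absent T (rest T F) λ U∈ → proj₂ (∈-filter⁻ (¬? ∘ (T ≅ᵗ?_)) {xs = F} U∈)

-- If T occurs fewer than i times, the truncated subtraction removes all its copies.
remove : ℕ → Tree → Forest → Forest
remove i T F = replicate (multiplicity T F ℕ.∸ i) T ++ rest T F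

-- An isomorphism rather than a reordering, because each copy in `F` is replaced by `T` itself.
split-copies : ∀ T F → F ≅ᶠ remove 0 T F
split-copies T [] = ≅ᶠ-refl
split-copies T (U ∷ F) = case T ≅ᵗ? U of λ where
  (yes T≅U) → subst (U ∷ F ≅ᶠ_) (cong₂ (λ m R → replicate m T ++ R) (≡.sym (mult-yes T U F T≅U)) (≡.sym (List.filter-reject (¬? ∘ (T ≅ᵗ?_)) (λ ¬e → ¬e T≅U))))
    (≅ᶠ-∷ (≅ᵗ-sym T U T≅U) (split-copies T F))
  (no T≇U) → subst (U ∷ F ≅ᶠ_) (cong₂ (λ m R → replicate m T ++ R) (≡.sym (mult-no T U F T≇U)) (≡.sym (List.filter-accept (¬? ∘ (T ≅ᵗ?_)) T≇U)))
    (≅ᶠ-trans (≅ᶠ-prep U (split-copies T F)) (↭⇒≅ᶠ (↭-sym (shift U (replicate (multiplicity T F) T) (rest T F)))))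


replicate-++ : ∀ {A : Set} i j (x : A) (ys : List A) → replicate (i ℕ.+ j) x ++ ys ≡ replicate i x ++ (replicate j x ++ ys)
replicate-++ zero    j x ys = refl
replicate-++ (suc i) j x ys = cong (x ∷_) (replicate-++ i j x ys)

remove-≅ : ∀ i T F → i ℕ.≤ multiplicity T F → F ≅ᶠ replicate i T ++ remove i T F
remove-≅ i T F i≤m = subst (F ≅ᶠ_)
  (≡.trans (cong (λ m → replicate m T ++ rest T F) (≡.sym (ℕ.m+[n∸m]≡n i≤m))) (replicate-++ i (multiplicity T F ℕ.∸ i) T (rest T F)))
  (split-copies T F)

size-copies : ∀ i T F → ∣ replicate i T ++ F ∣ᶠ ≡ i ℕ.* ∣ T ∣ᵗ ℕ.+ ∣ F ∣ᶠ
size-copies zero    T F = refl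
size-copies (suc i) T F = ≡.trans (cong (∣ T ∣ᵗ ℕ.+_) (size-copies i T F)) (≡.sym (ℕ.+-assoc ∣ T ∣ᵗ _ _))

size-remove : ∀ i T F → i ℕ.≤ multiplicity T F → ∣ F ∣ᶠ ≡ i ℕ.* ∣ T ∣ᵗ ℕ.+ ∣ remove i T F ∣ᶠ
size-remove i T F i≤m = ≡.trans (≅ᶠ-size F _ (remove-≅ i T F i≤m)) (size-copies i T (remove i T F))

-- Multiplicities determine a forest, are additive, and cancel as natural numbers.
++-cancelˡ : ∀ A F G → A ++ F ≅ᶠ A ++ G → F ≅ᶠ G
++-cancelˡ A F G e = mult⇒≅ᶠ F G λ V → ℕ.+-cancelˡ-≡ (multiplicity V A) _ _
  (≡.trans (≡.sym (mult-++ V A F)) (≡.trans (≅ᶠ⇒mult (A ++ F) (A ++ G) e V) (mult-++ V A G)))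

≅ᶠ-++ˡ : ∀ A {F G} → F ≅ᶠ G → A ++ F ≅ᶠ A ++ G
≅ᶠ-++ˡ []      e = e
≅ᶠ-++ˡ (T ∷ A) e = ≅ᶠ-prep T (≅ᶠ-++ˡ A e)

tree-size-positive : ∀ T → 1 ℕ.≤ ∣ T ∣ᵗ
tree-size-positive (node F) = s≤s z≤n

mult≤size : ∀ T F → multiplicity T F ℕ.≤ ∣ F ∣ᶠ
mult≤size T F = subst (multiplicity T F ℕ.≤_) (≡.sym (size-remove (multiplicity T F) T F ℕ.≤-refl))
  (ℕ.≤-trans (ℕ.≤-trans (ℕ.≤-reflexive (≡.sym (ℕ.*-identityʳ _))) (ℕ.*-monoʳ-≤ (multiplicity T F) (tree-size-positive T))) (ℕ.m≤m+n _ _))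

-- Sums over the multiples of a number

module Dilation (K : CommutativeRing 0ℓ 0ℓ) where

  open CommutativeRing K hiding (refl; zero)
  open Sums K
  open import Relation.Binary.Reasoning.Setoid setoid

  Σ<-delta : ∀ N f a → a ℕ.< N → (∀ k → k ≢ a → f k ≈ 0#) → Σ< N f ≈ f a
  Σ<-delta N f a a<N h = trans
    (sum-delta (fromℕ< a<N) (f ∘ toℕ) λ j j≢ → h (toℕ j) λ j≡a → j≢ (Fin.toℕ-injective (≡.trans j≡a (≡.sym (Fin.toℕ-fromℕ< a<N)))))
    (reflexive (cong f (Fin.toℕ-fromℕ< a<N)))

  Σ<-extend : ∀ m d f → (∀ k → m ℕ.≤ k → f k ≈ 0#) → Σ< (d ℕ.+ m) f ≈ Σ< m f
  Σ<-extend m zero    f h = CommutativeRing.refl K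
  Σ<-extend m (suc d) f h = trans (Σ<-last (d ℕ.+ m) f) (trans (+-cong (Σ<-extend m d f h) (h (d ℕ.+ m) (ℕ.m≤n+m m d))) (+-identityʳ _))

  Σ<-extend-≤ : ∀ {m n} f → m ℕ.≤ n → (∀ k → m ℕ.≤ k → f k ≈ 0#) → Σ< n f ≈ Σ< m f
  Σ<-extend-≤ {m} {n} f m≤n h = trans (reflexive (cong (λ N → Σ< N f) (≡.sym (ℕ.m∸n+n≡m m≤n)))) (Σ<-extend m (n ℕ.∸ m) f h)

  -- Both sides sum over the pairs (k, s) with k = (i + 1) s, arranged by k on the left and by s on
  -- the right. For a product of A(z^(i+1)) with another series, this turns a coefficient into a sum
  -- over the coefficients of A.
  Σ<-dilate : ∀ i n (φ ψ : ℕ → Carrier) →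
    Σ< (suc n) (λ k → [ suc i ∣? k ]· (φ (k ℕ./ suc i)) * ψ k) ≈ Σ< (suc n) (λ s → [ suc i ℕ.* s ℕ.≤? n ]· (φ s * ψ (suc i ℕ.* s)))
  Σ<-dilate i n φ ψ = begin
    Σ< (suc n) (λ k → [ suc i ∣? k ]· (φ (k ℕ./ suc i)) * ψ k)
      ≈⟨ Σ<-cong (suc n) (λ k → [ suc i ∣? k ]· (φ (k ℕ./ suc i)) * ψ k) (λ k → Σ< (suc n) (f k)) (λ k k<sn → by-k k (ℕ.s≤s⁻¹ k<sn)) ⟩
    Σ< (suc n) (λ k → Σ< (suc n) (f k)) ≈⟨ Σ<-swap (suc n) (suc n) f ⟩
    Σ< (suc n) (λ s → Σ< (suc n) (λ k → f k s)) ≈⟨ Σ<-cong (suc n) (λ s → Σ< (suc n) (λ k → f k s)) (λ s → [ suc i ℕ.* s ℕ.≤? n ]· (φ s * ψ (suc i ℕ.* s))) (λ s _ → by-s s) ⟩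
    Σ< (suc n) (λ s → [ suc i ℕ.* s ℕ.≤? n ]· (φ s * ψ (suc i ℕ.* s))) ∎
    where
    f : ℕ → ℕ → Carrier
    f k s = [ k ℕ.≟ suc i ℕ.* s ]· (φ s * ψ k)
    by-k : ∀ k → k ℕ.≤ n → [ suc i ∣? k ]· (φ (k ℕ./ suc i)) * ψ k ≈ Σ< (suc n) (f k)
    by-k k k≤n = case suc i ∣? k of λ where
      (yes d@(divides q k≡q*i)) →
        let k≡i*q = ≡.trans k≡q*i (ℕ.*-comm q (suc i))
            q≡ = ≡.trans (cong (ℕ._/ suc i) k≡q*i) (ℕ.m*n/n≡m q (suc i))
            q≤n = ℕ.≤-trans (subst (q ℕ.≤_) (≡.sym k≡i*q) (ℕ.m≤n*m q (suc i))) k≤n in begin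
        [ suc i ∣? k ]· (φ (k ℕ./ suc i)) * ψ k ≈⟨ *-congʳ ([-]·-yes (suc i ∣? k) _ d) ⟩
        φ (k ℕ./ suc i) * ψ k ≡⟨ cong (λ q → φ q * ψ k) q≡ ⟩
        φ q * ψ k ≈⟨ [-]·-yes (k ℕ.≟ suc i ℕ.* q) _ k≡i*q ⟨
        f k q ≈⟨ Σ<-delta (suc n) (f k) q (s≤s q≤n) (λ s s≢q → [-]·-no (k ℕ.≟ suc i ℕ.* s) _
                   λ k≡i*s → s≢q (ℕ.*-cancelˡ-≡ s q (suc i) (≡.trans (≡.sym k≡i*s) k≡i*q))) ⟨
        Σ< (suc n) (f k) ∎
      (no ∤k) → trans (trans (*-congʳ ([-]·-no (suc i ∣? k) _ ∤k)) (zeroˡ _))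
        (sym (Σ<-zero (suc n) (f k) λ s _ → [-]·-no (k ℕ.≟ suc i ℕ.* s) _ λ k≡i*s → ∤k (divides s (≡.trans k≡i*s (ℕ.*-comm (suc i) s)))))
    by-s : ∀ s → Σ< (suc n) (λ k → f k s) ≈ [ suc i ℕ.* s ℕ.≤? n ]· (φ s * ψ (suc i ℕ.* s))
    by-s s = case suc i ℕ.* s ℕ.≤? n of λ where
      (yes is≤n) → begin
        Σ< (suc n) (λ k → f k s) ≈⟨ Σ<-delta (suc n) (λ k → f k s) (suc i ℕ.* s) (s≤s is≤n) (λ k k≢ → [-]·-no (k ℕ.≟ suc i ℕ.* s) _ k≢) ⟩
        f (suc i ℕ.* s) s ≈⟨ [-]·-yes (suc i ℕ.* s ℕ.≟ suc i ℕ.* s) _ refl ⟩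
        φ s * ψ (suc i ℕ.* s) ≈⟨ [-]·-yes (suc i ℕ.* s ℕ.≤? n) _ is≤n ⟨
        [ suc i ℕ.* s ℕ.≤? n ]· (φ s * ψ (suc i ℕ.* s)) ∎
      (no is≰n) → trans
        (Σ<-zero (suc n) (λ k → f k s) λ k k<sn → [-]·-no (k ℕ.≟ suc i ℕ.* s) _ λ k≡ → is≰n (subst (ℕ._≤ n) k≡ (ℕ.s≤s⁻¹ k<sn)))
        (sym ([-]·-no (suc i ℕ.* s ℕ.≤? n) _ is≰n))

-- The differential equation of H, and H = exp(G) D

module CycleIndex (K : CommutativeRing 0ℓ 0ℓ) (η : ℚ → CommutativeRing.Carrier K)
  (η-0 : CommutativeRing._≈_ K (η 0ℚ) (CommutativeRing.0# K))
  (η-1 : CommutativeRing._≈_ K (η 1ℚ) (CommutativeRing.1# K))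
  (η-+ : ∀ a b → CommutativeRing._≈_ K (η (a ℚ.+ b)) (CommutativeRing._+_ K (η a) (η b)))
  (η-* : ∀ a b → CommutativeRing._≈_ K (η (a ℚ.* b)) (CommutativeRing._*_ K (η a) (η b)))
  (u : CommutativeRing.Carrier K) where

  open CommutativeRing K hiding (refl; zero)
  open ℚ-Algebra K η η-0 η-1 η-+ η-* public
  open Normalised K u inverse ι-inverse public
  open Dilation K
  open PowerSeries (Semiring.rawSemiring (CommutativeRing.semiring K)) η using (Series; monomial; _*ˢ_; _≈ˢ_; exp)
  open import Algebra.Solver.Ring.NaturalCoefficients.Default commutativeSemiring using (solve; _:=_; _:+_; _:*_; con)
  open import Relation.Binary.Reasoning.Setoid setoid

  H : Series
  H n = ∑ (forests n) P

  G : Series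
  G n = ∑ (polyaTrees n) Pᵗ

  G-zero : G 0 ≈ 0#
  G-zero = ∑-[]

  G-suc : ∀ n → G (suc n) ≈ u * H n
  G-suc n = trans
    (∑-bijection (polyaTrees-enum (suc n)) (forests-enum n) (λ {T} {U} → ≅ᵗ-sym T U) ≅ᶠ-sym
      (λ T F → T ≅ᵗ node F)
      (λ {T} {T′} {F} e r → ≅ᵗ-trans T′ T (node F) (≅ᵗ-sym T T′ e) r)
      (λ {T} {F} {F′} e r → ≅ᵗ-trans T (node F) (node F′) r (node-≅ F F′ e))
      (λ { {node F} eq → F , ℕ.suc-injective eq , ≅ᵗ-refl (node F) })
      (λ {F} eq → node F , cong suc eq , ≅ᵗ-refl (node F))
      (λ {T} {F} {F′} _ r r′ → node-≅⁻ F F′ (≅ᵗ-trans (node F) T (node F′) (≅ᵗ-sym T (node F) r) r′))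
      (λ {T} {T′} {F} _ r r′ → ≅ᵗ-trans T (node F) T′ r (≅ᵗ-sym T′ (node F) r′))
      Pᵗ (λ F → u * P F) (λ {T} {F} _ _ r → trans (Pᵗ-cong T (node F) r) (P-node F)))
    (sym (∑-*ˡ (forests n) u P))

  H-zero : H 0 ≈ 1#
  H-zero = begin
    H 0                              ≈⟨ ∑-∷ [] [] ⟩
    P [] + ∑ [] P                    ≈⟨ +-congˡ ∑-[] ⟩
    P [] + 0#                        ≈⟨ +-identityʳ _ ⟩
    recip-Aut (parentᶠ []) * Zᶠ []   ≈⟨ *-comm _ _ ⟩
    Zᶠ [] * recip-Aut (parentᶠ [])   ≈⟨ card-recip (parentᶠ []) ⟩
    1#                               ∎

  Σ∑-swap : ∀ {A : Set} m (xs : List A) (f : ℕ → A → Carrier) → Σ< m (λ i → ∑ xs (f i)) ≈ ∑ xs (λ x → Σ< m (λ i → f i x))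
  Σ∑-swap m xs f = sym (∑-sum {n = m} xs (λ x i → f (toℕ i) x))

  -- Every component `U` of the forest contributes its size at exactly one place of the double sum:
  -- where s is the size of `U` and T is the listed tree isomorphic to it.
  ι-size : ∀ n F → ∣ F ∣ᶠ ℕ.≤ n → ι ∣ F ∣ᶠ ≈ Σ< (suc n) (λ s → ∑ (polyaTrees s) (λ T → ι s * ι (multiplicity T F)))
  ι-size n [] _ = sym (Σ<-zero (suc n) (λ s → ∑ (polyaTrees s) (λ T → ι s * ι 0)) λ s _ → ∑-zero (polyaTrees s) λ _ → zeroʳ _)
  ι-size n (U ∷ F) size≤n = begin
    ι (∣ U ∣ᵗ ℕ.+ ∣ F ∣ᶠ) ≈⟨ ×-homo-+ 1# ∣ U ∣ᵗ ∣ F ∣ᶠ ⟩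
    ι ∣ U ∣ᵗ + ι ∣ F ∣ᶠ ≈⟨ +-cong (sym head) (ι-size n F (ℕ.≤-trans (ℕ.m≤n+m _ ∣ U ∣ᵗ) size≤n)) ⟩
    Σ< (suc n) f + Σ< (suc n) g ≈⟨ Σ<-+ (suc n) f g ⟨
    Σ< (suc n) (λ s → f s + g s) ≈⟨ Σ<-cong (suc n) (λ s → f s + g s) h (λ s _ → trans (sym (∑-+ (polyaTrees s) _ _)) (∑-cong (polyaTrees s) λ {T} _ → each s T)) ⟩
    Σ< (suc n) h ∎
    where
    f g h : ℕ → Carrier
    f s = ∑ (polyaTrees s) (λ T → ι s * [ T ≅ᵗ? U ]· 1#)
    g s = ∑ (polyaTrees s) (λ T → ι s * ι (multiplicity T F))
    h s = ∑ (polyaTrees s) (λ T → ι s * ι (multiplicity T (U ∷ F)))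
    each : ∀ s T → ι s * [ T ≅ᵗ? U ]· 1# + ι s * ι (multiplicity T F) ≈ ι s * ι (multiplicity T (U ∷ F))
    each s T = trans (sym (distribˡ _ _ _)) (*-congˡ (case T ≅ᵗ? U of λ where
      (yes T≅U) → trans (+-congʳ ([-]·-yes (T ≅ᵗ? U) 1# T≅U)) (reflexive (cong ι (≡.sym (mult-yes T U F T≅U))))
      (no T≇U) → trans (+-congʳ ([-]·-no (T ≅ᵗ? U) 1# T≇U)) (trans (+-identityˡ _) (reflexive (cong ι (≡.sym (mult-no T U F T≇U)))))))
    head : Σ< (suc n) f ≈ ι ∣ U ∣ᵗ
    head = begin
      Σ< (suc n) f ≈⟨ Σ<-delta (suc n) f ∣ U ∣ᵗ (s≤s (ℕ.≤-trans (ℕ.m≤m+n _ _) size≤n)) (λ s s≢ → ∑-zero (polyaTrees s) λ {T} T∈ →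
          trans (*-congˡ ([-]·-no (T ≅ᵗ? U) 1# λ (π , _) → s≢ (≡.trans (≡.sym (Enumeration.sound (polyaTrees-enum s) T∈)) (Perm.↔⇒≡ π)))) (zeroʳ _)) ⟩
      f ∣ U ∣ᵗ ≈⟨ ∑-*ˡ (polyaTrees ∣ U ∣ᵗ) (ι ∣ U ∣ᵗ) (λ T → [ T ≅ᵗ? U ]· 1#) ⟨
      ι ∣ U ∣ᵗ * ∑ (polyaTrees ∣ U ∣ᵗ) (λ T → [ T ≅ᵗ? U ]· 1#)
        ≈⟨ *-congˡ (∑-enum-one {_≈₁_ = _≅ᵗ_} _≅ᵗ?_ (λ {T} {U} → ≅ᵗ-sym T U) (λ {T} {U} {V} → ≅ᵗ-trans T U V) (polyaTrees-enum ∣ U ∣ᵗ) {U} refl) ⟩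
      ι ∣ U ∣ᵗ * 1# ≈⟨ *-identityʳ _ ⟩
      ι ∣ U ∣ᵗ ∎

  -- Weight of a cycle of i + 1 components isomorphic to T: a longer cycle contains no fixed nodes.
  cycleWeight : ℕ → Tree → Carrier
  cycleWeight zero    T = Pᵗ T
  cycleWeight (suc i) T = 1#

  removed : ℕ → Tree → Forest → Carrier
  removed i T F = [ i ℕ.≤? multiplicity T F ]· (P (remove i T F))

  -- This is `P-copies` for `F` rearranged as copies of `T` followed by the rest. The sum is
  -- extended by zero terms to a bound that may be chosen independently of `F` and `T`, so that
  -- `θ-H` can exchange sums.
  ι-mult-P : ∀ n T F → multiplicity T F ℕ.≤ n →
    ι (multiplicity T F) * P F ≈ Σ< n (λ i → cycleWeight i T * removed (suc i) T F)
  ι-mult-P n T F m≤n = trans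
    (*-congˡ (P-cong F (remove 0 T F) (split-copies T F)))
    (trans (go (multiplicity T F) refl) (sym (Σ<-extend-≤ f m≤n λ k m≤k → trans (*-congˡ ([-]·-no (suc k ℕ.≤? multiplicity T F) _ (ℕ.≤⇒≯ m≤k))) (zeroʳ _))))
    where
    f : ℕ → Carrier
    f i = cycleWeight i T * removed (suc i) T F
    R = rest T F
    go : ∀ m → m ≡ multiplicity T F → ι m * P (replicate m T ++ R) ≈ Σ< m f
    go zero    eq = zeroˡ _
    go (suc k) eq = begin
      ι (suc k) * P (replicate (suc k) T ++ R) ≈⟨ P-copies T R (mult-rest T F) k ⟩
      Pᵗ T * P (replicate k T ++ R) + Σ< k (λ i → P (replicate (k ℕ.∸ suc i) T ++ R))
        ≈⟨ +-cong (*-congˡ (sym (at 0 (s≤s z≤n))))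
             (Σ<-cong k (λ i → P (replicate (k ℕ.∸ suc i) T ++ R)) (f ∘ suc) λ i i<k → sym (trans (*-identityˡ _) (at (suc i) (s≤s i<k)))) ⟩
      Σ< (suc k) f ∎
      where
      at : ∀ i → i ℕ.< suc k → removed (suc i) T F ≈ P (replicate (k ℕ.∸ i) T ++ R)
      at i i<sk = trans ([-]·-yes (suc i ℕ.≤? multiplicity T F) _ (subst (i ℕ.<_) eq i<sk))
        (reflexive (cong (λ m → P (replicate (m ℕ.∸ suc i) T ++ R)) (≡.sym eq)))

  -- Adding i copies of T is a bijection onto the forests containing at least i copies.
  ∑-removed : ∀ n i s T → ∣ T ∣ᵗ ≡ s → ∑ (forests n) (removed i T) ≈ [ i ℕ.* s ℕ.≤? n ]· (H (n ℕ.∸ i ℕ.* s))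
  ∑-removed n i s T refl = trans (sym (∑-filter (λ F → i ℕ.≤? multiplicity T F) (forests n) (λ F → P (remove i T F)))) (case i ℕ.* s ℕ.≤? n of λ where
    (yes is≤n) → trans
      (∑-bijection
        (enum-filter {_≈_ = _≅ᶠ_} (λ F → i ℕ.≤? multiplicity T F) (λ {F} {G} e → subst (i ℕ.≤_) (≅ᶠ⇒mult F G e T)) (forests-enum n))
        (forests-enum (n ℕ.∸ i ℕ.* s)) ≅ᶠ-sym ≅ᶠ-sym
        (λ F F′ → F ≅ᶠ replicate i T ++ F′)
        (λ e r → ≅ᶠ-trans (≅ᶠ-sym e) r) (λ e r → ≅ᶠ-trans r (≅ᶠ-++ˡ (replicate i T) e))
        (λ {F} (size , i≤m) → remove i T F , ≡.trans (≡.sym (ℕ.m+n∸m≡n (i ℕ.* s) _)) (cong (ℕ._∸ i ℕ.* s) (≡.trans (≡.sym (size-remove i T F i≤m)) size)) , remove-≅ i T F i≤m)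
        (λ {F′} size → replicate i T ++ F′ ,
          (≡.trans (size-copies i T F′) (≡.trans (cong (i ℕ.* s ℕ.+_) size) (ℕ.m+[n∸m]≡n is≤n)) ,
           subst (i ℕ.≤_) (≡.sym (mult-++ T (replicate i T) F′)) (ℕ.≤-trans (ℕ.≤-reflexive (≡.sym mult-i)) (ℕ.m≤m+n _ _))) , ≅ᶠ-refl)
        (λ {F} {F′} {F″} _ r r′ → ++-cancelˡ (replicate i T) F′ F″ (≅ᶠ-trans (≅ᶠ-sym r) r′))
        (λ _ r r′ → ≅ᶠ-trans r (≅ᶠ-sym r′))
        (λ F → P (remove i T F)) P
        (λ {F} {F′} (_ , i≤m) _ r → P-cong (remove i T F) F′ (++-cancelˡ (replicate i T) (remove i T F) F′ (≅ᶠ-trans (≅ᶠ-sym (remove-≅ i T F i≤m)) r))))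
      (sym ([-]·-yes (i ℕ.* s ℕ.≤? n) _ is≤n))
    (no is≰n) → trans
      (∑-zero (filter (λ F → i ℕ.≤? multiplicity T F) (forests n)) λ {F} F∈ →
        let F∈′ , i≤m = ∈-filter⁻ (λ F → i ℕ.≤? multiplicity T F) {xs = forests n} F∈ in
        ⊥-elim (is≰n (subst (i ℕ.* s ℕ.≤_) (≡.trans (≡.sym (size-remove i T F i≤m)) (Enumeration.sound (forests-enum n) F∈′)) (ℕ.m≤m+n _ _))))
      (sym ([-]·-no (i ℕ.* s ℕ.≤? n) _ is≰n)))
    where
    mult-i : multiplicity T (replicate i T) ≡ i
    mult-i = ≡.trans (cong (multiplicity T) (≡.sym (List.++-identityʳ (replicate i T)))) (mult-replicate T i [] refl)

  cycleTotal : ℕ → ℕ → Carrier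
  cycleTotal i s = ∑ (polyaTrees s) (λ T → ι s * cycleWeight i T)

  -- The coefficient of zⁿ in z H′ counts forests with a marked node, here classified by the
  -- component of the mark and the length of the cycle of components through it.
  θ-H : ∀ n → θ H n ≈ Σ< (suc (suc n)) (λ i → Σ< (suc n) (λ s → [ suc i ℕ.* s ℕ.≤? n ]· (cycleTotal i s * H (n ℕ.∸ suc i ℕ.* s))))
  θ-H n = begin
    ι n * ∑ (forests n) P ≈⟨ ∑-*ˡ (forests n) (ι n) P ⟩
    ∑ (forests n) (λ F → ι n * P F) ≈⟨ ∑-cong (forests n) (λ {F} F∈ → expand F (Enumeration.sound (forests-enum n) F∈)) ⟩
    ∑ (forests n) (λ F → Σ< (suc n) (λ s → ∑ (polyaTrees s) (λ T → Σ< N (λ i → t i s T * removed (suc i) T F))))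
      ≈⟨ Σ∑-swap (suc n) (forests n) (λ s F → ∑ (polyaTrees s) (λ T → Σ< N (λ i → t i s T * removed (suc i) T F))) ⟨
    Σ< (suc n) (λ s → ∑ (forests n) (λ F → ∑ (polyaTrees s) (λ T → Σ< N (λ i → t i s T * removed (suc i) T F))))
      ≈⟨ Σ<-cong (suc n) (λ s → ∑ (forests n) (λ F → ∑ (polyaTrees s) (λ T → Σ< N (λ i → t i s T * removed (suc i) T F)))) (λ s → Σ< N (λ i → b i s)) (λ s _ → inner s) ⟩
    Σ< (suc n) (λ s → Σ< N (λ i → b i s)) ≈⟨ Σ<-swap (suc n) N (λ s i → b i s) ⟩
    Σ< N (λ i → Σ< (suc n) (b i)) ∎
    where
    -- Multiplicities are at most n, so any bound from n on would be correct here. With n + 2 terms,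
    -- the n + 1 left after i = 0 match the n + 1 terms of `Λ-expand`.
    N = suc (suc n)
    t : ℕ → ℕ → Tree → Carrier
    t i s T = ι s * cycleWeight i T
    b : ℕ → ℕ → Carrier
    b i s = [ suc i ℕ.* s ℕ.≤? n ]· (cycleTotal i s * H (n ℕ.∸ suc i ℕ.* s))
    expand : ∀ F → ∣ F ∣ᶠ ≡ n → ι n * P F ≈ Σ< (suc n) (λ s → ∑ (polyaTrees s) (λ T → Σ< N (λ i → t i s T * removed (suc i) T F)))
    expand F refl = begin
      ι n * P F ≈⟨ *-congʳ (ι-size n F ℕ.≤-refl) ⟩
      Σ< (suc n) f * P F ≈⟨ Σ<-*ʳ (suc n) (P F) f ⟩
      Σ< (suc n) (λ s → f s * P F) ≈⟨ Σ<-cong (suc n) (λ s → f s * P F) (λ s → ∑ (polyaTrees s) (λ T → Σ< N (λ i → t i s T * removed (suc i) T F))) (λ s _ →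
        trans (∑-*ʳ (polyaTrees s) (P F) (λ T → ι s * ι (multiplicity T F))) (∑-cong (polyaTrees s) λ {T} _ → begin
          ι s * ι (multiplicity T F) * P F ≈⟨ *-assoc _ _ _ ⟩
          ι s * (ι (multiplicity T F) * P F) ≈⟨ *-congˡ (ι-mult-P N T F (ℕ.≤-trans (mult≤size T F) (ℕ.≤-trans (ℕ.n≤1+n n) (ℕ.n≤1+n (suc n))))) ⟩
          ι s * Σ< N (λ i → cycleWeight i T * removed (suc i) T F) ≈⟨ Σ<-*ˡ N (ι s) (λ i → cycleWeight i T * removed (suc i) T F) ⟩
          Σ< N (λ i → ι s * (cycleWeight i T * removed (suc i) T F))
            ≈⟨ Σ<-cong N (λ i → ι s * (cycleWeight i T * removed (suc i) T F)) (λ i → t i s T * removed (suc i) T F) (λ _ _ → sym (*-assoc _ _ _)) ⟩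
          Σ< N (λ i → t i s T * removed (suc i) T F) ∎)) ⟩
      Σ< (suc n) (λ s → ∑ (polyaTrees s) (λ T → Σ< N (λ i → t i s T * removed (suc i) T F))) ∎
      where
      f : ℕ → Carrier
      f s = ∑ (polyaTrees s) (λ T → ι s * ι (multiplicity T F))
    inner : ∀ s → ∑ (forests n) (λ F → ∑ (polyaTrees s) (λ T → Σ< N (λ i → t i s T * removed (suc i) T F))) ≈ Σ< N (λ i → b i s)
    inner s = begin
      ∑ (forests n) (λ F → ∑ (polyaTrees s) (λ T → Σ< N (λ i → t i s T * removed (suc i) T F)))
        ≈⟨ ∑-swap (forests n) (polyaTrees s) (λ F T → Σ< N (λ i → t i s T * removed (suc i) T F)) ⟩
      ∑ (polyaTrees s) (λ T → ∑ (forests n) (λ F → Σ< N (λ i → t i s T * removed (suc i) T F)))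
        ≈⟨ ∑-cong (polyaTrees s) (λ {T} T∈ → begin
          ∑ (forests n) (λ F → Σ< N (λ i → t i s T * removed (suc i) T F)) ≈⟨ Σ∑-swap N (forests n) (λ i F → t i s T * removed (suc i) T F) ⟨
          Σ< N (λ i → ∑ (forests n) (λ F → t i s T * removed (suc i) T F))
            ≈⟨ Σ<-cong N (λ i → ∑ (forests n) (λ F → t i s T * removed (suc i) T F)) (λ i → t i s T * h i s) (λ i _ →
                trans (sym (∑-*ˡ (forests n) (t i s T) (removed (suc i) T))) (*-congˡ (∑-removed n (suc i) s T (Enumeration.sound (polyaTrees-enum s) T∈)))) ⟩
          Σ< N (λ i → t i s T * h i s) ∎) ⟩
      ∑ (polyaTrees s) (λ T → Σ< N (λ i → t i s T * h i s)) ≈⟨ Σ∑-swap N (polyaTrees s) (λ i T → t i s T * h i s) ⟨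
      Σ< N (λ i → ∑ (polyaTrees s) (λ T → t i s T * h i s))
        ≈⟨ Σ<-cong N (λ i → ∑ (polyaTrees s) (λ T → t i s T * h i s)) (λ i → b i s) (λ i _ →
             trans (sym (∑-*ʳ (polyaTrees s) (h i s) (t i s))) (pull (suc i ℕ.* s ℕ.≤? n) _ _)) ⟩
      Σ< N (λ i → b i s) ∎
      where
      h : ℕ → ℕ → Carrier
      h i s = [ suc i ℕ.* s ℕ.≤? n ]· (H (n ℕ.∸ suc i ℕ.* s))
      pull : ∀ {Q : Set} (d : Dec Q) x y → x * [ d ]· y ≈ [ d ]· (x * y)
      pull (yes _) x y = CommutativeRing.refl K
      pull (no _)  x y = zeroʳ x

  treeCount : ℕ → Carrier
  treeCount s = ι s * ι (length (polyaTrees s))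

  -- L = Σ_{i≥2} T(zⁱ)/i, so that D = exp L, and Λ = z L′.
  L : ℚ⟦z⟧.Series
  L = ℚ⟦z⟧.∑∞ (λ j → (+ 1 / suc (suc j)) ℚ⟦z⟧.· (T[z] ℚ⟦z⟧.⟨z^ suc (suc j) ⟩))

  Λ : Series
  Λ = η ∘ ℚˢ.θ L

  η-T : ∀ s → η (T[z] s) ≈ ι (length (polyaTrees s))
  η-T s = trans (reflexive (cong η (≡.sym (ι-/1 (length (polyaTrees s)))))) (η-ι (length (polyaTrees s)))

  η-indicator : ∀ {Q : Set} (d : Dec Q) i x t → η (ℚΣ.ι i ℚ.* (x ℚ.* (if does d then t else 0ℚ))) ≈ [ d ]· (ι i * (η x * η t))
  η-indicator (yes _) i x t = trans (η-* (ℚΣ.ι i) (x ℚ.* t)) (*-cong (η-ι i) (η-* x t))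
  η-indicator (no _)  i x t = trans (reflexive (cong η (≡.trans (cong (ℚΣ.ι i ℚ.*_) (ℚ.*-zeroʳ x)) (ℚ.*-zeroʳ (ℚΣ.ι i))))) η-0

  -- At k = q i with i = j + 2, differentiation gives the factor k and the series the factor 1/i,
  -- together q. So T(z^i)/i contributes q t_q, which is `treeCount q`.
  Λ-term : ∀ k j → η (ℚΣ.ι k ℚ.* ((+ 1 / suc (suc j)) ℚ.* (T[z] ℚ⟦z⟧.⟨z^ suc (suc j) ⟩) k)) ≈ [ suc (suc j) ∣? k ]· (treeCount (k ℕ./ suc (suc j)))
  Λ-term k j = trans (η-indicator (suc (suc j) ∣? k) k (1/ (suc (suc j))) (T[z] q)) ([-]·-cong (suc (suc j) ∣? k) λ d → begin
    ι k * (η x * η (T[z] q)) ≡⟨ cong (λ k → ι k * (η x * η (T[z] q))) (ℕ.m/n*n≡m d) ⟨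
    ι (q ℕ.* suc (suc j)) * (η x * η (T[z] q)) ≈⟨ *-cong (×1-homo-* q (suc (suc j))) (*-congˡ (η-T q)) ⟩
    ι q * ι (suc (suc j)) * (η x * ι t) ≈⟨ solve 4 (λ q j x t → q :* j :* (x :* t) := j :* x :* (q :* t)) (CommutativeRing.refl K) (ι q) (ι (suc (suc j))) (η x) (ι t) ⟩
    ι (suc (suc j)) * η x * (ι q * ι t) ≈⟨ *-congʳ (ι-inverse (suc j)) ⟩
    1# * (ι q * ι t) ≈⟨ *-identityˡ _ ⟩
    ι q * ι t ∎)
    where
    q = k ℕ./ suc (suc j)
    t = length (polyaTrees q)
    x = 1/ (suc (suc j))

  Λ-expand : ∀ n k → k ℕ.≤ n → Λ k ≈ Σ< (suc n) (λ j → [ suc (suc j) ∣? k ]· (treeCount (k ℕ./ suc (suc j))))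
  Λ-expand n k k≤n = begin
    η (ℚΣ.ι k ℚ.* ℚΣ.Σ< (suc k) l) ≡⟨ cong η (ℚΣ.Σ<-*ˡ (suc k) (ℚΣ.ι k) l) ⟩
    η (ℚΣ.Σ< (suc k) (λ j → ℚΣ.ι k ℚ.* l j)) ≈⟨ η-Σ< (suc k) (λ j → ℚΣ.ι k ℚ.* l j) ⟩
    Σ< (suc k) (λ j → η (ℚΣ.ι k ℚ.* l j)) ≈⟨ Σ<-cong (suc k) (λ j → η (ℚΣ.ι k ℚ.* l j)) f (λ j _ → Λ-term k j) ⟩
    Σ< (suc k) f ≈⟨ Σ<-extend-≤ f (s≤s k≤n) vanish ⟨
    Σ< (suc n) f ∎
    where
    l : ℕ → ℚ
    l j = (+ 1 / suc (suc j)) ℚ.* (T[z] ℚ⟦z⟧.⟨z^ suc (suc j) ⟩) k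
    f : ℕ → Carrier
    f j = [ suc (suc j) ∣? k ]· (treeCount (k ℕ./ suc (suc j)))
    treeCount-0 : ∀ s → s ≡ 0 → treeCount s ≈ 0#
    treeCount-0 s refl = zeroˡ _
    vanish : ∀ j → suc k ℕ.≤ j → f j ≈ 0#
    vanish j k<j = case suc (suc j) ∣? k of λ where
      -- Since j + 2 exceeds k, the quotient is 0 and `treeCount` vanishes there. This settles k =
      -- 0, which every number divides.
      (yes d) → trans ([-]·-yes (suc (suc j) ∣? k) _ d) (treeCount-0 _ (ℕ.m<n⇒m/n≡0 (ℕ.≤-trans k<j (ℕ.≤-trans (ℕ.n≤1+n j) (ℕ.n≤1+n (suc j))))))
      (no ∤k) → [-]·-no (suc (suc j) ∣? k) _ ∤k

  Ξ : Series
  Ξ = θ G +ˢ Λ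

  -- In `θ-H`, the terms with i = 0, components mapped to themselves, add up to θ G. For i ≥ 1 the
  -- cycle weight is 1, so what remains counts trees with sizes multiplied by i + 1, and these terms
  -- add up to Λ.
  H-ode : θ H ≈ˢ Ξ *ˢ H
  H-ode n = begin
    θ H n ≈⟨ θ-H n ⟩
    Σ< (suc n) (c 0) + Σ< (suc n) (λ j → Σ< (suc n) (c (suc j)))
      ≈⟨ +-cong (Σ<-cong (suc n) (c 0) (λ s → θ G s * H (n ℕ.∸ s)) (λ s s<sn → first s (ℕ.s≤s⁻¹ s<sn)))
                (Σ<-cong (suc n) (λ j → Σ< (suc n) (c (suc j))) (λ j → Σ< (suc n) (e j)) (λ j _ → later j)) ⟩
    (θ G *ˢ H) n + Σ< (suc n) (λ j → Σ< (suc n) (e j)) ≈⟨ +-congˡ (Σ<-swap (suc n) (suc n) e) ⟩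
    (θ G *ˢ H) n + Σ< (suc n) (λ k → Σ< (suc n) (λ j → e j k))
      ≈⟨ +-congˡ (Σ<-cong (suc n) (λ k → Σ< (suc n) (λ j → e j k)) (λ k → Λ k * H (n ℕ.∸ k)) (λ k k<sn →
           trans (sym (Σ<-*ʳ (suc n) (H (n ℕ.∸ k)) (λ j → [ suc (suc j) ∣? k ]· (treeCount (k ℕ./ suc (suc j))))))
                 (*-congʳ (sym (Λ-expand n k (ℕ.s≤s⁻¹ k<sn)))))) ⟩
    (θ G *ˢ H) n + (Λ *ˢ H) n ≈⟨ *ˢ-distribʳ (θ G) Λ H n ⟨
    (Ξ *ˢ H) n ∎
    where
    c : ℕ → ℕ → Carrier
    c i s = [ suc i ℕ.* s ℕ.≤? n ]· (cycleTotal i s * H (n ℕ.∸ suc i ℕ.* s))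
    e : ℕ → ℕ → Carrier
    e j k = [ suc (suc j) ∣? k ]· (treeCount (k ℕ./ suc (suc j))) * H (n ℕ.∸ k)
    first : ∀ s → s ℕ.≤ n → c 0 s ≈ θ G s * H (n ℕ.∸ s)
    first s s≤n = trans ([-]·-yes (1 ℕ.* s ℕ.≤? n) _ (subst (ℕ._≤ n) (≡.sym (ℕ.*-identityˡ s)) s≤n))
      (*-cong (sym (∑-*ˡ (polyaTrees s) (ι s) Pᵗ)) (reflexive (cong (λ s → H (n ℕ.∸ s)) (ℕ.*-identityˡ s))))
    later : ∀ j → Σ< (suc n) (c (suc j)) ≈ Σ< (suc n) (e j)
    later j = trans
      (Σ<-cong (suc n) (c (suc j)) (λ s → [ suc (suc j) ℕ.* s ℕ.≤? n ]· (treeCount s * H (n ℕ.∸ suc (suc j) ℕ.* s))) (λ s _ →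
        [-]·-cong (suc (suc j) ℕ.* s ℕ.≤? n) λ _ → *-congʳ (trans (sym (∑-*ˡ (polyaTrees s) (ι s) (const 1#))) (*-congˡ (∑-const (polyaTrees s) 1#)))))
      (sym (Σ<-dilate (suc j) n treeCount (λ k → H (n ℕ.∸ k))))

  Λ-zero : Λ 0 ≈ 0#
  Λ-zero = trans (reflexive (cong η (ℚ.*-zeroˡ (L 0)))) η-0

  D̂ : Series
  D̂ = η ∘ D[z]

  D̂-zero : D̂ 0 ≈ 1#
  D̂-zero = trans (reflexive (cong η (ℚˢ.exp-zero refl ι-1/! L))) η-1

  D̂-ode : θ D̂ ≈ˢ Λ *ˢ D̂
  D̂-ode n = begin
    ι n * η (D[z] n) ≈⟨ η-ι* n (D[z] n) (ℚˢ.θ D[z] n) refl ⟩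
    η (ℚˢ.θ D[z] n) ≡⟨ cong η (ℚˢ.θ-exp refl ι-1/! L refl n) ⟩
    η (ℚ⟦z⟧._*ˢ_ D[z] (ℚˢ.θ L) n) ≈⟨ η-*ˢ D[z] (ℚˢ.θ L) n ⟩
    (D̂ *ˢ Λ) n ≈⟨ *ˢ-comm D̂ Λ n ⟩
    (Λ *ˢ D̂) n ∎

  H≈exp : H ≈ˢ exp G *ˢ D̂
  H≈exp = exp-product G Λ D̂ H G-zero Λ-zero D̂-zero H-zero D̂-ode H-ode

  G-solution : Solution u D̂ G
  G-solution = solution-intro u D̂ G G-zero λ n → trans (G-suc n) (*-congˡ (H≈exp n))

-- The coefficients of D as proportions of derangements

module _ {F G : Forest} (F≅G : F ≅ᶠ G) where

  Repeated-resp : Repeated F → Repeated G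
  Repeated-resp rep = All.tabulate λ {U} U∈ →
    let m≡ = ≅ᶠ⇒mult F G F≅G U
        V , V∈ , U≅V = mult-positive U F (mult≢0 U U G U∈ (≅ᵗ-refl U) ∘ ≡.trans (≡.sym m≡))
    in subst (2 ℕ.≤_) (≡.trans (≡.sym (mult-cong U V U≅V F)) m≡) (All.lookup rep V∈)

unrepeated : ∀ F → ¬ Repeated F → ∃ λ T → multiplicity T F ≡ 1
unrepeated F ¬rep = let T , T∈ , ¬2≤ = find (All.¬All⇒Any¬ (λ T → 2 ℕ.≤? multiplicity T F) F ¬rep) in
  T , ℕ.≤-antisym (ℕ.s≤s⁻¹ (ℕ.≰⇒> ¬2≤)) (ℕ.n≢0⇒n>0 (mult≢0 T T F T∈ (≅ᵗ-refl T)))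

module Derangements where

  open CycleIndex ℚ-ring id refl refl (λ _ _ → refl) (λ _ _ → refl) 0ℚ
  open ≡.≡-Reasoning

  -- As 0^0 = 1, the weight of an automorphism at u = 0 is the indicator of having no fixed node.
  0^ : ∀ k → 0ℚ ^ k ≡ [ k ℕ.≟ 0 ]· 1ℚ
  0^ zero    = refl
  0^ (suc k) = ℚ.*-zeroˡ (0ℚ ^ k)

  P≡derangementProportion : ∀ F → P F ≡ derangementProportion (parentᶠ F)
  P≡derangementProportion F = begin
    1/ ∣Aut p ∣ ℚ.* ∑ (automorphisms p) (λ σ → 0ℚ ^ fixedIn (const true) σ)
      ≡⟨ cong (1/ ∣Aut p ∣ ℚ.*_) (∑-cong (automorphisms p) λ {σ} _ → ≡.trans (cong (0ℚ ^_) (≡.sym (fixedPoints≡fixedIn σ))) (0^ (fixedPoints σ))) ⟩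
    1/ ∣Aut p ∣ ℚ.* ∑ (automorphisms p) (λ σ → [ fixedPoints σ ℕ.≟ 0 ]· 1ℚ)
      ≡⟨ cong (1/ ∣Aut p ∣ ℚ.*_) (∑-filter (λ σ → fixedPoints σ ℕ.≟ 0) (automorphisms p) (const 1ℚ)) ⟨
    1/ ∣Aut p ∣ ℚ.* ∑ derangements (const 1ℚ) ≡⟨ cong (1/ ∣Aut p ∣ ℚ.*_) (∑-const derangements 1ℚ) ⟩
    1/ ∣Aut p ∣ ℚ.* ι (length derangements) ≡⟨ /≡ (length derangements) ∣Aut p ∣ {{∣Aut∣≢0 p}} ⟨
    derangementProportion p ∎
    where
    p = parentᶠ F
    derangements = filter (λ σ → fixedPoints σ ℕ.≟ 0) (automorphisms p)

  Pᵗ≡0 : ∀ T → Pᵗ T ≡ 0ℚ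
  Pᵗ≡0 (node F) = ≡.trans (P-node F) (ℚ.*-zeroˡ (P F))

  -- The root of a tree occurring once is fixed by every automorphism.
  P-unrepeated : ∀ F → ¬ Repeated F → P F ≡ 0ℚ
  P-unrepeated F ¬rep = let T , m≡1 = unrepeated F ¬rep ; R = rest T F in begin
    P F                                   ≡⟨ P-cong F (remove 0 T F) (split-copies T F) ⟩
    P (replicate (multiplicity T F) T ++ R) ≡⟨ cong (λ m → P (replicate m T ++ R)) m≡1 ⟩
    P (T ∷ R)                             ≡⟨ ℚ.*-identityˡ _ ⟨
    ι 1 ℚ.* P (T ∷ R)                     ≡⟨ P-copies T R (mult-rest T F) 0 ⟩
    Pᵗ T ℚ.* P R ℚ.+ 0ℚ                   ≡⟨ ℚ.+-identityʳ _ ⟩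
    Pᵗ T ℚ.* P R                          ≡⟨ cong (ℚ._* P R) (Pᵗ≡0 T) ⟩
    0ℚ ℚ.* P R                            ≡⟨ ℚ.*-zeroˡ (P R) ⟩
    0ℚ                                    ∎

  G≡0 : ∀ n → G n ≡ 0ℚ
  G≡0 n = ∑-zero (polyaTrees n) λ {T} _ → Pᵗ≡0 T

  -- At u = 0 the series G vanishes, so H and D solve the same equation θ X = Λ X with the same
  -- constant term. This bypasses the evaluation of exp at 0.
  H≡D : ∀ n → H n ≡ D[z] n
  H≡D = ode-unique (inverse ∘ suc) ι-inverse Λ H D̂ Λ-zero (≡.trans H-zero (≡.sym D̂-zero))
    (λ n → ≡.trans (H-ode n) (*ˢ-cong {Ξ} {Λ} {H} {H} (λ k → ≡.trans (cong (λ x → ι k ℚ.* x ℚ.+ Λ k) (G≡0 k)) (≡.trans (cong (ℚ._+ Λ k) (ℚ.*-zeroʳ (ι k))) (ℚ.+-identityˡ (Λ k)))) (λ _ → refl) n))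
    D̂-ode

  D-derangements : ∀ n → D[z] n ≡ ℚ⟦z⟧.∑ (MSET≥2 n) (λ F → derangementProportion (parentᶠ F))
  D-derangements n = begin
    D[z] n                ≡⟨ H≡D n ⟨
    ∑ (forests n) P       ≡⟨ ∑-partition repeated? (forests n) P ⟩
    ∑ (filter repeated? (forests n)) P ℚ.+ ∑ (filter (¬? ∘ repeated?) (forests n)) P
      ≡⟨ cong₂ ℚ._+_
          (∑-enumeration {_≈₁_ = _≅ᶠ_} ≅ᶠ-sym ≅ᶠ-trans ≅ᶠ-refl (enum-filter {_≈_ = _≅ᶠ_} repeated? (λ e → Repeated-resp e) (forests-enum n)) (MSET≥2-enum n)
            id id P (λ {F} {G} _ _ e → P-cong F G e))
          (∑-zero (filter (¬? ∘ repeated?) (forests n)) λ {F} F∈ → P-unrepeated F (proj₂ (∈-filter⁻ (¬? ∘ repeated?) {xs = forests n} F∈))) ⟩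
    ∑ (MSET≥2 n) P ℚ.+ 0ℚ ≡⟨ ℚ.+-identityʳ _ ⟩
    ∑ (MSET≥2 n) P        ≡⟨ ∑-cong (MSET≥2 n) (λ {F} _ → P≡derangementProportion F) ⟩
    ∑ (MSET≥2 n) (λ F → derangementProportion (parentᶠ F)) ≡⟨ ∑-lookup (MSET≥2 n) (λ F → derangementProportion (parentᶠ F)) ⟩
    ℚ⟦z⟧.∑ (MSET≥2 n) (λ F → derangementProportion (parentᶠ F)) ∎

-- The polynomials of C-trees

module CTrees where

  open CycleIndex Poly-ring constᵖ constᵖ-0 (λ _ → refl) constᵖ-+ constᵖ-* u
  private module R = CommutativeRing Poly-ring

  treePolynomial≈Pᵗ : ∀ T → treePolynomial T ≈ᵖ Pᵗ T
  treePolynomial≈Pᵗ T = R.*-cong {constᵖ (1/n)} {constᵖ (1/ ∣Aut p ∣)} {ℚ[u]⟦z⟧.∑ (automorphisms p) (λ σ → u ^ᵖ fixedPoints σ)} {Zᵗ T}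
    (R.reflexive (cong constᵖ (1/≡ ∣Aut p ∣ {{∣Aut∣≢0 p}})))
    (R.trans {ℚ[u]⟦z⟧.∑ (automorphisms p) (λ σ → u ^ᵖ fixedPoints σ)} {∑ (automorphisms p) (λ σ → u ^ᵖ fixedPoints σ)} {Zᵗ T} (R.reflexive (≡.sym (∑-lookup (automorphisms p) (λ σ → u ^ᵖ fixedPoints σ))))
      (∑-cong (automorphisms p) {λ σ → u ^ᵖ fixedPoints σ} {weight (const true)} λ {σ} _ → R.reflexive (cong (u ^ᵖ_) (fixedPoints≡fixedIn σ))))
    where
    p = parentᵗ T
    1/n : ℚ
    1/n = (+ 1 / ∣Aut p ∣) {{∣Aut∣≢0 p}}

  G≈∑ : ∀ n → G n ≈ᵖ ℚ[u]⟦z⟧.∑ (polyaTrees n) treePolynomial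
  G≈∑ n = R.trans {G n} {∑ (polyaTrees n) treePolynomial} {ℚ[u]⟦z⟧.∑ (polyaTrees n) treePolynomial}
    (∑-cong (polyaTrees n) {Pᵗ} {treePolynomial} λ {T} _ → R.sym {treePolynomial T} {Pᵗ T} (treePolynomial≈Pᵗ T))
    (R.reflexive (∑-lookup (polyaTrees n) treePolynomial))

  unique-solution : ∃! ℚ[u]⟦z⟧._≈ˢ_ IsCTreeSeries
  unique-solution = G , G-solution , λ {Tc} sol → solution-unique u D̂ G Tc G-solution sol

  coefficients : ∀ Tc → IsCTreeSeries Tc → ∀ n → Tc n ≈ᵖ ℚ[u]⟦z⟧.∑ (polyaTrees n) treePolynomial
  coefficients Tc sol n = R.trans {Tc n} {G n} {ℚ[u]⟦z⟧.∑ (polyaTrees n) treePolynomial}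
    (solution-unique u D̂ Tc G sol G-solution n) (G≈∑ n)

-- The derivative at u = 1

module Pointings where

  open Counting ℚ-ring 1ℚ
  open Burnside ℚ-ring
  open import Algebra.Solver.Ring.NaturalCoefficients.Default (CommutativeRing.commutativeSemiring ℚ-ring) using (solve; _:=_; _:+_; _:*_; con)
  open ≡.≡-Reasoning

  ev : Poly → ℚ
  ev p = eval p 1ℚ

  -- Only the values at 1 of a polynomial and of its derivative are tracked. On these pairs the
  -- Leibniz rule is a numerical identity, so the derivative of a product is never compared as a
  -- polynomial.
  d : Poly → ℚ
  d p = eval (p ′) 1ℚ

  ev-∷ : ∀ a p → ev (a ∷ p) ≡ a ℚ.+ ev p
  ev-∷ a p = cong (λ x → a ℚ.+ x) (ℚ.*-identityˡ (ev p))

  ev-+ : ∀ p q → ev (p +ᵖ q) ≡ ev p ℚ.+ ev q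
  ev-+ []      q       = ≡.sym (ℚ.+-identityˡ _)
  ev-+ (a ∷ p) []      = ≡.sym (ℚ.+-identityʳ _)
  ev-+ (a ∷ p) (b ∷ q) = begin
    ev ((a ℚ.+ b) ∷ (p +ᵖ q))                ≡⟨ ev-∷ (a ℚ.+ b) (p +ᵖ q) ⟩
    a ℚ.+ b ℚ.+ ev (p +ᵖ q)                  ≡⟨ cong (λ x → a ℚ.+ b ℚ.+ x) (ev-+ p q) ⟩
    a ℚ.+ b ℚ.+ (ev p ℚ.+ ev q)              ≡⟨ solve 4 (λ a b p q → a :+ b :+ (p :+ q) := a :+ p :+ (b :+ q)) refl a b (ev p) (ev q) ⟩
    a ℚ.+ ev p ℚ.+ (b ℚ.+ ev q)              ≡⟨ cong₂ ℚ._+_ (ev-∷ a p) (ev-∷ b q) ⟨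
    ev (a ∷ p) ℚ.+ ev (b ∷ q)                ∎

  ev-map : ∀ a p → ev (List.map (a ℚ.*_) p) ≡ a ℚ.* ev p
  ev-map a []      = ≡.sym (ℚ.*-zeroʳ a)
  ev-map a (b ∷ p) = begin
    ev (a ℚ.* b ∷ List.map (a ℚ.*_) p)        ≡⟨ ev-∷ (a ℚ.* b) (List.map (a ℚ.*_) p) ⟩
    a ℚ.* b ℚ.+ ev (List.map (a ℚ.*_) p)      ≡⟨ cong (λ x → a ℚ.* b ℚ.+ x) (ev-map a p) ⟩
    a ℚ.* b ℚ.+ a ℚ.* ev p                    ≡⟨ ℚ.*-distribˡ-+ a b (ev p) ⟨
    a ℚ.* (b ℚ.+ ev p)                        ≡⟨ cong (a ℚ.*_) (ev-∷ b p) ⟨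
    a ℚ.* ev (b ∷ p)                          ∎

  ev-* : ∀ p q → ev (p *ᵖ q) ≡ ev p ℚ.* ev q
  ev-* []      q = ≡.sym (ℚ.*-zeroˡ (ev q))
  ev-* (a ∷ p) q = begin
    ev (List.map (a ℚ.*_) q +ᵖ (0ℚ ∷ p *ᵖ q)) ≡⟨ ev-+ (List.map (a ℚ.*_) q) (0ℚ ∷ p *ᵖ q) ⟩
    ev (List.map (a ℚ.*_) q) ℚ.+ ev (0ℚ ∷ p *ᵖ q) ≡⟨ cong₂ ℚ._+_ (ev-map a q) (≡.trans (ev-∷ 0ℚ (p *ᵖ q)) (≡.trans (ℚ.+-identityˡ _) (ev-* p q))) ⟩
    a ℚ.* ev q ℚ.+ ev p ℚ.* ev q              ≡⟨ ℚ.*-distribʳ-+ (ev q) a (ev p) ⟨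
    (a ℚ.+ ev p) ℚ.* ev q                     ≡⟨ cong (ℚ._* ev q) (ev-∷ a p) ⟨
    ev (a ∷ p) ℚ.* ev q                       ∎

  d-∷ : ∀ a p → d (a ∷ p) ≡ ev p ℚ.+ d p
  d-∷ a p = ≡.trans (ev-+ p (0ℚ ∷ p ′)) (cong (λ x → ev p ℚ.+ x) (≡.trans (ev-∷ 0ℚ (p ′)) (ℚ.+-identityˡ _)))

  d-+ : ∀ p q → d (p +ᵖ q) ≡ d p ℚ.+ d q
  d-+ []      q       = ≡.sym (ℚ.+-identityˡ _)
  d-+ (a ∷ p) []      = ≡.sym (ℚ.+-identityʳ _)
  d-+ (a ∷ p) (b ∷ q) = begin
    d ((a ℚ.+ b) ∷ (p +ᵖ q))                     ≡⟨ d-∷ (a ℚ.+ b) (p +ᵖ q) ⟩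
    ev (p +ᵖ q) ℚ.+ d (p +ᵖ q)                   ≡⟨ cong₂ ℚ._+_ (ev-+ p q) (d-+ p q) ⟩
    ev p ℚ.+ ev q ℚ.+ (d p ℚ.+ d q)              ≡⟨ solve 4 (λ a b p q → a :+ b :+ (p :+ q) := a :+ p :+ (b :+ q)) refl (ev p) (ev q) (d p) (d q) ⟩
    ev p ℚ.+ d p ℚ.+ (ev q ℚ.+ d q)              ≡⟨ cong₂ ℚ._+_ (d-∷ a p) (d-∷ b q) ⟨
    d (a ∷ p) ℚ.+ d (b ∷ q)                      ∎

  d-map : ∀ a p → d (List.map (a ℚ.*_) p) ≡ a ℚ.* d p
  d-map a []      = ≡.sym (ℚ.*-zeroʳ a)
  d-map a (b ∷ p) = begin
    d (a ℚ.* b ∷ List.map (a ℚ.*_) p)                          ≡⟨ d-∷ (a ℚ.* b) (List.map (a ℚ.*_) p) ⟩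
    ev (List.map (a ℚ.*_) p) ℚ.+ d (List.map (a ℚ.*_) p)       ≡⟨ cong₂ ℚ._+_ (ev-map a p) (d-map a p) ⟩
    a ℚ.* ev p ℚ.+ a ℚ.* d p                                   ≡⟨ ℚ.*-distribˡ-+ a (ev p) (d p) ⟨
    a ℚ.* (ev p ℚ.+ d p)                                       ≡⟨ cong (a ℚ.*_) (d-∷ b p) ⟨
    a ℚ.* d (b ∷ p)                                            ∎

  d-* : ∀ p q → d (p *ᵖ q) ≡ d p ℚ.* ev q ℚ.+ ev p ℚ.* d q
  d-* []      q = ≡.sym (cong₂ ℚ._+_ (ℚ.*-zeroˡ (ev q)) (ℚ.*-zeroˡ (d q)))
  d-* (a ∷ p) q = begin
    d (List.map (a ℚ.*_) q +ᵖ (0ℚ ∷ p *ᵖ q)) ≡⟨ d-+ (List.map (a ℚ.*_) q) (0ℚ ∷ p *ᵖ q) ⟩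
    d (List.map (a ℚ.*_) q) ℚ.+ d (0ℚ ∷ p *ᵖ q) ≡⟨ cong₂ ℚ._+_ (d-map a q) (≡.trans (d-∷ 0ℚ (p *ᵖ q)) (cong₂ ℚ._+_ (ev-* p q) (d-* p q))) ⟩
    a ℚ.* d q ℚ.+ (ev p ℚ.* ev q ℚ.+ (d p ℚ.* ev q ℚ.+ ev p ℚ.* d q))
      ≡⟨ solve 5 (λ a p q p′ q′ → a :* q′ :+ (p :* q :+ (p′ :* q :+ p :* q′)) := (p :+ p′) :* q :+ (a :+ p) :* q′) refl a (ev p) (ev q) (d p) (d q) ⟩
    (ev p ℚ.+ d p) ℚ.* ev q ℚ.+ (a ℚ.+ ev p) ℚ.* d q ≡⟨ cong₂ (λ x y → x ℚ.* ev q ℚ.+ y ℚ.* d q) (d-∷ a p) (ev-∷ a p) ⟨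
    d (a ∷ p) ℚ.* ev q ℚ.+ ev (a ∷ p) ℚ.* d q ∎

  ev-u^ : ∀ k → ev (u ^ᵖ k) ≡ 1ℚ
  ev-u^ zero    = refl
  ev-u^ (suc k) = ≡.trans (ev-* u (u ^ᵖ k)) (≡.trans (ℚ.*-identityˡ _) (ev-u^ k))

  d-u^ : ∀ k → d (u ^ᵖ k) ≡ ι k
  d-u^ zero    = refl
  d-u^ (suc k) = ≡.trans (d-* u (u ^ᵖ k)) (cong₂ ℚ._+_ (≡.trans (ℚ.*-identityˡ _) (ev-u^ k)) (≡.trans (ℚ.*-identityˡ _) (d-u^ k)))

  d-∑ : ∀ {A : Set} (xs : List A) (f : A → Poly) → d (ℚ[u]⟦z⟧.∑ xs f) ≡ ∑ xs (d ∘ f)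
  d-∑ []       f = ≡.sym ∑-[]
  d-∑ (x ∷ xs) f = ≡.trans (d-+ (f x) (ℚ[u]⟦z⟧.∑ xs f)) (≡.trans (cong (λ y → d (f x) ℚ.+ y) (d-∑ xs f)) (≡.sym (∑-∷ x xs)))

  derivative-pointings : ∀ T → eval ((treePolynomial T) ′) 1ℚ ≡ + length (pointings T) / 1
  derivative-pointings T = begin
    d (constᵖ 1/n *ᵖ S) ≡⟨ d-* (constᵖ 1/n) S ⟩
    0ℚ ℚ.* ev S ℚ.+ ev (constᵖ 1/n) ℚ.* d S ≡⟨ cong₂ ℚ._+_ (ℚ.*-zeroˡ (ev S)) (cong₂ ℚ._*_ (ev-∷ 1/n []) (d-∑ auts (λ σ → u ^ᵖ fixedPoints σ))) ⟩
    0ℚ ℚ.+ (1/n ℚ.+ 0ℚ) ℚ.* ∑ auts (λ σ → d (u ^ᵖ fixedPoints σ))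
      ≡⟨ ≡.trans (ℚ.+-identityˡ _) (cong₂ ℚ._*_ (≡.trans (ℚ.+-identityʳ 1/n) (1/≡ n {{∣Aut∣≢0 p}})) (∑-cong auts λ {σ} _ → ≡.trans (d-u^ (fixedPoints σ)) (cong ι (fixedPoints≡fixedIn σ)))) ⟩
    1/ n ℚ.* ∑ auts (λ σ → ι (fixedIn (const true) σ)) ≡⟨ cong (1/ n ℚ.*_) (burnside T) ⟩
    1/ n ℚ.* (length (pointings T) ·ₙ cardᵗ T) ≡⟨ cong (1/ n ℚ.*_) (·ₙ≈ι* (length (pointings T)) (cardᵗ T)) ⟩
    1/ n ℚ.* (ι (length (pointings T)) ℚ.* cardᵗ T) ≡⟨ solve 3 (λ a b c → a :* (b :* c) := c :* a :* b) refl (1/ n) (ι (length (pointings T))) (cardᵗ T) ⟩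
    cardᵗ T ℚ.* 1/ n ℚ.* ι (length (pointings T)) ≡⟨ cong (ℚ._* ι (length (pointings T))) (card-recip p) ⟩
    1ℚ ℚ.* ι (length (pointings T)) ≡⟨ ℚ.*-identityˡ _ ⟩
    ι (length (pointings T)) ≡⟨ ι-/1 (length (pointings T)) ⟩
    + length (pointings T) / 1 ∎
    where
    open Normalised ℚ-ring 1ℚ 1/ ι-1/ using (card-recip)
    p = parentᵗ T
    auts = automorphisms p
    n = ∣Aut p ∣
    1/n : ℚ
    1/n = (+ 1 / n) {{∣Aut∣≢0 p}}
    S = ℚ[u]⟦z⟧.∑ auts (λ σ → u ^ᵖ fixedPoints σ)

theorem2 : (∀ n → D[z] n ≡ ℚ⟦z⟧.∑ (MSET≥2 n) (λ F → derangementProportion (parentᶠ F)))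
    × (∃! ℚ[u]⟦z⟧._≈ˢ_ IsCTreeSeries
    × (∀ Tc → IsCTreeSeries Tc →
    ∀ n → Tc n ≈ᵖ ℚ[u]⟦z⟧.∑ (polyaTrees n) treePolynomial))
    × (∀ T → eval ((treePolynomial T) ′) 1ℚ ≡ + length (pointings T) / 1)
theorem2 = Derangements.D-derangements , (CTrees.unique-solution , CTrees.coefficients) , Pointings.derivative-pointings
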